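{- Suppose that for every $\alpha>0$ we have $pn^\alpha\to\infty$ as $n\to\infty$, and that $q\ln n\to\infty$, where $q=1-p$. Then for every $d\in\mathbb{N}$ and every $\varepsilon>0$ there exists $n_0$ such that for all $n\ge n_0$, $$u_d(n,p)\ge(2-\varepsilon)\log_{\frac{1}{1-p}}(np).$$
   Context: $G(n,p)$ is the Erdős–Rényi random graph on $n$ labelled vertices (vertex set $V$), each edge present independently with probability $p=p(n)$; $\mathbb{P}_{n,p}$ is the corresponding probability and $q=1-p$. A diameter graph in $\mathbb{R}^d$ is a graph $(V,E)$ with $V\subset\mathbb{R}^d$ finite and $E=\{\{\mathbf{x},\mathbf{y}\}\subseteq V: |\mathbf{x}-\mathbf{y}|=\operatorname{diam}V\}$, where $\operatorname{diam}V=\max_{\mathbf{x},\mathbf{y}\in V}|\mathbf{x}-\mathbf{y}|$ (Euclidean norm); a graph is a diameter graph in $\mathbb{R}^d$ if it is isomorphic to one. $u_d(n,p)$ is the largest positive integer $k$ such that $\mathbb{P}_{n,p}\big(\exists W\subseteq V,\ |W|=k,\ G[W]$ is a diameter graph in $\mathbb{R}^d$ and $\chi(G[W])=d+1\big)>\frac12$, where $G[W]$ is the induced subgraph; if no such $k$ exists, $u_d(n,p)=0$. -}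

module Defs where

open import Algebra.Bundles using (CommutativeRing; Semiring)
import Algebra.Definitions.RawSemiring
open import Axiom.ExcludedMiddle using (ExcludedMiddle)
open import Data.Bool.Base using (if_then_else_)
open import Data.Fin.Base as Fin using (Fin)
import Data.Fin.Properties as Fin
open import Data.Fin.Subset using (Subset; inside; outside; _∈_; ∣_∣; ∁)
open import Data.List.Base as List
  using (List; []; _∷_; _++_; allFin; cartesianProduct; filter; foldr; length)
import Data.List.Extrema
open import Data.List.Membership.Propositional.Properties using (∈-filter⁻; ∈-lookup)
open import Data.Nat.Base as ℕ using (ℕ; zero; suc)
open import Data.Product.Base using (Σ; ∃; ∃-syntax; _×_; _,_; proj₁; proj₂; uncurry)
open import Data.Sum.Base using (_⊎_; inj₁; inj₂; swap)
import Data.Vec.Base as Vec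
open import Data.Vec.Functional using (Vector)
open import Function.Base using (_∘_)
open import Function.Bundles using (_↔_; _⇔_; Inverse)
open import Function.Definitions using (Injective)
open import Level using (0ℓ) renaming (suc to lsuc)
open import Relation.Binary.Bundles using (TotalOrder)
open import Relation.Binary.Core using (Rel)
import Relation.Binary.Construct.NonStrictToStrict as ToStrict
open import Relation.Binary.PropositionalEquality.Core as ≡ using (_≡_; _≢_)
open import Relation.Binary.Structures using (IsTotalOrder)
open import Relation.Nullary using (¬_; yes; no; does)
open import Relation.Unary using (Pred; Satisfiable)

record Graph (V : Set) : Set₁ where
  field
    Adj    : Rel V 0ℓ
    sym    : ∀ {u v} → Adj u v → Adj v u
    irrefl : ∀ {v} → ¬ Adj v v

open Graph public using (Adj)

_≅_ : {V W : Set} → Graph V → Graph W → Set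
_≅_ {V} {W} G H = Σ (V ↔ W) λ f →
  ∀ u v → Adj G u v ⇔ Adj H (Inverse.to f u) (Inverse.to f v)

_[_] : ∀ {n} → Graph (Fin n) → (W : Subset n) → Graph (∃[ v ] v ∈ W)
G [ W ] = record
  { Adj    = λ u v → Adj G (proj₁ u) (proj₁ v)
  ; sym    = Graph.sym G
  ; irrefl = Graph.irrefl G
  }

Colourable : {V : Set} → Graph V → ℕ → Set
Colourable {V} G k = ∃ λ (c : V → Fin k) → ∀ u v → Adj G u v → c u ≢ c v

HasChromaticNumber : {V : Set} → Graph V → ℕ → Set
HasChromaticNumber G k = Colourable G k × (∀ j → Colourable G j → k ℕ.≤ j)

-- The unordered pairs of vertices, each listed once with its smaller end first.
pairs : ∀ n → List (Fin n × Fin n)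
pairs n = filter (uncurry Fin._<?_) (cartesianProduct (allFin n) (allFin n))

EdgeSet : ℕ → Set
EdgeSet n = Subset (length (pairs n))

graph : ∀ {n} → EdgeSet n → Graph (Fin n)
graph {n} E = record
  { Adj    = λ u v → Joined u v ⊎ Joined v u
  ; sym    = swap
  ; irrefl = λ { (inj₁ j) → loopless j ; (inj₂ j) → loopless j }
  }
  where
  Joined : Fin n → Fin n → Set
  Joined u v = ∃[ e ] (e ∈ E × List.lookup (pairs n) e ≡ (u , v))

  increasing : ∀ e → uncurry Fin._<_ (List.lookup (pairs n) e)
  increasing e =
    proj₂ (∈-filter⁻ (uncurry Fin._<?_) {xs = cartesianProduct (allFin n) (allFin n)}
            (∈-lookup {xs = pairs n} e))

  loopless : ∀ {v} → ¬ Joined v v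
  loopless (e , _ , eq) = Fin.<-irrefl ≡.refl (≡.subst (uncurry Fin._<_) eq (increasing e))

subsets : ∀ m → List (Subset m)
subsets zero    = Vec.[] ∷ []
subsets (suc m) =
  List.map (inside Vec.∷_) (subsets m) ++ List.map (outside Vec.∷_) (subsets m)

IsLargest : (ℕ → Set) → ℕ → Set
IsLargest P k = P k × (∀ j → P j → j ℕ.≤ k)

-- The axioms of the real numbers, which determine them up to isomorphism.
record CompleteOrderedField : Set (lsuc 0ℓ) where
  infix 4 _≤_
  field
    commutativeRing : CommutativeRing 0ℓ 0ℓ

  open CommutativeRing commutativeRing public

  field
    0≉1          : ¬ (0# ≈ 1#)
    invertible   : ∀ x → ¬ (x ≈ 0#) → ∃[ y ] x * y ≈ 1#
    _≤_          : Rel Carrier 0ℓ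
    isTotalOrder : IsTotalOrder _≈_ _≤_
    +-monoˡ-≤    : ∀ z {x y} → x ≤ y → x + z ≤ y + z
    *-nonNeg     : ∀ {x y} → 0# ≤ x → 0# ≤ y → 0# ≤ x * y

  UpperBound : Pred Carrier 0ℓ → Pred Carrier 0ℓ
  UpperBound S b = ∀ x → S x → x ≤ b

  IsSupremum : Pred Carrier 0ℓ → Pred Carrier 0ℓ
  IsSupremum S s = UpperBound S s × (∀ b → UpperBound S b → s ≤ b)

  field
    complete : (S : Pred Carrier 0ℓ) → Satisfiable S → ∃ (UpperBound S) → ∃ (IsSupremum S)

  totalOrder : TotalOrder 0ℓ 0ℓ 0ℓ
  totalOrder = record { isTotalOrder = isTotalOrder }

module Real (em : ExcludedMiddle 0ℓ) (ℛ : CompleteOrderedField) where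

  open CompleteOrderedField ℛ public renaming (Carrier to ℝ)
  open ToStrict _≈_ _≤_ public using (_<_)
  open Algebra.Definitions.RawSemiring (Semiring.rawSemiring semiring) public using (_^_; sum)
  open Algebra.Definitions.RawSemiring (Semiring.rawSemiring semiring) using () renaming (_×_ to _·_)

  fromℕ : ℕ → ℝ
  fromℕ n = n · 1#

  2# : ℝ
  2# = fromℕ 2

  -- Inverses and suprema are made total: 0 ⁻¹ = 0, and sup S = 0 when S is
  -- empty or unbounded above.
  infix 9 _⁻¹
  _⁻¹ : ℝ → ℝ
  x ⁻¹ with em {x ≈ 0#}
  ... | yes _  = 0#
  ... | no x≉0 = proj₁ (invertible x x≉0)

  sup : Pred ℝ 0ℓ → ℝ
  sup S with em {∃ (IsSupremum S)}
  ... | yes (s , _) = s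
  ... | no _        = 0#

  -- The limit inferior, hence the limit of any convergent sequence.
  lim : (ℕ → ℝ) → ℝ
  lim a = sup λ t → ∃[ N ] ∀ n → N ℕ.≤ n → t ≤ a n

  sqrt : ℝ → ℝ
  sqrt x = sup λ t → t * t ≤ x

  -- exp x = lim (1 + x/n)ⁿ, with n shifted by one to avoid n = 0.
  exp : ℝ → ℝ
  exp x = lim λ n → (1# + x * fromℕ (suc n) ⁻¹) ^ suc n

  -- For x > 0 this is the t with exp t = x; for x ≤ 0 it is the junk value 0.
  ln : ℝ → ℝ
  ln x = sup λ t → exp t ≤ x

  log : (base x : ℝ) → ℝ
  log b x = ln x * ln b ⁻¹

  -- Real powers, for a positive base.
  pow : ℝ → ℝ → ℝ
  pow x α = exp (α * ln x)

  TendsTo+∞ : (ℕ → ℝ) → Set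
  TendsTo+∞ a = ∀ M → ∃[ N ] ∀ n → N ℕ.≤ n → M < a n

  Point : ℕ → Set
  Point d = Vector ℝ d

  _≋_ : ∀ {d} → Rel (Point d) 0ℓ
  x ≋ y = ∀ i → x i ≈ y i

  dist : ∀ {d} → Point d → Point d → ℝ
  dist x y = sqrt (sum λ i → (x i - y i) ^ 2)

  diam : ∀ {d m} → (Fin m → Point d) → ℝ
  diam {m = m} x = max 0# (List.map (λ (i , j) → dist (x i) (x j))
                                    (cartesianProduct (allFin m) (allFin m)))
    where open Data.List.Extrema totalOrder using (max)

  -- A finite V ⊂ ℝᵈ is given by an injective enumeration x of its points. An
  -- edge has two distinct ends, so a single point carries no loop although its
  -- diameter 0 is attained. Since dist is symmetric, the two disjuncts of Adj
  -- are equivalent; having both makes the relation symmetric by construction.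
  diameterGraph : ∀ {d m} → (Fin m → Point d) → Graph (Fin m)
  diameterGraph x = record
    { Adj    = λ i j → i ≢ j × (dist (x i) (x j) ≈ diam x ⊎ dist (x j) (x i) ≈ diam x)
    ; sym    = λ (i≢j , e) → i≢j ∘ ≡.sym , swap e
    ; irrefl = λ (v≢v , _) → v≢v ≡.refl
    }

  IsDiameterGraph : {V : Set} → ℕ → Graph V → Set
  IsDiameterGraph d G =
    ∃[ m ] ∃ λ (x : Fin m → Point d) → Injective _≡_ _≋_ x × G ≅ diameterGraph x

  -- ℙ n p A is the probability that G(n,p) has the property A.
  ℙ : ∀ n → ℝ → (Graph (Fin n) → Set) → ℝ
  ℙ n p A = foldr _+_ 0# (List.map weight (subsets (length (pairs n))))
    where
    weight : EdgeSet n → ℝ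
    weight E = if does (em {A (graph E)}) then p ^ ∣ E ∣ * (1# - p) ^ ∣ ∁ E ∣ else 0#

  HasDiameterSubgraph : ∀ {n} → ℕ → ℕ → Graph (Fin n) → Set
  HasDiameterSubgraph {n} d k G = ∃ λ (W : Subset n) →
    ∣ W ∣ ≡ k × IsDiameterGraph d (G [ W ]) × HasChromaticNumber (G [ W ]) (suc d)

  -- Such k are at most n, so a largest one exists as soon as there is any.
  u : ℕ → ℕ → ℝ → ℕ
  u d n p with em {∃ (IsLargest λ k → 1 ℕ.≤ k × 2# ⁻¹ < ℙ n p (HasDiameterSubgraph d k))}
  ... | yes (k , _) = k
  ... | no _        = 0

{-# OPTIONS --safe #-}

-- Split nearly all vertices into k = 2r + 1 blocks of size m. A choice φ of one
-- vertex per block is good if its vertices in the first d + 1 blocks form a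
-- clique and there are no other edges among its vertices. The subgraph induced
-- by a good φ is a diameter graph: take a regular simplex in ℝᵈ together with
-- points inside it. Let Y be the average over φ of 1[φ good] / ℙ[φ good]. Then
-- 𝔼Y = 1, and 1 ≥ 2Y − Y² gives ℙ[some φ is good] ≥ 2 − 𝔼Y². The choices φ and ψ
-- are correlated only through the l blocks where they agree, which contribute at
-- most p^(−C(d+1,2)) q^(−C(l,2)), and nothing if l ≤ 1. As C(l,2) ≤ l r, the
-- average over φ and ψ is bounded by a product over the blocks, and 𝔼Y² < 3/2 as
-- soon as 64 k⁴ p^(−C(d+1,2)) q^(−2r) < n². Taking logarithms, this holds for k
-- next to (2 − ε) ln(np) / ln(1/q), because ln(1/p), ln(1/q) and ln k are o(ln n).
module Submission where

open import Defs
open import Algebra.Bundles using (CommutativeRing; Semiring)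
import Algebra.Definitions.RawSemiring
import Algebra.Properties.CommutativeMonoid.Sum
import Algebra.Properties.CommutativeSemiring.Exp
import Algebra.Properties.Ring
import Algebra.Properties.Semiring.Exp
import Algebra.Properties.Semiring.Mult
import Algebra.Properties.Semiring.Sum
import Algebra.Solver.Ring
open import Algebra.Solver.Ring.AlmostCommutativeRing
  using (fromCommutativeRing; _-Raw-AlmostCommutative⟶_)
open import Axiom.ExcludedMiddle using (ExcludedMiddle)
open import Data.Bool.Base using (Bool; true; false; if_then_else_; _∧_)
open import Data.Empty using (⊥-elim)
open import Data.Fin.Base as Fin using (Fin; zero; suc; toℕ; splitAt; _↑ˡ_; _↑ʳ_)
import Data.Fin.Properties as Fin
open import Data.Fin.Subset
  using (Subset; inside; outside; _∈_; ∣_∣; ∁; _∩_; ⁅_⁆; ⊥; ⊤)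
import Data.Fin.Subset.Properties as Subset
open import Data.Integer.Base as ℤ using (ℤ; +_; -[1+_])
import Data.Integer.Properties as ℤ
open import Data.List.Base as List
  using (List; []; _∷_; _++_; allFin; cartesianProduct; filter; foldr; length)
import Data.List.Extrema
import Data.List.Membership.Propositional.Properties as List
import Data.List.Properties as List
import Data.List.Relation.Unary.All as All
import Data.List.Relation.Unary.All.Properties as All
import Data.List.Relation.Unary.Any as Any
import Data.List.Relation.Unary.Any.Properties as Any
open import Data.Maybe.Base using (Maybe; just; nothing)
open import Data.Nat.Base as ℕ using (ℕ; zero; suc)
open import Data.Nat.DivMod using (m≡m%n+[m/n]*n; m%n<n)
import Data.Nat.Properties as ℕ
open import Data.Product.Base using (_×_; ∃; ∃-syntax; _,_; proj₁; proj₂)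
open import Data.Sum.Base as Sum using (_⊎_; inj₁; inj₂; [_,_]′)
open import Data.Sum.Properties using (inj₁-injective)
open import Data.Vec.Base as Vec using (Vec; []; _∷_)
import Data.Vec.Properties as Vec
open import Function.Base using (_∘_; id)
open import Function.Bundles using (_↔_; _⇔_; Inverse; mk⇔; mk↔ₛ′; Equivalence)
open import Level using (0ℓ)
open import Relation.Binary.Bundles using (TotalOrder)
open import Relation.Binary.Definitions using (tri<; tri≈; tri>)
open import Relation.Binary.PropositionalEquality as ≡ using (_≡_; _≢_; module ≡-Reasoning)
import Relation.Binary.Reasoning.PartialOrder
open import Relation.Binary.Structures using (IsTotalOrder)
open import Relation.Nullary using (¬_; Dec; yes; no; does)
open import Relation.Unary using (Decidable; Pred)

-- The induced graph sought is a clique on d + 1 vertices with isolated vertices added: it has the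
-- required chromatic number, and its edges cost only a factor p^(-C(d+1,2)), which the growth
-- condition on p makes n^o(1). Up to that factor the problem is to find a large independent set.
-- The block of a vertex fixes its role, so two choices never make opposite demands on a shared
-- pair, and their joint moment is a product of factors 1/p and 1/q. The obstacle is that
-- q^(-C(l,2)) has an exponent quadratic in l, while the mean over independent overlaps factorises
-- only for linear exponents. The chord C(l,2) ≤ l r is exact at l = 0 and at l = 2r + 1, which is
-- where k odd enters. The bound 3/2 comes from 2 - 𝔼Y² > 1/2. The number 64 is 4 · 16: a factor 4k²
-- is lost because the block size is a quotient rounded down, for which n ≤ 2mk is used, and 16k² is
-- 4 (2k)², with 2k from letting each block contribute a factor 1 + 1/(2k).

-- A ring solver with integer coefficients.

module RingSolver (em : ExcludedMiddle 0ℓ) (ℛ : CompleteOrderedField) where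

  open Real em ℛ hiding (zero)
  open Algebra.Properties.Semiring.Mult semiring
    using (×-homo-+; ×1-homo-*)
  open Algebra.Properties.Ring ring
    using (-‿involutive; -0#≈0#; -‿distribˡ-*; -‿distribʳ-*; -‿+-comm)
  open Relation.Binary.Reasoning.PartialOrder (TotalOrder.poset totalOrder)

  private
    -- `fromℕ 1` unfolds to `1# + 0#`, so the coefficient 1 is read as `1#` itself; from 2 on the
    -- numerals are those of `fromℕ`. Thus `κ 1` matches `1#` and `κ 2` matches `2#` by computation.
    pos : ℕ → ℝ
    pos 0             = 0#
    pos 1             = 1#
    pos (suc (suc n)) = fromℕ (suc (suc n))

    pos≈fromℕ : ∀ n → pos n ≈ fromℕ n
    pos≈fromℕ 0             = refl
    pos≈fromℕ 1             = sym (+-identityʳ 1#)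
    pos≈fromℕ (suc (suc n)) = refl

    pos-homo-+ : ∀ m n → pos (m ℕ.+ n) ≈ pos m + pos n
    pos-homo-+ m n = begin-equality
      pos (m ℕ.+ n)       ≈⟨ pos≈fromℕ (m ℕ.+ n) ⟩
      fromℕ (m ℕ.+ n)     ≈⟨ ×-homo-+ 1# m n ⟩
      fromℕ m + fromℕ n   ≈⟨ +-cong (pos≈fromℕ m) (pos≈fromℕ n) ⟨
      pos m + pos n       ∎

    pos-homo-* : ∀ m n → pos (m ℕ.* n) ≈ pos m * pos n
    pos-homo-* m n = begin-equality
      pos (m ℕ.* n)       ≈⟨ pos≈fromℕ (m ℕ.* n) ⟩
      fromℕ (m ℕ.* n)     ≈⟨ ×1-homo-* m n ⟩
      fromℕ m * fromℕ n   ≈⟨ *-cong (pos≈fromℕ m) (pos≈fromℕ n) ⟨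
      pos m * pos n       ∎

    ⟦_⟧ : ℤ → ℝ
    ⟦ + n ⟧      = pos n
    ⟦ -[1+ n ] ⟧ = - pos (suc n)

    -‿homo : ∀ i → ⟦ ℤ.- i ⟧ ≈ - ⟦ i ⟧
    -‿homo -[1+ n ]    = sym (-‿involutive _)
    -‿homo (+ zero)    = sym -0#≈0#
    -‿homo (+ (suc n)) = refl

    ⊖-homo : ∀ m n → ⟦ m ℤ.⊖ n ⟧ ≈ pos m - pos n
    ⊖-homo m n with ℕ.≤-total n m
    ... | inj₁ n≤m = begin-equality
      ⟦ m ℤ.⊖ n ⟧                       ≡⟨ ≡.cong ⟦_⟧ (ℤ.⊖-≥ n≤m) ⟩
      pos (m ℕ.∸ n)                     ≈⟨ +-identityʳ _ ⟨
      pos (m ℕ.∸ n) + 0#                ≈⟨ +-congˡ (-‿inverseʳ (pos n)) ⟨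
      pos (m ℕ.∸ n) + (pos n - pos n)   ≈⟨ +-assoc _ _ _ ⟨
      pos (m ℕ.∸ n) + pos n - pos n     ≈⟨ +-congʳ (pos-homo-+ (m ℕ.∸ n) n) ⟨
      pos (m ℕ.∸ n ℕ.+ n) - pos n       ≡⟨ ≡.cong (λ k → pos k - pos n) (ℕ.m∸n+n≡m n≤m) ⟩
      pos m - pos n                     ∎
    ... | inj₂ m≤n = begin-equality
      ⟦ m ℤ.⊖ n ⟧                       ≡⟨ ≡.cong ⟦_⟧ (ℤ.⊖-≤ m≤n) ⟩
      ⟦ ℤ.- (+ (n ℕ.∸ m)) ⟧             ≈⟨ -‿homo (+ (n ℕ.∸ m)) ⟩
      - pos (n ℕ.∸ m)                   ≈⟨ +-identityˡ _ ⟨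
      0# - pos (n ℕ.∸ m)                ≈⟨ +-congʳ (-‿inverseʳ (pos m)) ⟨
      pos m - pos m - pos (n ℕ.∸ m)     ≈⟨ +-assoc _ _ _ ⟩
      pos m + (- pos m - pos (n ℕ.∸ m)) ≈⟨ +-congˡ (-‿+-comm _ _) ⟩
      pos m - (pos m + pos (n ℕ.∸ m))   ≈⟨ +-congˡ (-‿cong (pos-homo-+ m (n ℕ.∸ m))) ⟨
      pos m - pos (m ℕ.+ (n ℕ.∸ m))     ≡⟨ ≡.cong (λ k → pos m - pos k) (ℕ.m+[n∸m]≡n m≤n) ⟩
      pos m - pos n                     ∎

    +-homo : ∀ i j → ⟦ i ℤ.+ j ⟧ ≈ ⟦ i ⟧ + ⟦ j ⟧
    +-homo (+ m)    (+ n)    = pos-homo-+ m n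
    +-homo (+ m)    -[1+ n ] = ⊖-homo m (suc n)
    +-homo -[1+ m ] (+ n)    = trans (⊖-homo n (suc m)) (+-comm _ _)
    +-homo -[1+ m ] -[1+ n ] = begin-equality
      - pos (suc (suc (m ℕ.+ n)))     ≡⟨ ≡.cong (λ k → - pos (suc k)) (≡.sym (ℕ.+-suc m n)) ⟩
      - pos (suc m ℕ.+ suc n)         ≈⟨ -‿cong (pos-homo-+ (suc m) (suc n)) ⟩
      - (pos (suc m) + pos (suc n))   ≈⟨ -‿+-comm _ _ ⟨
      - pos (suc m) - pos (suc n)     ∎

    *-homo⁺ : ∀ m j → ⟦ + m ℤ.* j ⟧ ≈ pos m * ⟦ j ⟧
    *-homo⁺ m (+ n)    = trans (reflexive (≡.cong ⟦_⟧ (≡.sym (ℤ.pos-* m n)))) (pos-homo-* m n)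
    *-homo⁺ m -[1+ n ] = begin-equality
      ⟦ + m ℤ.* -[1+ n ] ⟧            ≡⟨ ≡.cong ⟦_⟧ (ℤ.neg-distribʳ-* (+ m) (+ suc n)) ⟨
      ⟦ ℤ.- (+ m ℤ.* (+ suc n)) ⟧     ≈⟨ -‿homo (+ m ℤ.* (+ suc n)) ⟩
      - ⟦ + m ℤ.* (+ suc n) ⟧         ≈⟨ -‿cong (*-homo⁺ m (+ suc n)) ⟩
      - (pos m * pos (suc n))         ≈⟨ -‿distribʳ-* _ _ ⟩
      pos m * - pos (suc n)           ∎

    *-homo : ∀ i j → ⟦ i ℤ.* j ⟧ ≈ ⟦ i ⟧ * ⟦ j ⟧
    *-homo (+ m)    j = *-homo⁺ m j
    *-homo -[1+ m ] j = begin-equality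
      ⟦ -[1+ m ] ℤ.* j ⟧              ≡⟨ ≡.cong ⟦_⟧ (ℤ.neg-distribˡ-* (+ suc m) j) ⟨
      ⟦ ℤ.- ((+ suc m) ℤ.* j) ⟧       ≈⟨ -‿homo ((+ suc m) ℤ.* j) ⟩
      - ⟦ (+ suc m) ℤ.* j ⟧           ≈⟨ -‿cong (*-homo⁺ (suc m) j) ⟩
      - (pos (suc m) * ⟦ j ⟧)         ≈⟨ -‿distribˡ-* _ _ ⟩
      - pos (suc m) * ⟦ j ⟧           ∎

    morphism : CommutativeRing.rawRing ℤ.+-*-commutativeRing
               -Raw-AlmostCommutative⟶ fromCommutativeRing commutativeRing
    morphism = record
      { ⟦_⟧    = ⟦_⟧
      ; +-homo = +-homo
      ; *-homo = *-homo
      ; -‿homo = -‿homo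
      ; 0-homo = refl
      ; 1-homo = refl
      }

    equal? : ∀ i j → Maybe (⟦ i ⟧ ≈ ⟦ j ⟧)
    equal? i j with i ℤ.≟ j
    ... | yes i≡j = just (reflexive (≡.cong ⟦_⟧ i≡j))
    ... | no  _   = nothing

  open Algebra.Solver.Ring
    (CommutativeRing.rawRing ℤ.+-*-commutativeRing)
    (fromCommutativeRing commutativeRing) morphism equal?
    public using (solve; _:=_; _:+_; _:*_; _:-_; :-_; _:^_; con; Polynomial)

  κ : ∀ {n} → ℕ → Polynomial n
  κ n = con (+ n)

-- Inequalities, inverses, powers and suprema in a complete ordered field.

module OrderedField (em : ExcludedMiddle 0ℓ) (ℛ : CompleteOrderedField) where

  open RingSolver em ℛ
  open Real em ℛ hiding (zero)
  open IsTotalOrder isTotalOrder public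
    using (antisym; total)
    renaming (refl to ≤-refl; trans to ≤-trans; reflexive to ≤-reflexive)
  open Relation.Binary.Reasoning.PartialOrder (TotalOrder.poset totalOrder) public
  open Algebra.Properties.Semiring.Exp semiring public
    using (^-homo-*; ^-assocʳ; ^-congˡ)
  open Algebra.Properties.CommutativeSemiring.Exp commutativeSemiring public
    using (^-distrib-*)
  open Algebra.Properties.Semiring.Mult semiring using (×1-homo-*)

  <⇒≤ : ∀ {x y} → x < y → x ≤ y
  <⇒≤ = proj₁

  ≰⇒> : ∀ {x y} → ¬ x ≤ y → y < x
  ≰⇒> {x} {y} x≰y with total x y
  ... | inj₁ x≤y = ⊥-elim (x≰y x≤y)
  ... | inj₂ y≤x = y≤x , λ y≈x → x≰y (≤-reflexive (sym y≈x))

  <⇒≱ : ∀ {x y} → x < y → ¬ y ≤ x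
  <⇒≱ (x≤y , x≉y) y≤x = x≉y (antisym x≤y y≤x)

  ≤-<-connex : ∀ x y → x ≤ y ⊎ y < x
  ≤-<-connex x y with em {x ≤ y}
  ... | yes x≤y = inj₁ x≤y
  ... | no  x≰y = inj₂ (≰⇒> x≰y)

  ≮⇒≥ : ∀ {x y} → ¬ x < y → y ≤ x
  ≮⇒≥ {x} {y} x≮y with ≤-<-connex y x
  ... | inj₁ y≤x = y≤x
  ... | inj₂ x<y = ⊥-elim (x≮y x<y)

  <-trans : ∀ {x y z} → x < y → y < z → x < z
  <-trans {x} {y} {z} x<y y<z = begin-strict x <⟨ x<y ⟩ y <⟨ y<z ⟩ z ∎

  <-≤-trans : ∀ {x y z} → x < y → y ≤ z → x < z
  <-≤-trans {x} {y} {z} x<y y≤z = begin-strict x <⟨ x<y ⟩ y ≤⟨ y≤z ⟩ z ∎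

  ≤-<-trans : ∀ {x y z} → x ≤ y → y < z → x < z
  ≤-<-trans {x} {y} {z} x≤y y<z = begin-strict x ≤⟨ x≤y ⟩ y <⟨ y<z ⟩ z ∎

  ≤-resp : ∀ {x x′ y y′} → x ≈ x′ → y ≈ y′ → x ≤ y → x′ ≤ y′
  ≤-resp x≈x′ y≈y′ x≤y = ≤-trans (≤-reflexive (sym x≈x′)) (≤-trans x≤y (≤-reflexive y≈y′))

  <-resp : ∀ {x x′ y y′} → x ≈ x′ → y ≈ y′ → x < y → x′ < y′
  <-resp x≈x′ y≈y′ (x≤y , x≉y) =
    ≤-resp x≈x′ y≈y′ x≤y , λ x′≈y′ → x≉y (trans x≈x′ (trans x′≈y′ (sym y≈y′)))

  +-monoˡ-< : ∀ z {x y} → x < y → x + z < y + z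
  +-monoˡ-< z {x} {y} (x≤y , x≉y) = +-monoˡ-≤ z x≤y , λ e → x≉y (begin-equality
    x         ≈⟨ solve 2 (λ x z → x := x :+ z :- z) refl x z ⟩
    x + z - z ≈⟨ +-congʳ e ⟩
    y + z - z ≈⟨ solve 2 (λ x z → x :+ z :- z := x) refl y z ⟩
    y         ∎)

  -- Most inequalities below go through this form: the difference of the two sides is exhibited as a
  -- visibly nonnegative `c`, and the ring solver checks the identity.
  ≤-by : ∀ {x y c} → 0# ≤ c → y - x ≈ c → x ≤ y
  ≤-by {x} {y} {c} 0≤c e =
    ≤-resp (+-identityˡ x) (trans (+-congʳ (sym e)) (solve 2 (λ x y → y :- x :+ x := y) refl x y))
      (+-monoˡ-≤ x 0≤c)

  <-by : ∀ {x y c} → 0# < c → y - x ≈ c → x < y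
  <-by {x} {y} {c} 0<c e =
    <-resp (+-identityˡ x) (trans (+-congʳ (sym e)) (solve 2 (λ x y → y :- x :+ x := y) refl x y))
      (+-monoˡ-< x 0<c)

  ≤⇒0≤- : ∀ {x y} → x ≤ y → 0# ≤ y - x
  ≤⇒0≤- {x} {y} x≤y = ≤-resp (-‿inverseʳ x) refl (+-monoˡ-≤ (- x) x≤y)

  <⇒0<- : ∀ {x y} → x < y → 0# < y - x
  <⇒0<- {x} {y} x<y = <-resp (-‿inverseʳ x) refl (+-monoˡ-< (- x) x<y)

  +-nonNeg : ∀ {x y} → 0# ≤ x → 0# ≤ y → 0# ≤ x + y
  +-nonNeg {x} {y} 0≤x 0≤y = begin
    0#      ≤⟨ 0≤y ⟩
    y       ≈⟨ +-identityˡ y ⟨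
    0# + y  ≤⟨ +-monoˡ-≤ y 0≤x ⟩
    x + y   ∎

  +-pos-nonNeg : ∀ {x y} → 0# < x → 0# ≤ y → 0# < x + y
  +-pos-nonNeg {x} {y} 0<x 0≤y = begin-strict
    0#      ≤⟨ 0≤y ⟩
    y       ≈⟨ +-identityˡ y ⟨
    0# + y  <⟨ +-monoˡ-< y 0<x ⟩
    x + y   ∎

  +-mono-≤ : ∀ {x y u v} → x ≤ y → u ≤ v → x + u ≤ y + v
  +-mono-≤ {x} {y} {u} {v} x≤y u≤v = ≤-by (+-nonNeg (≤⇒0≤- x≤y) (≤⇒0≤- u≤v))
    (solve 4 (λ x y u v → (y :+ v) :- (x :+ u) := (y :- x) :+ (v :- u)) refl x y u v)

  +-monoʳ-≤ : ∀ z {x y} → x ≤ y → z + x ≤ z + y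
  +-monoʳ-≤ z = +-mono-≤ ≤-refl

  -‿anti-≤ : ∀ {x y} → x ≤ y → - y ≤ - x
  -‿anti-≤ {x} {y} x≤y = ≤-by (≤⇒0≤- x≤y)
    (solve 2 (λ x y → :- x :- (:- y) := y :- x) refl x y)

  *-monoˡ-≤ : ∀ {z x y} → 0# ≤ z → x ≤ y → x * z ≤ y * z
  *-monoˡ-≤ {z} {x} {y} 0≤z x≤y = ≤-by (*-nonNeg (≤⇒0≤- x≤y) 0≤z)
    (solve 3 (λ x y z → y :* z :- x :* z := (y :- x) :* z) refl x y z)

  *-monoʳ-≤ : ∀ {z x y} → 0# ≤ z → x ≤ y → z * x ≤ z * y
  *-monoʳ-≤ {z} {x} {y} 0≤z x≤y = ≤-resp (*-comm x z) (*-comm y z) (*-monoˡ-≤ 0≤z x≤y)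

  *-mono-≤ : ∀ {x y u v} → 0# ≤ x → x ≤ y → 0# ≤ u → u ≤ v → x * u ≤ y * v
  *-mono-≤ {x} {y} {u} {v} 0≤x x≤y 0≤u u≤v =
    ≤-trans (*-monoˡ-≤ 0≤u x≤y) (*-monoʳ-≤ (≤-trans 0≤x x≤y) u≤v)

  pos⇒≉0 : ∀ {x} → 0# < x → ¬ x ≈ 0#
  pos⇒≉0 0<x = proj₂ 0<x ∘ sym

  ⁻¹-inverseʳ : ∀ {x} → ¬ x ≈ 0# → x * x ⁻¹ ≈ 1#
  ⁻¹-inverseʳ {x} x≉0 with em {x ≈ 0#}
  ... | yes x≈0 = ⊥-elim (x≉0 x≈0)
  ... | no  x≉0 = proj₂ (invertible x x≉0)

  ⁻¹-inverseˡ : ∀ {x} → ¬ x ≈ 0# → x ⁻¹ * x ≈ 1#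
  ⁻¹-inverseˡ x≉0 = trans (*-comm _ _) (⁻¹-inverseʳ x≉0)

  x*x⁻¹ : ∀ {x} → 0# < x → x * x ⁻¹ ≈ 1#
  x*x⁻¹ = ⁻¹-inverseʳ ∘ pos⇒≉0

  *-pos : ∀ {x y} → 0# < x → 0# < y → 0# < x * y
  *-pos {x} {y} 0<x 0<y = *-nonNeg (<⇒≤ 0<x) (<⇒≤ 0<y) , λ e → proj₂ 0<y (begin-equality
    0#             ≈⟨ zeroˡ (x ⁻¹) ⟨
    0# * x ⁻¹      ≈⟨ *-congʳ e ⟩
    x * y * x ⁻¹   ≈⟨ solve 3 (λ x y z → x :* y :* z := x :* z :* y) refl x y (x ⁻¹) ⟩
    x * x ⁻¹ * y   ≈⟨ *-congʳ (x*x⁻¹ 0<x) ⟩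
    1# * y         ≈⟨ *-identityˡ y ⟩
    y              ∎)

  *-monoˡ-< : ∀ {z x y} → 0# < z → x < y → x * z < y * z
  *-monoˡ-< {z} {x} {y} 0<z x<y = <-by (*-pos (<⇒0<- x<y) 0<z)
    (solve 3 (λ x y z → y :* z :- x :* z := (y :- x) :* z) refl x y z)

  *-cancelʳ-≤ : ∀ {z x y} → 0# < z → x * z ≤ y * z → x ≤ y
  *-cancelʳ-≤ {z} {x} {y} 0<z xz≤yz = ≮⇒≥ λ y<x → <⇒≱ (*-monoˡ-< 0<z y<x) xz≤yz

  *-cancelʳ-< : ∀ {z x y} → 0# ≤ z → x * z < y * z → x < y
  *-cancelʳ-< {z} {x} {y} 0≤z xz<yz = ≰⇒> λ y≤x → <⇒≱ xz<yz (*-monoˡ-≤ 0≤z y≤x)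

  0≤x*x : ∀ x → 0# ≤ x * x
  0≤x*x x with total 0# x
  ... | inj₁ 0≤x = *-nonNeg 0≤x 0≤x
  ... | inj₂ x≤0 = ≤-resp refl (solve 1 (λ x → (κ 0 :- x) :* (κ 0 :- x) := x :* x) refl x)
                     (*-nonNeg (≤⇒0≤- x≤0) (≤⇒0≤- x≤0))

  0<1 : 0# < 1#
  0<1 = ≤-resp refl (*-identityˡ 1#) (0≤x*x 1#) , 0≉1

  ⁻¹-pos : ∀ {x} → 0# < x → 0# < x ⁻¹
  ⁻¹-pos {x} 0<x = *-cancelʳ-< (<⇒≤ 0<x)
    (<-resp (sym (zeroˡ x)) (sym (⁻¹-inverseˡ (pos⇒≉0 0<x))) 0<1)

  *⁻¹-cancel : ∀ {y} x → 0# < y → x * y ⁻¹ * y ≈ x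
  *⁻¹-cancel {y} x 0<y =
    trans (*-assoc x (y ⁻¹) y) (trans (*-congˡ (⁻¹-inverseˡ (pos⇒≉0 0<y))) (*-identityʳ x))

  ≤-div : ∀ {x y z} → 0# < z → x * z ≤ y → x ≤ y * z ⁻¹
  ≤-div {x} {y} {z} 0<z xz≤y =
    *-cancelʳ-≤ 0<z (≤-trans xz≤y (≤-reflexive (sym (*⁻¹-cancel y 0<z))))

  div-≤ : ∀ {x y z} → 0# < z → x ≤ y * z → x * z ⁻¹ ≤ y
  div-≤ {x} {y} {z} 0<z x≤yz =
    *-cancelʳ-≤ 0<z (≤-trans (≤-reflexive (*⁻¹-cancel x 0<z)) x≤yz)

  x≤1⇒1≤x⁻¹ : ∀ {x} → 0# < x → x ≤ 1# → 1# ≤ x ⁻¹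
  x≤1⇒1≤x⁻¹ {x} 0<x x≤1 =
    ≤-resp refl (*-identityˡ _) (≤-div 0<x (≤-resp (sym (*-identityˡ x)) refl x≤1))

  ^-nonNeg : ∀ {x} n → 0# ≤ x → 0# ≤ x ^ n
  ^-nonNeg zero    0≤x = <⇒≤ 0<1
  ^-nonNeg (suc n) 0≤x = *-nonNeg 0≤x (^-nonNeg n 0≤x)

  ^-pos : ∀ {x} n → 0# < x → 0# < x ^ n
  ^-pos zero    0<x = 0<1
  ^-pos (suc n) 0<x = *-pos 0<x (^-pos n 0<x)

  ^-monoˡ-≤ : ∀ {x y} n → 0# ≤ x → x ≤ y → x ^ n ≤ y ^ n
  ^-monoˡ-≤ zero    0≤x x≤y = ≤-refl
  ^-monoˡ-≤ (suc n) 0≤x x≤y = *-mono-≤ 0≤x x≤y (^-nonNeg n 0≤x) (^-monoˡ-≤ n 0≤x x≤y)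

  1^n : ∀ n → 1# ^ n ≈ 1#
  1^n zero    = refl
  1^n (suc n) = trans (*-identityˡ _) (1^n n)

  1≤x^n : ∀ {x} n → 1# ≤ x → 1# ≤ x ^ n
  1≤x^n n 1≤x = ≤-resp (1^n n) refl (^-monoˡ-≤ n (<⇒≤ 0<1) 1≤x)

  x^n≤1 : ∀ {x} n → 0# ≤ x → x ≤ 1# → x ^ n ≤ 1#
  x^n≤1 n 0≤x x≤1 = ≤-resp refl (1^n n) (^-monoˡ-≤ n 0≤x x≤1)

  ^-monoʳ-≤ : ∀ {x m n} → 1# ≤ x → m ℕ.≤ n → x ^ m ≤ x ^ n
  ^-monoʳ-≤ {n = n} 1≤x ℕ.z≤n       = 1≤x^n n 1≤x
  ^-monoʳ-≤         1≤x (ℕ.s≤s m≤n) =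
    *-monoʳ-≤ (≤-trans (<⇒≤ 0<1) 1≤x) (^-monoʳ-≤ 1≤x m≤n)

  x^n*x⁻¹^n : ∀ {x} n → 0# < x → x ^ n * x ⁻¹ ^ n ≈ 1#
  x^n*x⁻¹^n {x} n 0<x = begin-equality
    x ^ n * x ⁻¹ ^ n   ≈⟨ ^-distrib-* x (x ⁻¹) n ⟨
    (x * x ⁻¹) ^ n     ≈⟨ ^-congˡ n (x*x⁻¹ 0<x) ⟩
    1# ^ n             ≈⟨ 1^n n ⟩
    1#                 ∎

  0≤fromℕ : ∀ n → 0# ≤ fromℕ n
  0≤fromℕ zero    = ≤-refl
  0≤fromℕ (suc n) = +-nonNeg (<⇒≤ 0<1) (0≤fromℕ n)

  0<fromℕ : ∀ {n} → 0 ℕ.< n → 0# < fromℕ n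
  0<fromℕ {suc n} _ = +-pos-nonNeg 0<1 (0≤fromℕ n)

  0<2 : 0# < 2#
  0<2 = 0<fromℕ {2} (ℕ.s≤s ℕ.z≤n)

  fromℕ-mono-≤ : ∀ {m n} → m ℕ.≤ n → fromℕ m ≤ fromℕ n
  fromℕ-mono-≤ {n = n} ℕ.z≤n = 0≤fromℕ n
  fromℕ-mono-≤ (ℕ.s≤s m≤n)   = +-mono-≤ ≤-refl (fromℕ-mono-≤ m≤n)

  fromℕ-mono-< : ∀ {m n} → m ℕ.< n → fromℕ m < fromℕ n
  fromℕ-mono-< {m} m<n = <-≤-trans
    (<-by 0<1 (solve 1 (λ m → (κ 1 :+ m) :- m := κ 1) refl (fromℕ m)))
    (fromℕ-mono-≤ m<n)

  fromℕ-cancel-≤ : ∀ {m n} → fromℕ m ≤ fromℕ n → m ℕ.≤ n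
  fromℕ-cancel-≤ {m} {n} p with ℕ.≤-<-connex m n
  ... | inj₁ m≤n = m≤n
  ... | inj₂ n<m = ⊥-elim (<⇒≱ (fromℕ-mono-< n<m) p)

  fromℕ-* : ∀ m n → fromℕ (m ℕ.* n) ≈ fromℕ m * fromℕ n
  fromℕ-* = ×1-homo-*

  -- By completeness the default branch of `sup` is not taken once one element and one upper bound
  -- are known.
  supremum : ∀ (S : Pred ℝ 0ℓ) {x b} → S x → UpperBound S b → IsSupremum S (sup S)
  supremum S {x} {b} x∈S b-upper with em {∃ (IsSupremum S)}
  ... | yes (s , s-sup) = s-sup
  ... | no  ¬sup        = ⊥-elim (¬sup (complete S (x , x∈S) (b , b-upper)))

  -- Otherwise the natural numbers have a supremum s. Since n + 1 ≤ s for all n, also s - 1 is an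
  -- upper bound, which contradicts leastness.
  archimedean : ∀ x → ∃[ n ] x < fromℕ n
  archimedean x with em {∃ λ n → x < fromℕ n}
  ... | yes p = p
  ... | no ¬p = ⊥-elim (<⇒≱ (<-by 0<1 (solve 1 (λ s → s :- (s :- κ 1) := κ 1) refl s)) s≤s-1)
    where
    S : Pred ℝ 0ℓ
    S y = ∃[ n ] y ≈ fromℕ n

    S-sup : ∃ (IsSupremum S)
    S-sup = complete S (0# , 0 , refl)
      (x , λ y → λ (n , y≈n) → ≤-trans (≤-reflexive y≈n) (≮⇒≥ λ x<n → ¬p (n , x<n)))

    s : ℝ
    s = proj₁ S-sup

    s≤s-1 : s ≤ s - 1#
    s≤s-1 = proj₂ (proj₂ S-sup) (s - 1#) λ y → λ (n , y≈n) →
      ≤-by (≤⇒0≤- (proj₁ (proj₂ S-sup) (fromℕ (suc n)) (suc n , refl)))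
        (trans (+-congˡ (-‿cong y≈n))
          (solve 2 (λ s y → (s :- κ 1) :- y := s :- (κ 1 :+ y)) refl s (fromℕ n)))

  bernoulli : ∀ n {x} → 0# ≤ 1# + x → 1# + fromℕ n * x ≤ (1# + x) ^ n
  bernoulli zero    {x} _     = ≤-reflexive (solve 1 (λ x → κ 1 :+ κ 0 :* x := κ 1) refl x)
  bernoulli (suc n) {x} 0≤1+x = begin
    1# + fromℕ (suc n) * x         ≤⟨ ≤-by (*-nonNeg (0≤fromℕ n) (0≤x*x x))
                                       (solve 2 (λ n x → (κ 1 :+ x) :* (κ 1 :+ n :* x)
                                          :- (κ 1 :+ (κ 1 :+ n) :* x) := n :* (x :* x))
                                        refl (fromℕ n) x) ⟩
    (1# + x) * (1# + fromℕ n * x)  ≤⟨ *-monoʳ-≤ 0≤1+x (bernoulli n 0≤1+x) ⟩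
    (1# + x) ^ suc n               ∎

-- Square roots.

module SquareRoot (em : ExcludedMiddle 0ℓ) (ℛ : CompleteOrderedField) where

  open RingSolver em ℛ
  open Real em ℛ hiding (zero)
  open OrderedField em ℛ

  private
    module _ {x : ℝ} (0≤x : 0# ≤ x) where

      s y : ℝ
      s = sqrt x
      y = x + 1#

      0<y : 0# < y
      0<y = <-resp refl (+-comm 1# x) (+-pos-nonNeg 0<1 0≤x)

      s-sup : IsSupremum (λ t → t * t ≤ x) s
      s-sup = supremum _ {0#} {y} (≤-resp (sym (zeroˡ 0#)) refl 0≤x) λ t t²≤x →
        ≮⇒≥ λ y<t → <⇒≱
          (begin-strict
            x      <⟨ <-by 0<1 (solve 1 (λ x → (x :+ κ 1) :- x := κ 1) refl x) ⟩
            y      ≈⟨ *-identityʳ y ⟨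
            y * 1# ≤⟨ *-mono-≤ (<⇒≤ 0<y) (<⇒≤ y<t) (<⇒≤ 0<1)
                        (≤-trans (≤-by 0≤x (solve 1 (λ x → (x :+ κ 1) :- κ 1 := x) refl x)) (<⇒≤ y<t)) ⟩
            t * t  ∎)
          t²≤x

      0≤s : 0# ≤ s
      0≤s = proj₁ s-sup 0# (≤-resp (sym (zeroˡ 0#)) refl 0≤x)

      -- A secant step from s towards y > √x: t − s and x − t² have the sign of x − s².
      w t : ℝ
      w = (s + y) ⁻¹
      t = (s * y + x) * w

      0<s+y : 0# < s + y
      0<s+y = <-resp refl (+-comm y s) (+-pos-nonNeg 0<y 0≤s)

      0<w : 0# < w
      0<w = ⁻¹-pos 0<s+y

      w-inv : (s + y) * w ≈ 1#
      w-inv = x*x⁻¹ 0<s+y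

      y²-x : 0# < y * y - x
      y²-x = <-resp refl
        (solve 1 (λ x → κ 1 :+ (x :* x :+ x) := (x :+ κ 1) :* (x :+ κ 1) :- x) refl x)
        (+-pos-nonNeg 0<1 (+-nonNeg (0≤x*x x) 0≤x))

      t-s : t - s ≈ (x - s * s) * w
      t-s = begin-equality
        (s * y + x) * w - s                  ≈⟨ +-congˡ (-‿cong (*-identityʳ s)) ⟨
        (s * y + x) * w - s * 1#             ≈⟨ +-congˡ (-‿cong (*-congˡ w-inv)) ⟨
        (s * y + x) * w - s * ((s + y) * w)  ≈⟨ solve 4 (λ s y x w →
            (s :* y :+ x) :* w :- s :* ((s :+ y) :* w) := (x :- s :* s) :* w) refl s y x w ⟩
        (x - s * s) * w                      ∎

      x-t² : x - t * t ≈ (x - s * s) * (w * w * (y * y - x))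
      x-t² = begin-equality
        x - t * t                                     ≈⟨ +-congʳ (trans (*-congˡ (*-identityˡ 1#)) (*-identityʳ x)) ⟨
        x * (1# * 1#) - t * t                         ≈⟨ +-congʳ (*-congˡ (*-cong w-inv w-inv)) ⟨
        x * ((s + y) * w * ((s + y) * w)) - t * t     ≈⟨ solve 4 (λ s y x w →
            x :* ((s :+ y) :* w :* ((s :+ y) :* w)) :- (s :* y :+ x) :* w :* ((s :* y :+ x) :* w)
            := (x :- s :* s) :* (w :* w :* (y :* y :- x))) refl s y x w ⟩
        (x - s * s) * (w * w * (y * y - x))           ∎

      0<w²c : 0# < w * w * (y * y - x)
      0<w²c = *-pos (*-pos 0<w 0<w) y²-x

      -- If s² < x, the secant point `t` is an element of the set beyond its supremum s. In the
      -- opposite case, treated next, `t` is an upper bound below s.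
      ¬s²<x : ¬ s * s < x
      ¬s²<x s²<x = <⇒≱ (<-by (*-pos (<⇒0<- s²<x) 0<w) t-s)
        (proj₁ s-sup t (≤-by (*-nonNeg (<⇒≤ (<⇒0<- s²<x)) (<⇒≤ 0<w²c)) x-t²))

      ¬x<s² : ¬ x < s * s
      ¬x<s² x<s² = <⇒≱ t<s (proj₂ s-sup t λ r r²≤x → ≮⇒≥ λ t<r → <⇒≱ x<t²
          (≤-trans (*-mono-≤ 0≤t (<⇒≤ t<r) 0≤t (<⇒≤ t<r)) r²≤x))
        where
        flip : ∀ {a b c} → a - b ≈ (x - s * s) * c → b - a ≈ (s * s - x) * c
        flip {a} {b} {c} e = begin-equality
          b - a                  ≈⟨ solve 2 (λ a b → b :- a := :- (a :- b)) refl a b ⟩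
          - (a - b)              ≈⟨ -‿cong e ⟩
          - ((x - s * s) * c)    ≈⟨ solve 3 (λ x s c → :- ((x :- s :* s) :* c) := (s :* s :- x) :* c) refl x s c ⟩
          (s * s - x) * c        ∎
        t<s : t < s
        t<s = <-by (*-pos (<⇒0<- x<s²) 0<w) (flip t-s)
        x<t² : x < t * t
        x<t² = <-by (*-pos (<⇒0<- x<s²) 0<w²c) (flip x-t²)
        0≤t : 0# ≤ t
        0≤t = *-nonNeg (+-nonNeg (*-nonNeg 0≤s (<⇒≤ 0<y)) 0≤x) (<⇒≤ 0<w)

  0≤sqrt : ∀ {x} → 0# ≤ x → 0# ≤ sqrt x
  0≤sqrt = 0≤s

  sqrt*sqrt : ∀ {x} → 0# ≤ x → sqrt x * sqrt x ≈ x
  sqrt*sqrt 0≤x = antisym (≮⇒≥ (¬x<s² 0≤x)) (≮⇒≥ (¬s²<x 0≤x))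

  sqrt-cancel-≤ : ∀ {x y} → 0# ≤ x → 0# ≤ y → sqrt x ≤ sqrt y → x ≤ y
  sqrt-cancel-≤ 0≤x 0≤y p = ≤-resp (sqrt*sqrt 0≤x) (sqrt*sqrt 0≤y)
    (*-mono-≤ (0≤sqrt 0≤x) p (0≤sqrt 0≤x) p)

  sqrt-mono-≤ : ∀ {x y} → 0# ≤ x → x ≤ y → sqrt x ≤ sqrt y
  sqrt-mono-≤ {x} {y} 0≤x x≤y = ≮⇒≥ λ q → <⇒≱
    (begin-strict
      sqrt y * sqrt y  ≤⟨ *-monoʳ-≤ (0≤sqrt 0≤y) (<⇒≤ q) ⟩
      sqrt y * sqrt x  <⟨ *-monoˡ-< (≤-<-trans (0≤sqrt 0≤y) q) q ⟩
      sqrt x * sqrt x  ∎)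
    (≤-resp (sym (sqrt*sqrt 0≤x)) (sym (sqrt*sqrt 0≤y)) x≤y)
    where
    0≤y : 0# ≤ y
    0≤y = ≤-trans 0≤x x≤y

-- Properties that hold for all large n.

module Eventual (em : ExcludedMiddle 0ℓ) (ℛ : CompleteOrderedField) where

  open Real em ℛ hiding (zero)
  open OrderedField em ℛ

  Eventually : (ℕ → Set) → Set
  Eventually P = ∃[ N ] ∀ n → N ℕ.≤ n → P n

  infixr 4 _⋏_
  _⋏_ : ∀ {P Q} → Eventually P → Eventually Q → Eventually (λ n → P n × Q n)
  (M , p) ⋏ (N , q) = M ℕ.⊔ N , λ n h →
    p n (ℕ.≤-trans (ℕ.m≤m⊔n M N) h) , q n (ℕ.≤-trans (ℕ.m≤n⊔m M N) h)

  eventually-map : ∀ {P Q : ℕ → Set} → (∀ n → P n → Q n) → Eventually P → Eventually Q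
  eventually-map f (N , p) = N , λ n h → f n (p n h)

  eventually-∃ : ∀ {P} → Eventually P → ∃ P
  eventually-∃ (N , p) = N , p N ℕ.≤-refl

  eventually-> : ∀ x → Eventually (λ n → x < fromℕ n)
  eventually-> x = proj₁ (archimedean x) , λ n N≤n →
    <-≤-trans (proj₂ (archimedean x)) (fromℕ-mono-≤ N≤n)

-- The laws of exp and ln that serve as interfaces.

module Laws (em : ExcludedMiddle 0ℓ) (ℛ : CompleteOrderedField) where

  open Real em ℛ hiding (exp; ln)

  -- The functional equation appears as two inequalities with a strict gap between `x + y` and `z`.
  -- The gap absorbs the cross term of the finite approximations, and the logarithm, being a
  -- supremum, closes it again by density.
  record IsExponential (exp : ℝ → ℝ) : Set where
    field
      0<exp       : ∀ x → 0# < exp x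
      1+x≤exp     : ∀ x → 1# + x ≤ exp x
      exp*exp-    : ∀ x → exp x * exp (- x) ≤ 1#
      exp*exp≤exp : ∀ {x y z} → x + y < z → exp x * exp y ≤ exp z
      exp≤exp*exp : ∀ {x y z} → z < x + y → exp z ≤ exp x * exp y

  _IsSupLogarithmOf_ : (ln exp : ℝ → ℝ) → Set
  ln IsSupLogarithmOf exp = ∀ x → ln x ≡ sup λ t → exp t ≤ x

  record IsLogarithm (exp ln : ℝ → ℝ) : Set where
    field
      0<exp     : ∀ x → 0# < exp x
      ln-exp≤   : ∀ x → ln (exp x) ≤ x
      ln-mono-≤ : ∀ {x y} → 0# < x → x ≤ y → ln x ≤ ln y
      ln-*      : ∀ {x y} → 0# < x → 0# < y → ln (x * y) ≈ ln x + ln y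
      ln≤x-1    : ∀ {x} → 0# < x → ln x ≤ x - 1#

-- The exponential function as the limit of (1 + x/n)^n.

module Exponential (em : ExcludedMiddle 0ℓ) (ℛ : CompleteOrderedField) where

  open RingSolver em ℛ
  open Real em ℛ hiding (zero)
  open OrderedField em ℛ
  open Eventual em ℛ

  factor : ℝ → ℕ → ℝ
  factor x n = 1# + x * fromℕ (suc n) ⁻¹

  approx : ℝ → ℕ → ℝ
  approx x n = factor x n ^ suc n

  -- From such an index on `factor x n` is positive even for negative `x`, so its powers can be
  -- compared.
  record Large (x : ℝ) (n : ℕ) : Set where
    constructor mk
    field
      -x<1+n : - x < fromℕ (suc n)

  open Large

  private
    i : ℕ → ℝ
    i n = fromℕ (suc n) ⁻¹

    0<1+n : ∀ n → 0# < fromℕ (suc n)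
    0<1+n n = 0<fromℕ {suc n} (ℕ.s≤s ℕ.z≤n)

    0<i : ∀ n → 0# < i n
    0<i n = ⁻¹-pos (0<1+n n)

    i-inv : ∀ n → fromℕ (suc n) * i n ≈ 1#
    i-inv n = x*x⁻¹ (0<1+n n)

    [1+n]*factor : ∀ x n → fromℕ (suc n) * factor x n ≈ fromℕ (suc n) + x
    [1+n]*factor x n = begin-equality
      fromℕ (suc n) * factor x n                   ≈⟨ solve 3 (λ m x j →
          m :* (κ 1 :+ x :* j) := m :+ x :* (m :* j)) refl (fromℕ (suc n)) x (i n) ⟩
      fromℕ (suc n) + x * (fromℕ (suc n) * i n)    ≈⟨ +-congˡ (*-congˡ (i-inv n)) ⟩
      fromℕ (suc n) + x * 1#                       ≈⟨ +-congˡ (*-identityʳ x) ⟩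
      fromℕ (suc n) + x                            ∎

    0<factor : ∀ {x n} → Large x n → 0# < factor x n
    0<factor {x} {n} large = *-cancelʳ-< (<⇒≤ (0<1+n n)) (<-resp (sym (zeroˡ _))
      (trans (solve 2 (λ m x → m :- (:- x) := m :+ x) refl (fromℕ (suc n)) x)
        (trans (sym ([1+n]*factor x n)) (*-comm _ _)))
      (<⇒0<- (-x<1+n large)))

    0<approx : ∀ {x n} → Large x n → 0# < approx x n
    0<approx {n = n} large = ^-pos (suc n) (0<factor large)

  -- The tangent line at b of the convex function t ↦ tᵐ⁺¹.
  tangent : ∀ m {a b} → 0# ≤ a → 0# ≤ b →
            b ^ m * (fromℕ (suc m) * a - fromℕ m * b) ≤ a ^ suc m
  tangent zero    {a} {b} _   _   = ≤-reflexive
    (solve 2 (λ a b → κ 1 :* ((κ 1 :+ κ 0) :* a :- κ 0 :* b) := a :* κ 1) refl a b)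
  tangent (suc m) {a} {b} 0≤a 0≤b = begin
    b ^ suc m * (fromℕ (2 ℕ.+ m) * a - fromℕ (suc m) * b)
      ≤⟨ ≤-by (*-nonNeg (*-nonNeg (0≤fromℕ (suc m)) (^-nonNeg m 0≤b)) (0≤x*x (a - b)))
          (solve 4 (λ a b c m →
             a :* (c :* ((κ 1 :+ m) :* a :- m :* b))
               :- (b :* c) :* ((κ 1 :+ (κ 1 :+ m)) :* a :- (κ 1 :+ m) :* b)
             := ((κ 1 :+ m) :* c) :* ((a :- b) :* (a :- b))) refl a b (b ^ m) (fromℕ m)) ⟩
    a * (b ^ m * (fromℕ (suc m) * a - fromℕ m * b))
      ≤⟨ *-monoʳ-≤ 0≤a (tangent m 0≤a 0≤b) ⟩
    a ^ (2 ℕ.+ m) ∎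

  Large-mono : ∀ {x m n} → m ℕ.≤ n → Large x m → Large x n
  Large-mono m≤n large = mk (<-≤-trans (-x<1+n large) (fromℕ-mono-≤ (ℕ.s≤s m≤n)))

  -- The tangent of t^(n+2) at the old factor is evaluated at the new factor. Its bracket is (n + 2
  -- + x) - (n + 1 + x) = 1, so what remains on the left is exactly the old approximation.
  approx-step : ∀ {x n} → Large x n → approx x n ≤ approx x (suc n)
  approx-step {x} {n} large = ≤-resp
    (trans (*-congˡ slope) (*-identityʳ _)) refl
    (tangent (suc n) (<⇒≤ (0<factor {x} (Large-mono {x} (ℕ.n≤1+n n) large))) (<⇒≤ (0<factor large)))
    where
    slope : fromℕ (2 ℕ.+ n) * factor x (suc n) - fromℕ (suc n) * factor x n ≈ 1#
    slope = begin-equality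
      fromℕ (2 ℕ.+ n) * factor x (suc n) - fromℕ (suc n) * factor x n
        ≈⟨ +-cong ([1+n]*factor x (suc n)) (-‿cong ([1+n]*factor x n)) ⟩
      fromℕ (2 ℕ.+ n) + x - (fromℕ (suc n) + x)
        ≈⟨ solve 2 (λ m x → (κ 1 :+ m) :+ x :- (m :+ x) := κ 1) refl (fromℕ (suc n)) x ⟩
      1# ∎

  approx-mono : ∀ {x m n} → m ℕ.≤ n → Large x m → approx x m ≤ approx x n
  approx-mono {x} {m} m≤n large = go (ℕ.≤⇒≤′ m≤n)
    where
    go : ∀ {n} → m ℕ.≤′ n → approx x m ≤ approx x n
    go ℕ.≤′-refl        = ≤-refl
    go (ℕ.≤′-step m≤′n) =
      ≤-trans (go m≤′n) (approx-step {x} (Large-mono {x} (ℕ.≤′⇒≤ m≤′n) large))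

  -- At a common index the factors multiply to 1 - (x/(k+1))² ≤ 1, and monotonicity moves both
  -- approximations to that index.
  approx*approx : ∀ {x m n} → Large x m → Large (- x) n → approx x m * approx (- x) n ≤ 1#
  approx*approx {x} {m} {n} large large⁻ = begin
    approx x m * approx (- x) n     ≤⟨ *-mono-≤
        (<⇒≤ (0<approx large)) (approx-mono {x} (ℕ.m≤m⊔n m n) large)
        (<⇒≤ (0<approx large⁻)) (approx-mono { - x} (ℕ.m≤n⊔m m n) large⁻) ⟩
    approx x k * approx (- x) k     ≈⟨ ^-distrib-* (factor x k) (factor (- x) k) (suc k) ⟨
    (factor x k * factor (- x) k) ^ suc k  ≤⟨ x^n≤1 (suc k)
        (<⇒≤ (*-pos (0<factor (Large-mono {x} (ℕ.m≤m⊔n m n) large))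
                    (0<factor (Large-mono { - x} (ℕ.m≤n⊔m m n) large⁻))))
        (≤-by (0≤x*x (x * i k)) (solve 2 (λ x i →
          κ 1 :- (κ 1 :+ x :* i) :* (κ 1 :+ (:- x) :* i) := x :* i :* (x :* i)) refl x (i k))) ⟩
    1#                              ∎
    where
    k : ℕ
    k = m ℕ.⊔ n

  large : ∀ x → Eventually (Large x)
  large x = eventually-map (λ n -x<n → mk (<-≤-trans -x<n (fromℕ-mono-≤ (ℕ.n≤1+n n)))) (eventually-> (- x))

  private
    -- By monotonicity the set behind `lim` contains any approximation of large index, and by
    -- `approx*approx` it is bounded by the inverse of one approximation at `- x`.
    exp-sup : ∀ x → IsSupremum (λ t → ∃[ N ] ∀ n → N ℕ.≤ n → t ≤ approx x n) (exp x)
    exp-sup x with eventually-∃ (large x) | eventually-∃ (large (- x))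
    ... | n , large | n⁻ , large⁻ = supremum _ {approx x n} {1# * approx (- x) n⁻ ⁻¹}
      (n , λ n′ n≤n′ → approx-mono {x} n≤n′ large)
      λ t → λ (N , t≤) → ≤-trans (t≤ (N ℕ.⊔ n) (ℕ.m≤m⊔n N n)) (≤-div (0<approx large⁻)
        (approx*approx {x} (Large-mono {x} (ℕ.m≤n⊔m N n) large) large⁻))

  approx≤exp : ∀ {x n} → Large x n → approx x n ≤ exp x
  approx≤exp {x} {n} large =
    proj₁ (exp-sup x) (approx x n) (n , λ n′ n≤n′ → approx-mono {x} n≤n′ large)

  exp-least : ∀ {x b} → Eventually (λ n → approx x n ≤ b) → exp x ≤ b
  exp-least {x} {b} (N , ≤b) = proj₂ (exp-sup x) b λ t → λ (M , t≤) →
    ≤-trans (t≤ (M ℕ.⊔ N) (ℕ.m≤m⊔n M N)) (≤b (M ℕ.⊔ N) (ℕ.m≤n⊔m M N))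

  0<exp : ∀ x → 0# < exp x
  0<exp x with eventually-∃ (large x)
  ... | n , large = <-≤-trans (0<approx large) (approx≤exp {x} large)

  1+x≤exp : ∀ x → 1# + x ≤ exp x
  1+x≤exp x with eventually-∃ (large x)
  ... | n , large = begin
    1# + x                          ≈⟨ +-congˡ (*-identityˡ x) ⟨
    1# + 1# * x                     ≈⟨ +-congˡ (*-congʳ (i-inv n)) ⟨
    1# + fromℕ (suc n) * i n * x    ≈⟨ solve 3 (λ m j x → κ 1 :+ m :* j :* x := κ 1 :+ m :* (x :* j))
                                         refl (fromℕ (suc n)) (i n) x ⟩
    1# + fromℕ (suc n) * (x * i n)  ≤⟨ bernoulli (suc n) (<⇒≤ (0<factor large)) ⟩
    approx x n                      ≤⟨ approx≤exp {x} large ⟩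
    exp x                           ∎

  private
    -- The limit is taken in one factor at a time, after division by the other, which is positive.
    exp*exp-least : ∀ {x y b} →
      (∀ m n → Large x m → Large y n → approx x m * approx y n ≤ b) → exp x * exp y ≤ b
    exp*exp-least {x} {y} {b} h = ≤-resp (*-comm _ _) refl (≤-trans
      (*-monoˡ-≤ (<⇒≤ (0<exp x)) (exp-least {y} {b * exp x ⁻¹} (eventually-map
        (λ n largeʸ → ≤-div (0<exp x) (≤-trans (*-monoʳ-≤ (<⇒≤ (0<approx largeʸ))
            (exp-least {x} {b * approx y n ⁻¹} (eventually-map
              (λ m largeˣ → ≤-div (0<approx largeʸ) (h m n largeˣ largeʸ)) (large x))))
          (≤-reflexive (trans (*-comm _ _) (*⁻¹-cancel b (0<approx largeʸ))))))
        (large y))))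
      (≤-reflexive (*⁻¹-cancel b (0<exp x))))

    eventually-*i< : ∀ x {η} → 0# < η → Eventually (λ n → x * i n ≤ η)
    eventually-*i< x {η} 0<η = eventually-map
      (λ n p → div-≤ (0<1+n n) (begin
        x                     ≈⟨ *⁻¹-cancel x 0<η ⟨
        x * η ⁻¹ * η          ≤⟨ *-monoˡ-≤ (<⇒≤ 0<η) (≤-trans (<⇒≤ p) (fromℕ-mono-≤ (ℕ.n≤1+n n))) ⟩
        fromℕ (suc n) * η     ≈⟨ *-comm _ _ ⟩
        η * fromℕ (suc n)     ∎))
      (eventually-> (x * η ⁻¹))

  exp*exp- : ∀ x → exp x * exp (- x) ≤ 1#
  exp*exp- x = exp*exp-least λ m n → approx*approx {x}

  -- With i = 1/(k+1), the product (1 + x i)(1 + y i) exceeds 1 + (x + y) i by x y i². For large k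
  -- this is at most (z - x - y) i, so the product is at most 1 + z i.
  exp*exp≤exp : ∀ {x y z} → x + y < z → exp x * exp y ≤ exp z
  exp*exp≤exp {x} {y} {z} x+y<z = exp*exp-least λ m n largeˣ largeʸ →
    let N , h = large x ⋏ large y ⋏ large z ⋏ eventually-*i< (x * y) (<⇒0<- x+y<z)
        k   = N ℕ.⊔ (m ℕ.⊔ n)
        m≤k = ℕ.≤-trans (ℕ.m≤m⊔n m n) (ℕ.m≤n⊔m N _)
        n≤k = ℕ.≤-trans (ℕ.m≤n⊔m m n) (ℕ.m≤n⊔m N _)
        lx , ly , lz , small = h k (ℕ.m≤m⊔n N _)
    in begin
      approx x m * approx y n            ≤⟨ *-mono-≤
          (<⇒≤ (0<approx largeˣ)) (approx-mono {x} m≤k largeˣ)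
          (<⇒≤ (0<approx largeʸ)) (approx-mono {y} n≤k largeʸ) ⟩
      approx x k * approx y k            ≈⟨ ^-distrib-* (factor x k) (factor y k) (suc k) ⟨
      (factor x k * factor y k) ^ suc k  ≤⟨ ^-monoˡ-≤ (suc k)
          (<⇒≤ (*-pos (0<factor lx) (0<factor ly)))
          (≤-by (*-nonNeg (<⇒≤ (0<i k)) (≤⇒0≤- small)) (solve 4 (λ x y z i →
            (κ 1 :+ z :* i) :- (κ 1 :+ x :* i) :* (κ 1 :+ y :* i)
            := i :* ((z :- (x :+ y)) :- x :* y :* i)) refl x y z (i k))) ⟩
      approx z k                         ≤⟨ approx≤exp {z} lz ⟩
      exp z                              ∎

  exp≤exp*exp : ∀ {x y z} → z < x + y → exp z ≤ exp x * exp y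
  exp≤exp*exp {x} {y} {z} z<x+y = exp-least (eventually-map
    (λ k → λ (lx , ly , lz , small) → begin
      approx z k                         ≤⟨ ^-monoˡ-≤ (suc k) (<⇒≤ (0<factor lz))
          (≤-by (*-nonNeg (<⇒≤ (0<i k)) (≤⇒0≤- small)) (solve 4 (λ x y z i →
            (κ 1 :+ x :* i) :* (κ 1 :+ y :* i) :- (κ 1 :+ z :* i)
            := i :* (((x :+ y) :- z) :- (:- (x :* y)) :* i)) refl x y z (i k))) ⟩
      (factor x k * factor y k) ^ suc k  ≈⟨ ^-distrib-* (factor x k) (factor y k) (suc k) ⟩
      approx x k * approx y k            ≤⟨ *-mono-≤
          (<⇒≤ (0<approx lx)) (approx≤exp {x} lx) (<⇒≤ (0<approx ly)) (approx≤exp {y} ly) ⟩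
      exp x * exp y                      ∎)
    (large x ⋏ large y ⋏ large z ⋏ eventually-*i< (- (x * y)) (<⇒0<- z<x+y)))

  isExponential : Laws.IsExponential em ℛ exp
  isExponential = record
    { 0<exp       = 0<exp
    ; 1+x≤exp     = 1+x≤exp
    ; exp*exp-    = exp*exp-
    ; exp*exp≤exp = exp*exp≤exp
    ; exp≤exp*exp = exp≤exp*exp
    }

-- The logarithm as a supremum.

-- exp and ln are parameters, so that their definitions as suprema are never
-- unfolded.
module Logarithm (em : ExcludedMiddle 0ℓ) (ℛ : CompleteOrderedField)
  (exp ln : CompleteOrderedField.Carrier ℛ → CompleteOrderedField.Carrier ℛ)
  (isExponential : Laws.IsExponential em ℛ exp)
  (ln≡sup : Laws._IsSupLogarithmOf_ em ℛ ln exp) where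

  open Laws em ℛ
  open IsExponential isExponential
  open Real em ℛ hiding (zero; exp; ln)
  open RingSolver em ℛ
  open OrderedField em ℛ

  half : ℝ
  half = 2# ⁻¹

  0<half : 0# < half
  0<half = ⁻¹-pos 0<2

  half+half : half + half ≈ 1#
  half+half = trans (solve 1 (λ h → h :+ h := κ 2 :* h) refl half) (x*x⁻¹ 0<2)

  abstract
    <-dense : ∀ {x y} → x < y → ∃[ z ] x < z × z < y
    <-dense {x} {y} x<y = x + (y - x) * half ,
      <-by 0<d (solve 2 (λ x d → (x :+ d) :- x := d) refl x _) ,
      <-by 0<d (begin-equality
        y - (x + (y - x) * half)              ≈⟨ solve 3 (λ x y h →
            y :- (x :+ (y :- x) :* h) := (y :- x) :* (κ 1 :- h)) refl x y half ⟩
        (y - x) * (1# - half)                 ≈⟨ *-congˡ (+-congʳ half+half) ⟨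
        (y - x) * (half + half - half)        ≈⟨ *-congˡ (solve 1 (λ h → h :+ h :- h := h) refl half) ⟩
        (y - x) * half                        ∎)
      where
      0<d : 0# < (y - x) * half
      0<d = *-pos (<⇒0<- x<y) 0<half

  ≤-from-below : ∀ {x y} → (∀ z → z < x → z ≤ y) → x ≤ y
  ≤-from-below {x} {y} h = ≮⇒≥ λ y<x →
    let z , y<z , z<x = <-dense y<x in <⇒≱ y<z (h z z<x)

  -- `exp x` is multiplied by 1 + (z - x) > 1, which is at most `exp (z - x)`. Stopping at an
  -- intermediate `z` leaves the gap below `y` that `exp*exp≤exp` requires.
  exp-mono-< : ∀ {x y} → x < y → exp x < exp y
  exp-mono-< {x} {y} x<y with <-dense x<y
  ... | z , x<z , z<y = begin-strict
    exp x                     ≈⟨ *-identityʳ _ ⟨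
    exp x * 1#                ≈⟨ *-comm _ _ ⟩
    1# * exp x                <⟨ *-monoˡ-< (0<exp x) (<-by (<⇒0<- x<z)
                                   (solve 1 (λ d → (κ 1 :+ d) :- κ 1 := d) refl (z - x))) ⟩
    (1# + (z - x)) * exp x    ≤⟨ *-monoˡ-≤ (<⇒≤ (0<exp x)) (1+x≤exp (z - x)) ⟩
    exp (z - x) * exp x       ≤⟨ exp*exp≤exp (<-resp (solve 2 (λ x z → z := (z :- x) :+ x) refl x z) refl z<y) ⟩
    exp y                     ∎

  private
    -- The set contains -1/x, because y ≤ exp y gives exp (-y) y ≤ 1 for y = 1/x. It is bounded by
    -- x, because t ≤ 1 + t ≤ exp t.
    ln-sup : ∀ {x} → 0# < x → IsSupremum (λ t → exp t ≤ x) (ln x)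
    ln-sup {x} 0<x = ≡.subst (IsSupremum _) (≡.sym (ln≡sup x)) (supremum _ { - y} {x} e⁻ʸ≤x λ t eᵗ≤x →
      ≤-trans (≤-by (<⇒≤ 0<1) (solve 1 (λ t → κ 1 :+ t :- t := κ 1) refl t))
        (≤-trans (1+x≤exp t) eᵗ≤x))
      where
      y : ℝ
      y = x ⁻¹
      e⁻ʸ≤x : exp (- y) ≤ x
      e⁻ʸ≤x = *-cancelʳ-≤ (⁻¹-pos 0<x) (begin
        exp (- y) * y         ≤⟨ *-monoʳ-≤ (<⇒≤ (0<exp (- y)))
                                   (≤-by (<⇒≤ 0<1) (solve 1 (λ t → κ 1 :+ t :- t := κ 1) refl y)) ⟩
        exp (- y) * (1# + y)  ≤⟨ *-monoʳ-≤ (<⇒≤ (0<exp (- y))) (1+x≤exp y) ⟩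
        exp (- y) * exp y     ≈⟨ *-comm _ _ ⟩
        exp y * exp (- y)     ≤⟨ exp*exp- y ⟩
        1#                    ≈⟨ x*x⁻¹ 0<x ⟨
        x * y                 ∎)

  exp≤⇒≤ln : ∀ {t x} → 0# < x → exp t ≤ x → t ≤ ln x
  exp≤⇒≤ln {t} 0<x = proj₁ (ln-sup 0<x) t

  ln-least : ∀ {x b} → 0# < x → (∀ t → exp t ≤ x → t ≤ b) → ln x ≤ b
  ln-least {b = b} 0<x = proj₂ (ln-sup 0<x) b

  ln<⇒<exp : ∀ {t x} → 0# < x → ln x < t → x < exp t
  ln<⇒<exp 0<x lnx<t = ≰⇒> λ eᵗ≤x → <⇒≱ lnx<t (exp≤⇒≤ln 0<x eᵗ≤x)

  ln-exp≤ : ∀ t → ln (exp t) ≤ t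
  ln-exp≤ t = ln-least (0<exp t) λ s eˢ≤eᵗ → ≮⇒≥ λ t<s → <⇒≱ (exp-mono-< t<s) eˢ≤eᵗ

  ln-mono-≤ : ∀ {x y} → 0# < x → x ≤ y → ln x ≤ ln y
  ln-mono-≤ 0<x x≤y =
    ln-least 0<x λ t eᵗ≤x → exp≤⇒≤ln (<-≤-trans 0<x x≤y) (≤-trans eᵗ≤x x≤y)

  ln≤x-1 : ∀ {x} → 0# < x → ln x ≤ x - 1#
  ln≤x-1 {x} 0<x = ln-least 0<x λ t eᵗ≤x → ≤-by (≤⇒0≤- (≤-trans (1+x≤exp t) eᵗ≤x))
    (solve 2 (λ x t → (x :- κ 1) :- t := x :- (κ 1 :+ t)) refl x t)

  -- For `r` above `ln x + ln y`, `split` yields `s` above `ln x` with `r - s` above `ln y`. A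
  -- further point between `ln x` and `s` leaves the gap for `exp*exp≤exp`, whence `x * y < exp r`.
  -- The other inequality adds elements of the two sets and reaches their sum only from below, again
  -- because of the gap.
  ln-* : ∀ {x y} → 0# < x → 0# < y → ln (x * y) ≈ ln x + ln y
  ln-* {x} {y} 0<x 0<y = antisym
    (ln-least 0<xy λ r eʳ≤xy → ≮⇒≥ λ sum<r → let s , h₁ , h₂ = split sum<r in
      <⇒≱ (begin-strict
        x * y                                ≈⟨ *-comm x y ⟩
        y * x                                <⟨ *-monoˡ-< 0<x (ln<⇒<exp 0<y h₂) ⟩
        exp (r - s) * x                      ≤⟨ *-monoʳ-≤ (<⇒≤ (0<exp _)) (<⇒≤ (ln<⇒<exp 0<x (proj₁ (proj₂ (<-dense h₁))))) ⟩
        exp (r - s) * exp (proj₁ (<-dense h₁)) ≤⟨ exp*exp≤exp {z = r}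
            (<-resp (+-comm _ _) (solve 2 (λ r s → s :+ (r :- s) := r) refl r s)
              (+-monoˡ-< (r - s) (proj₂ (proj₂ (<-dense h₁))))) ⟩
        exp r                                ∎) eʳ≤xy)
    (shift (ln-least 0<x λ s eˢ≤x → ≤-by (≤⇒0≤- (ln-least 0<y λ t eᵗ≤y →
        ≤-by (≤⇒0≤- (s+t≤ s t eˢ≤x eᵗ≤y))
          (solve 3 (λ l s t → (l :- s) :- t := l :- (s :+ t)) refl (ln (x * y)) s t)))
        (solve 3 (λ l s t → (l :- t) :- s := (l :- s) :- t) refl (ln (x * y)) s (ln y))))
    where
    0<xy : 0# < x * y
    0<xy = *-pos 0<x 0<y

    split : ∀ {r} → ln x + ln y < r → ∃[ s ] ln x < s × ln y < r - s
    split {r} h with <-dense (<-resp refl refl (<-by (<⇒0<- h)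
                       (solve 3 (λ a b r → (r :- b) :- a := r :- (a :+ b)) refl (ln x) (ln y) r)))
    ... | s , a , b = s , a , <-by (<⇒0<- b)
      (solve 3 (λ r s b → (r :- s) :- b := (r :- b) :- s) refl r s (ln y))

    s+t≤ : ∀ s t → exp s ≤ x → exp t ≤ y → s + t ≤ ln (x * y)
    s+t≤ s t eˢ≤x eᵗ≤y = ≤-from-below λ z z<s+t → exp≤⇒≤ln 0<xy
      (≤-trans (exp≤exp*exp z<s+t) (*-mono-≤ (<⇒≤ (0<exp s)) eˢ≤x (<⇒≤ (0<exp t)) eᵗ≤y))

    shift : ∀ {a b c} → a ≤ c - b → a + b ≤ c
    shift {a} {b} {c} h = ≤-by (≤⇒0≤- h)
      (solve 3 (λ a b c → c :- (a :+ b) := (c :- b) :- a) refl a b c)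

  isLogarithm : IsLogarithm exp ln
  isLogarithm = record
    { 0<exp     = 0<exp
    ; ln-exp≤   = ln-exp≤
    ; ln-mono-≤ = ln-mono-≤
    ; ln-*      = ln-*
    ; ln≤x-1    = ln≤x-1
    }

-- Finite products and expectations.

module Expectation (em : ExcludedMiddle 0ℓ) (ℛ : CompleteOrderedField) where

  open RingSolver em ℛ
  open Real em ℛ hiding (zero)
  open OrderedField em ℛ
  open Algebra.Definitions.RawSemiring (Semiring.rawSemiring semiring) public using (product)
  open Algebra.Properties.CommutativeMonoid.Sum *-commutativeMonoid public
    using () renaming (sum-cong-≋ to product-cong; ∑-distrib-+ to product-*)
  open Algebra.Properties.Semiring.Sum semiring public
    using (∑-distrib-+; sum-replicate; *-distribˡ-sum)

  sum-mono-≤ : ∀ {m} {f g : Fin m → ℝ} → (∀ a → f a ≤ g a) → sum f ≤ sum g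
  sum-mono-≤ {zero}  _   = ≤-refl
  sum-mono-≤ {suc m} f≤g = +-mono-≤ (f≤g zero) (sum-mono-≤ (f≤g ∘ suc))

  product-nonNeg : ∀ {m} {f : Fin m → ℝ} → (∀ a → 0# ≤ f a) → 0# ≤ product f
  product-nonNeg {zero}  _   = <⇒≤ 0<1
  product-nonNeg {suc m} 0≤f = *-nonNeg (0≤f zero) (product-nonNeg (0≤f ∘ suc))

  product-mono-≤ : ∀ {m} {f g : Fin m → ℝ} →
                   (∀ a → 0# ≤ f a) → (∀ a → f a ≤ g a) → product f ≤ product g
  product-mono-≤ {zero}  _   _   = ≤-refl
  product-mono-≤ {suc m} 0≤f f≤g =
    *-mono-≤ (0≤f zero) (f≤g zero) (product-nonNeg (0≤f ∘ suc)) (product-mono-≤ (0≤f ∘ suc) (f≤g ∘ suc))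

  product-1 : ∀ {m} {f : Fin m → ℝ} → (∀ a → f a ≈ 1#) → product f ≈ 1#
  product-1 {zero}  _   = refl
  product-1 {suc m} f≈1 = trans (*-cong (f≈1 zero) (product-1 (f≈1 ∘ suc))) (*-identityˡ 1#)

  product-0 : ∀ {m} {f : Fin m → ℝ} a → f a ≈ 0# → product f ≈ 0#
  product-0 {suc m} zero    fa≈0 = trans (*-congʳ fa≈0) (zeroˡ _)
  product-0 {suc m} (suc a) fa≈0 = trans (*-congˡ (product-0 a fa≈0)) (zeroʳ _)

  -- An expectation viewed as a positive linear functional of total mass 1. The random edge set and
  -- the random choice of vertices share this interface.
  record Mean (X : Set) : Set₁ where
    field
      𝔼      : (X → ℝ) → ℝ
      mono   : ∀ {f g} → (∀ x → f x ≤ g x) → 𝔼 f ≤ 𝔼 g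
      +-homo : ∀ f g → 𝔼 (λ x → f x + g x) ≈ 𝔼 f + 𝔼 g
      *-homo : ∀ c f → 𝔼 (λ x → c * f x) ≈ c * 𝔼 f
      unit   : 𝔼 (λ _ → 1#) ≈ 1#

    cong : ∀ {f g} → (∀ x → f x ≈ g x) → 𝔼 f ≈ 𝔼 g
    cong f≈g = antisym (mono (≤-reflexive ∘ f≈g)) (mono (≤-reflexive ∘ sym ∘ f≈g))

    const : ∀ c → 𝔼 (λ _ → c) ≈ c
    const c = begin-equality
      𝔼 (λ _ → c)        ≈⟨ cong (λ _ → sym (*-identityʳ c)) ⟩
      𝔼 (λ _ → c * 1#)   ≈⟨ *-homo c (λ _ → 1#) ⟩
      c * 𝔼 (λ _ → 1#)   ≈⟨ *-congˡ unit ⟩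
      c * 1#             ≈⟨ *-identityʳ c ⟩
      c                  ∎

    *-homoʳ : ∀ f c → 𝔼 (λ x → f x * c) ≈ 𝔼 f * c
    *-homoʳ f c = trans (cong (λ x → *-comm (f x) c)) (trans (*-homo c f) (*-comm c (𝔼 f)))

    sum-homo : ∀ {m} (f : Fin m → X → ℝ) → 𝔼 (λ x → sum λ a → f a x) ≈ sum λ a → 𝔼 (f a)
    sum-homo {zero}  f = const 0#
    sum-homo {suc m} f = trans (+-homo (f zero) _) (+-congˡ (sum-homo (f ∘ suc)))

  open Mean

  coin : ∀ p → 0# ≤ p → p ≤ 1# → Mean Bool
  coin p 0≤p p≤1 = record
    { 𝔼      = λ f → p * f true + (1# - p) * f false
    ; mono   = λ f≤g → +-mono-≤ (*-monoʳ-≤ 0≤p (f≤g true)) (*-monoʳ-≤ (≤⇒0≤- p≤1) (f≤g false))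
    ; +-homo = λ f g → solve 5 (λ p a b c d →
        p :* (a :+ b) :+ (κ 1 :- p) :* (c :+ d)
        := (p :* a :+ (κ 1 :- p) :* c) :+ (p :* b :+ (κ 1 :- p) :* d))
        refl p (f true) (g true) (f false) (g false)
    ; *-homo = λ c f → solve 4 (λ p c a b →
        p :* (c :* a) :+ (κ 1 :- p) :* (c :* b) := c :* (p :* a :+ (κ 1 :- p) :* b))
        refl p c (f true) (f false)
    ; unit   = solve 1 (λ p → p :* κ 1 :+ (κ 1 :- p) :* κ 1 := κ 1) refl p
    }

  uniform : ∀ m → 0 ℕ.< m → Mean (Fin m)
  uniform m 0<m = record
    { 𝔼      = λ f → sum f * c
    ; mono   = λ f≤g → *-monoˡ-≤ (<⇒≤ (⁻¹-pos 0<m′)) (sum-mono-≤ f≤g)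
    ; +-homo = λ f g → trans (*-congʳ (∑-distrib-+ f g)) (distribʳ c (sum f) (sum g))
    ; *-homo = λ d f → trans (*-congʳ (sym (*-distribˡ-sum d f))) (*-assoc d (sum f) c)
    ; unit   = trans (*-congʳ (sum-replicate m)) (x*x⁻¹ 0<m′)
    }
    where
    c : ℝ
    c = fromℕ m ⁻¹
    0<m′ : 0# < fromℕ m
    0<m′ = 0<fromℕ {m} 0<m

  -- The product measure, integrated one independent coordinate at a time.
  power : ∀ {X} → Mean X → ∀ k → Mean (Vec X k)
  power M zero = record
    { 𝔼      = λ f → f []
    ; mono   = λ f≤g → f≤g []
    ; +-homo = λ f g → refl
    ; *-homo = λ c f → refl
    ; unit   = refl
    }
  power M (suc k) = record
    { 𝔼      = λ f → 𝔼 M λ x → 𝔼 (power M k) λ xs → f (x ∷ xs)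
    ; mono   = λ f≤g → mono M λ x → mono (power M k) λ xs → f≤g (x ∷ xs)
    ; +-homo = λ f g → trans (cong M λ x → +-homo (power M k) _ _) (+-homo M _ _)
    ; *-homo = λ c f → trans (cong M λ x → *-homo (power M k) c _) (*-homo M c _)
    ; unit   = trans (cong M λ x → unit (power M k)) (unit M)
    }

  𝔼-product : ∀ {X} (M : Mean X) {k} (g : Fin k → X → ℝ) →
    𝔼 (power M k) (λ xs → product λ e → g e (Vec.lookup xs e)) ≈ product λ e → 𝔼 M (g e)
  𝔼-product M {zero}  g = refl
  𝔼-product M {suc k} g = begin-equality
    𝔼 M (λ x → 𝔼 (power M k) λ xs → g zero x * product λ e → g (suc e) (Vec.lookup xs e))
      ≈⟨ cong M (λ x → *-homo (power M k) (g zero x) _) ⟩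
    𝔼 M (λ x → g zero x * 𝔼 (power M k) λ xs → product λ e → g (suc e) (Vec.lookup xs e))
      ≈⟨ cong M (λ x → *-congˡ (𝔼-product M (g ∘ suc))) ⟩
    𝔼 M (λ x → g zero x * product λ e → 𝔼 M (g (suc e)))
      ≈⟨ *-homoʳ M (g zero) _ ⟩
    𝔼 M (g zero) * (product λ e → 𝔼 M (g (suc e))) ∎

  -- Fubini's theorem from the linearity of `M` alone, as the other mean is an iterated finite sum.
  𝔼-swap : ∀ {X m} (M : Mean X) 0<m k (f : Vec (Fin m) k → X → ℝ) →
    𝔼 M (λ x → 𝔼 (power (uniform m 0<m) k) λ as → f as x)
    ≈ 𝔼 (power (uniform m 0<m) k) (λ as → 𝔼 M (f as))
  𝔼-swap         M 0<m zero    f = refl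
  𝔼-swap {m = m} M 0<m (suc k) f = begin-equality
    𝔼 M (λ x → sum (λ a → 𝔼 (power (uniform m 0<m) k) λ as → f (a ∷ as) x) * fromℕ m ⁻¹)
      ≈⟨ *-homoʳ M _ (fromℕ m ⁻¹) ⟩
    𝔼 M (λ x → sum (λ a → 𝔼 (power (uniform m 0<m) k) λ as → f (a ∷ as) x)) * fromℕ m ⁻¹
      ≈⟨ *-congʳ (sum-homo M λ a x → 𝔼 (power (uniform m 0<m) k) λ as → f (a ∷ as) x) ⟩
    sum (λ a → 𝔼 M λ x → 𝔼 (power (uniform m 0<m) k) λ as → f (a ∷ as) x) * fromℕ m ⁻¹
      ≈⟨ cong (uniform m 0<m) (λ a → 𝔼-swap M 0<m k (f ∘ (a ∷_))) ⟩
    sum (λ a → 𝔼 (power (uniform m 0<m) k) λ as → 𝔼 M (f (a ∷ as))) * fromℕ m ⁻¹ ∎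

  private
    total-++ : ∀ (xs ys : List ℝ) → foldr _+_ 0# (xs ++ ys) ≈ foldr _+_ 0# xs + foldr _+_ 0# ys
    total-++ []       ys = sym (+-identityˡ _)
    total-++ (x ∷ xs) ys = trans (+-congˡ (total-++ xs ys)) (sym (+-assoc x _ _))

  -- The two halves of the list `subsets` are the two outcomes of the first coin. This identifies
  -- the explicit weighted sum in `ℙ` with a mean over independent coins.
  𝔼-subsets : ∀ {p} 0≤p p≤1 N {w f : Subset N → ℝ} →
    (∀ S → w S ≈ p ^ ∣ S ∣ * (1# - p) ^ ∣ ∁ S ∣ * f S) →
    foldr _+_ 0# (List.map w (subsets N)) ≈ 𝔼 (power (coin p 0≤p p≤1) N) f
  𝔼-subsets     0≤p p≤1 zero {w} {f} w≈ = begin-equality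
    w [] + 0#              ≈⟨ +-identityʳ (w []) ⟩
    w []                   ≈⟨ w≈ [] ⟩
    1# * 1# * f []         ≈⟨ solve 1 (λ a → κ 1 :* κ 1 :* a := a) refl (f []) ⟩
    f []                   ∎
  𝔼-subsets {p} 0≤p p≤1 (suc N) {w} {f} w≈ = begin-equality
    foldr _+_ 0# (List.map w (List.map (inside ∷_) (subsets N) ++ List.map (outside ∷_) (subsets N)))
      ≡⟨ ≡.cong (foldr _+_ 0#) (List.map-++ w (List.map (inside ∷_) (subsets N)) _) ⟩
    foldr _+_ 0# (List.map w (List.map (inside ∷_) (subsets N)) ++ List.map w (List.map (outside ∷_) (subsets N)))
      ≈⟨ total-++ (List.map w (List.map (inside ∷_) (subsets N))) _ ⟩
    foldr _+_ 0# (List.map w (List.map (inside ∷_) (subsets N)))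
      + foldr _+_ 0# (List.map w (List.map (outside ∷_) (subsets N)))
      ≡⟨ ≡.cong₂ (λ xs ys → foldr _+_ 0# xs + foldr _+_ 0# ys)
          (List.map-∘ (subsets N)) (List.map-∘ (subsets N)) ⟨
    foldr _+_ 0# (List.map (w ∘ (inside ∷_)) (subsets N))
      + foldr _+_ 0# (List.map (w ∘ (outside ∷_)) (subsets N))
      ≈⟨ +-cong
          (𝔼-subsets 0≤p p≤1 N λ S → trans (w≈ (inside ∷ S)) (solve 4 (λ p a b c →
            p :* a :* b :* c := a :* b :* (p :* c)) refl p (p ^ ∣ S ∣) ((1# - p) ^ ∣ ∁ S ∣) _))
          (𝔼-subsets 0≤p p≤1 N λ S → trans (w≈ (outside ∷ S)) (solve 4 (λ q a b c →
            a :* (q :* b) :* c := a :* b :* (q :* c)) refl (1# - p) (p ^ ∣ S ∣) ((1# - p) ^ ∣ ∁ S ∣) _)) ⟩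
    𝔼 M (λ S → p * f (inside ∷ S)) + 𝔼 M (λ S → (1# - p) * f (outside ∷ S))
      ≈⟨ +-cong (*-homo M p _) (*-homo M (1# - p) _) ⟩
    p * 𝔼 M (λ S → f (inside ∷ S)) + (1# - p) * 𝔼 M (λ S → f (outside ∷ S)) ∎
    where
    M : Mean (Subset N)
    M = power (coin p 0≤p p≤1) N

  module _ {n} {p : ℝ} (0≤p : 0# ≤ p) (p≤1 : p ≤ 1#) (A : Graph (Fin n) → Set) where

    private
      M : Mean (EdgeSet n)
      M = power (coin p 0≤p p≤1) (length (pairs n))

      indicator : EdgeSet n → ℝ
      indicator E = if does (em {A (graph E)}) then 1# else 0#

    ℙ≈𝔼 : ℙ n p A ≈ 𝔼 M indicator
    ℙ≈𝔼 = 𝔼-subsets 0≤p p≤1 (length (pairs n)) λ E → lemma (does (em {A (graph E)}))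
      where
      lemma : ∀ b {c} → (if b then c else 0#) ≈ c * (if b then 1# else 0#)
      lemma true  = sym (*-identityʳ _)
      lemma false = sym (zeroʳ _)

    ℙ-impossible : (∀ G → ¬ A G) → ℙ n p A ≈ 0#
    ℙ-impossible ¬A = trans ℙ≈𝔼 (trans (cong M zero-indicator) (const M 0#))
      where
      zero-indicator : ∀ E → indicator E ≈ 0#
      zero-indicator E with em {A (graph E)}
      ... | yes a = ⊥-elim (¬A _ a)
      ... | no  _ = refl

    -- 1[A] ≥ 1 − (Y − 1)² pointwise when Y vanishes off A.
    second-moment : (Y : EdgeSet n → ℝ) → (∀ E → ¬ A (graph E) → Y E ≈ 0#) →
                    2# * 𝔼 M Y - 𝔼 M (λ E → Y E * Y E) ≤ ℙ n p A
    second-moment Y Y≈0 = begin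
      2# * 𝔼 M Y - 𝔼 M (λ E → Y E * Y E)
        ≈⟨ solve 2 (λ a b → κ 2 :* a :- b := κ 2 :* a :+ (:- κ 1) :* b) refl _ _ ⟩
      2# * 𝔼 M Y + (- 1#) * 𝔼 M (λ E → Y E * Y E)
        ≈⟨ +-cong (*-homo M 2# Y) (*-homo M (- 1#) _) ⟨
      𝔼 M (λ E → 2# * Y E) + 𝔼 M (λ E → (- 1#) * (Y E * Y E))
        ≈⟨ +-homo M _ _ ⟨
      𝔼 M (λ E → 2# * Y E + (- 1#) * (Y E * Y E))
        ≤⟨ mono M bound ⟩
      𝔼 M indicator
        ≈⟨ ℙ≈𝔼 ⟨
      ℙ n p A ∎
      where
      bound : ∀ E → 2# * Y E + (- 1#) * (Y E * Y E) ≤ indicator E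
      bound E with em {A (graph E)}
      ... | yes _  = ≤-by (0≤x*x (Y E - 1#)) (solve 1 (λ y →
              κ 1 :- (κ 2 :* y :+ (:- κ 1) :* (y :* y)) := (y :- κ 1) :* (y :- κ 1)) refl (Y E))
      ... | no  ¬a = ≤-reflexive (trans (+-cong (*-congˡ y≈0) (*-congˡ (*-congˡ y≈0)))
              (solve 1 (λ y → κ 2 :* κ 0 :+ (:- κ 1) :* (y :* κ 0) := κ 0) refl (Y E)))
        where
        y≈0 : Y E ≈ 0#
        y≈0 = Y≈0 E ¬a

-- Cardinalities, binomial coefficients and blocks of vertices.

∣++∣ : ∀ {m n} (S : Subset m) (T : Subset n) → ∣ S Vec.++ T ∣ ≡ ∣ S ∣ ℕ.+ ∣ T ∣
∣++∣ []            T = ≡.refl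
∣++∣ (inside  ∷ S) T = ≡.cong suc (∣++∣ S T)
∣++∣ (outside ∷ S) T = ∣++∣ S T

∣⊥∩∣ : ∀ {n} (S : Subset n) → ∣ ⊥ ∩ S ∣ ≡ 0
∣⊥∩∣ {n} S = ≡.trans (≡.cong ∣_∣ (Subset.∩-zeroˡ S)) (Subset.∣⊥∣≡0 n)

∣∩⊥∣ : ∀ {n} (S : Subset n) → ∣ S ∩ ⊥ ∣ ≡ 0
∣∩⊥∣ {n} S = ≡.trans (≡.cong ∣_∣ (Subset.∩-zeroʳ S)) (Subset.∣⊥∣≡0 n)

-- tri l is the binomial coefficient l C 2.
tri : ℕ → ℕ
tri zero    = 0
tri (suc l) = l ℕ.+ tri l

tri-mono : ∀ {l m} → l ℕ.≤ m → tri l ℕ.≤ tri m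
tri-mono ℕ.z≤n       = ℕ.z≤n
tri-mono (ℕ.s≤s l≤m) = ℕ.+-mono-≤ l≤m (tri-mono l≤m)

2*tri : ∀ l → 2 ℕ.* tri (suc l) ≡ suc l ℕ.* l
2*tri zero    = ≡.refl
2*tri (suc l) = begin
  2 ℕ.* (suc l ℕ.+ tri (suc l))          ≡⟨ ℕ.*-distribˡ-+ 2 (suc l) (tri (suc l)) ⟩
  2 ℕ.* suc l ℕ.+ 2 ℕ.* tri (suc l)      ≡⟨ ≡.cong (2 ℕ.* suc l ℕ.+_) (2*tri l) ⟩
  2 ℕ.* suc l ℕ.+ suc l ℕ.* l            ≡⟨ ≡.cong (2 ℕ.* suc l ℕ.+_) (ℕ.*-comm (suc l) l) ⟩
  2 ℕ.* suc l ℕ.+ l ℕ.* suc l            ≡⟨ ℕ.*-distribʳ-+ (suc l) 2 l ⟨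
  suc (suc l) ℕ.* suc l                  ∎
  where open ≡-Reasoning

-- After doubling, this is l - 1 ≤ 2r multiplied by l. Equality holds for l = 2r + 1, so nothing is
-- lost where the overlap is complete.
tri≤l*r : ∀ {l r} → l ℕ.≤ suc (2 ℕ.* r) → tri l ℕ.≤ l ℕ.* r
tri≤l*r {zero}      _            = ℕ.z≤n
tri≤l*r {suc l} {r} (ℕ.s≤s l≤2r) = ℕ.*-cancelˡ-≤ 2 (begin
  2 ℕ.* tri (suc l)        ≡⟨ 2*tri l ⟩
  suc l ℕ.* l              ≤⟨ ℕ.*-monoʳ-≤ (suc l) l≤2r ⟩
  suc l ℕ.* (2 ℕ.* r)      ≡⟨ ℕ.*-assoc (suc l) 2 r ⟨
  suc l ℕ.* 2 ℕ.* r        ≡⟨ ≡.cong (ℕ._* r) (ℕ.*-comm (suc l) 2) ⟩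
  2 ℕ.* suc l ℕ.* r        ≡⟨ ℕ.*-assoc 2 (suc l) r ⟩
  2 ℕ.* (suc l ℕ.* r)      ∎)
  where open ℕ.≤-Reasoning

-- The vertices are k blocks of size m followed by a remainder that is not used.
module Blocks (m rest : ℕ) where

  size : ℕ → ℕ
  size zero    = rest
  size (suc k) = m ℕ.+ size k

  size≡ : ∀ k → size k ≡ k ℕ.* m ℕ.+ rest
  size≡ zero    = ≡.refl
  size≡ (suc k) = ≡.trans (≡.cong (m ℕ.+_) (size≡ k)) (≡.sym (ℕ.+-assoc m (k ℕ.* m) rest))

  select : ∀ {k} → Vec (Fin m) k → Subset (size k)
  select []      = ⊥
  select (a ∷ φ) = ⁅ a ⁆ Vec.++ select φ

  -- Whole blocks rather than chosen vertices: the set is the same for every choice, so whether a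
  -- pair should be an edge depends on the pair alone.
  prefix : ∀ c s → Subset (size (c ℕ.+ s))
  prefix zero    s = ⊥
  prefix (suc c) s = ⊤ {m} Vec.++ prefix c s

  ∣select∣ : ∀ {k} (φ : Vec (Fin m) k) → ∣ select φ ∣ ≡ k
  ∣select∣ []      = Subset.∣⊥∣≡0 rest
  ∣select∣ (a ∷ φ) =
    ≡.trans (∣++∣ ⁅ a ⁆ (select φ)) (≡.cong₂ ℕ._+_ (Subset.∣⁅x⁆∣≡1 a) (∣select∣ φ))

  ∣∩-++∣ : ∀ {n} (S S′ : Subset m) (T T′ : Subset n) →
           ∣ (S Vec.++ T) ∩ (S′ Vec.++ T′) ∣ ≡ ∣ S ∩ S′ ∣ ℕ.+ ∣ T ∩ T′ ∣
  ∣∩-++∣ S S′ T T′ =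
    ≡.trans (≡.cong ∣_∣ (Vec.zipWith-++ _∧_ S T S′ T′)) (∣++∣ (S ∩ S′) (T ∩ T′))

  ∣select∩prefix∣ : ∀ c {s} (φ : Vec (Fin m) (c ℕ.+ s)) → ∣ select φ ∩ prefix c s ∣ ≡ c
  ∣select∩prefix∣ zero    φ       = ∣∩⊥∣ (select φ)
  ∣select∩prefix∣ (suc c) (a ∷ φ) = ≡.trans (∣∩-++∣ ⁅ a ⁆ ⊤ (select φ) (prefix c _))
    (≡.cong₂ ℕ._+_ (≡.trans (≡.cong ∣_∣ (Subset.∩-identityʳ ⁅ a ⁆)) (Subset.∣⁅x⁆∣≡1 a))
                   (∣select∩prefix∣ c φ))

-- Products over unordered pairs of vertices.

module PairProducts (em : ExcludedMiddle 0ℓ) (ℛ : CompleteOrderedField) where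

  open Real em ℛ hiding (zero)
  open OrderedField em ℛ
  open Expectation em ℛ

  private
    Π : List ℝ → ℝ
    Π = foldr _*_ 1#

    product-lookup : ∀ {A : Set} (xs : List A) (F : A → ℝ) →
                     product (F ∘ List.lookup xs) ≡ Π (List.map F xs)
    product-lookup []       F = ≡.refl
    product-lookup (x ∷ xs) F = ≡.cong (F x *_) (product-lookup xs F)

    Π-++ : ∀ xs ys → Π (xs List.++ ys) ≈ Π xs * Π ys
    Π-++ []       ys = sym (*-identityˡ _)
    Π-++ (x ∷ xs) ys = trans (*-congˡ (Π-++ xs ys)) (sym (*-assoc x _ _))

    Π-filter : ∀ {A : Set} {P : A → Set} (P? : Decidable P) (F : A → ℝ) xs →
      Π (List.map F (filter P? xs)) ≈ Π (List.map (λ x → if does (P? x) then F x else 1#) xs)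
    Π-filter P? F []       = refl
    Π-filter P? F (x ∷ xs) with does (P? x)
    ... | true  = *-congˡ (Π-filter P? F xs)
    ... | false = trans (Π-filter P? F xs) (sym (*-identityˡ _))

    Π-cartesianProduct : ∀ {A B : Set} (F : A × B → ℝ) xs ys →
      Π (List.map F (cartesianProduct xs ys))
      ≈ Π (List.map (λ x → Π (List.map (λ y → F (x , y)) ys)) xs)
    Π-cartesianProduct F []       ys = refl
    Π-cartesianProduct F (x ∷ xs) ys = begin-equality
      Π (List.map F (List.map (x ,_) ys List.++ cartesianProduct xs ys))
        ≡⟨ ≡.cong Π (List.map-++ F (List.map (x ,_) ys) _) ⟩
      Π (List.map F (List.map (x ,_) ys) List.++ List.map F (cartesianProduct xs ys))
        ≈⟨ Π-++ (List.map F (List.map (x ,_) ys)) _ ⟩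
      Π (List.map F (List.map (x ,_) ys)) * Π (List.map F (cartesianProduct xs ys))
        ≈⟨ *-cong (reflexive (≡.cong Π (≡.sym (List.map-∘ ys)))) (Π-cartesianProduct F xs ys) ⟩
      Π (List.map (λ y → F (x , y)) ys) * Π (List.map (λ x → Π (List.map (λ y → F (x , y)) ys)) xs) ∎

    Π-tabulate : ∀ {n} (f : Fin n → ℝ) → Π (List.tabulate f) ≡ product f
    Π-tabulate {zero}  f = ≡.refl
    Π-tabulate {suc n} f = ≡.cong (f zero *_) (Π-tabulate (f ∘ suc))

    Π-allFin : ∀ {n} (f : Fin n → ℝ) → Π (List.map f (allFin n)) ≡ product f
    Π-allFin f = ≡.trans (≡.cong Π (List.map-tabulate id f)) (Π-tabulate f)

  -- Padding with 1 instead of filtering a list gives a shape from which the first vertex can be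
  -- split off by computation.
  pairProduct : ∀ n → (Fin n → Fin n → ℝ) → ℝ
  pairProduct n F = product λ u → product λ v → if does (u Fin.<? v) then F u v else 1#

  product-pairs : ∀ n (F : Fin n × Fin n → ℝ) →
    product (F ∘ List.lookup (pairs n)) ≈ pairProduct n (λ u v → F (u , v))
  product-pairs n F = begin-equality
    product (F ∘ List.lookup (pairs n))
      ≡⟨ product-lookup (pairs n) F ⟩
    Π (List.map F (pairs n))
      ≈⟨ Π-filter _ F (cartesianProduct (allFin n) (allFin n)) ⟩
    Π (List.map F′ (cartesianProduct (allFin n) (allFin n)))
      ≈⟨ Π-cartesianProduct F′ (allFin n) (allFin n) ⟩
    Π (List.map (λ u → Π (List.map (λ v → F′ (u , v)) (allFin n))) (allFin n))
      ≡⟨ Π-allFin {n} _ ⟩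
    product (λ u → Π (List.map (λ v → F′ (u , v)) (allFin n)))
      ≈⟨ product-cong (λ u → reflexive (Π-allFin (λ v → F′ (u , v)))) ⟩
    pairProduct n (λ u v → F (u , v)) ∎
    where
    F′ : Fin n × Fin n → ℝ
    F′ (u , v) = if does (u Fin.<? v) then F (u , v) else 1#

  pairProduct-mono : ∀ {n} {F G : Fin n → Fin n → ℝ} →
    (∀ u v → 0# ≤ F u v) → (∀ u v → F u v ≤ G u v) → pairProduct n F ≤ pairProduct n G
  pairProduct-mono {n} {F} {G} 0≤F F≤G = product-mono-≤
    (λ u → product-nonNeg λ v → nonNeg u v (does (u Fin.<? v)))
    (λ u → product-mono-≤ (λ v → nonNeg u v (does (u Fin.<? v))) (λ v → bound u v (does (u Fin.<? v))))
    where
    nonNeg : ∀ u v b → 0# ≤ (if b then F u v else 1#)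
    nonNeg u v true  = 0≤F u v
    nonNeg u v false = <⇒≤ 0<1
    bound : ∀ u v b → (if b then F u v else 1#) ≤ (if b then G u v else 1#)
    bound u v true  = F≤G u v
    bound u v false = ≤-refl

  pairProduct-* : ∀ {n} (F G : Fin n → Fin n → ℝ) →
    pairProduct n (λ u v → F u v * G u v) ≈ pairProduct n F * pairProduct n G
  pairProduct-* {n} F G = trans
    (product-cong λ u → trans (product-cong λ v → split u v (does (u Fin.<? v))) (product-* {n} _ _))
    (product-* {n} _ _)
    where
    split : ∀ u v b → (if b then F u v * G u v else 1#)
                      ≈ (if b then F u v else 1#) * (if b then G u v else 1#)
    split u v true  = refl
    split u v false = sym (*-identityˡ 1#)

  both : ∀ {n} → Subset n → ℝ → Fin n → Fin n → ℝ
  both T x u v = if Vec.lookup T u ∧ Vec.lookup T v then x else 1#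

  product-members : ∀ {n} (T : Subset n) x →
    product (λ v → if Vec.lookup T v then x else 1#) ≈ x ^ ∣ T ∣
  product-members []            x = refl
  product-members (inside  ∷ T) x = *-congˡ (product-members T x)
  product-members (outside ∷ T) x = trans (*-identityˡ _) (product-members T x)

  -- Every pair is counted at its smaller end. A first vertex in `T` pairs with each later member of
  -- `T`, which is the recursion of `tri`.
  pairProduct-both : ∀ {n} (T : Subset n) x → pairProduct n (both T x) ≈ x ^ tri ∣ T ∣
  pairProduct-both         []            x = refl
  pairProduct-both {suc n} (inside ∷ T)  x = begin-equality
    (1# * product {n} (λ v → if Vec.lookup T v then x else 1#)) * product {n} (λ u → 1# * _)
      ≈⟨ *-cong (trans (*-identityˡ _) (product-members T x))
                (trans (product-cong {n} (λ u → *-identityˡ _)) (pairProduct-both T x)) ⟩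
    x ^ ∣ T ∣ * x ^ tri ∣ T ∣
      ≈⟨ ^-homo-* x ∣ T ∣ (tri ∣ T ∣) ⟨
    x ^ (∣ T ∣ ℕ.+ tri ∣ T ∣) ∎
  pairProduct-both {suc n} (outside ∷ T) x = begin-equality
    (1# * product {n} (λ v → 1#)) * product {n} (λ u → 1# * _)
      ≈⟨ *-cong (trans (*-identityˡ _) (product-1 {n} λ _ → refl))
                (trans (product-cong {n} (λ u → *-identityˡ _)) (pairProduct-both T x)) ⟩
    1# * x ^ tri ∣ T ∣
      ≈⟨ *-identityˡ _ ⟩
    x ^ tri ∣ T ∣ ∎

-- The overlap of two random choices.

module Overlap (em : ExcludedMiddle 0ℓ) (ℛ : CompleteOrderedField) where

  open RingSolver em ℛ
  open Real em ℛ hiding (zero)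
  open OrderedField em ℛ
  open Expectation em ℛ
  open Mean

  sum-1 : ∀ {n} {f : Fin n → ℝ} → (∀ a → f a ≈ 1#) → sum f ≈ fromℕ n
  sum-1 {zero}  _   = refl
  sum-1 {suc n} f≈1 = +-cong (f≈1 zero) (sum-1 (f≈1 ∘ suc))

  -- Only b = a overlaps, so the sum equals m - 1 + x. Rounding up by 1 gives the convenient average
  -- 1 + x/m.
  sum-x^∣⁅a⁆∩⁅b⁆∣ : ∀ {m} (a : Fin m) {x} → 0# ≤ x →
                    sum (λ b → x ^ ∣ ⁅ a ⁆ ∩ ⁅ b ⁆ ∣) ≤ fromℕ m + x
  sum-x^∣⁅a⁆∩⁅b⁆∣ {suc m} zero {x} 0≤x = begin
    x * x ^ ∣ ⊥ {m} ∩ ⊥ ∣ + sum {m} (λ b → x ^ ∣ ⊥ ∩ ⁅ b ⁆ ∣)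
      ≈⟨ +-cong (*-congˡ (reflexive (≡.cong (x ^_) (∣⊥∩∣ {m} ⊥))))
                (sum-1 {m} λ b → reflexive (≡.cong (x ^_) (∣⊥∩∣ ⁅ b ⁆))) ⟩
    x * 1# + fromℕ m
      ≤⟨ ≤-by (<⇒≤ 0<1) (solve 2 (λ x m → (κ 1 :+ m) :+ x :- (x :* κ 1 :+ m) := κ 1) refl x (fromℕ m)) ⟩
    fromℕ (suc m) + x ∎
  sum-x^∣⁅a⁆∩⁅b⁆∣ {suc m} (suc a) {x} 0≤x = begin
    x ^ ∣ ⁅ a ⁆ ∩ ⊥ ∣ + sum {m} (λ b → x ^ ∣ ⁅ a ⁆ ∩ ⁅ b ⁆ ∣)
      ≈⟨ +-congʳ (reflexive (≡.cong (x ^_) (∣∩⊥∣ ⁅ a ⁆))) ⟩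
    1# + sum {m} (λ b → x ^ ∣ ⁅ a ⁆ ∩ ⁅ b ⁆ ∣)
      ≤⟨ +-monoʳ-≤ 1# (sum-x^∣⁅a⁆∩⁅b⁆∣ a 0≤x) ⟩
    1# + (fromℕ m + x)
      ≈⟨ +-assoc 1# (fromℕ m) x ⟨
    fromℕ (suc m) + x ∎

  module _ (m rest : ℕ) (0<m : 0 ℕ.< m) where

    open Blocks m rest

    Φ : ∀ k → Mean (Vec (Fin m) k)
    Φ = power (uniform m 0<m)

    private
      U : Mean (Fin m)
      U = uniform m 0<m

      0<m′ : 0# < fromℕ m
      0<m′ = 0<fromℕ {m} 0<m

    -- The overlaps in the k blocks are independent, each of probability 1/m.
    𝔼-overlap : ∀ k {x} → 0# ≤ x →
      𝔼 (Φ k) (λ φ → 𝔼 (Φ k) λ ψ → x ^ ∣ select φ ∩ select ψ ∣) ≤ (1# + x * fromℕ m ⁻¹) ^ k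
    𝔼-overlap zero    {x} 0≤x = ≤-reflexive (reflexive (≡.cong (x ^_) (∣⊥∩∣ {rest} ⊥)))
    𝔼-overlap (suc k) {x} 0≤x = begin
      𝔼 U (λ a → 𝔼 (Φ k) λ φ → 𝔼 U λ b → 𝔼 (Φ k) λ ψ → x ^ ∣ (⁅ a ⁆ Vec.++ select φ) ∩ (⁅ b ⁆ Vec.++ select ψ) ∣)
        ≤⟨ mono U (λ a → mono (Φ k) λ φ → block a φ) ⟩
      𝔼 U (λ a → 𝔼 (Φ k) λ φ → (1# + x * fromℕ m ⁻¹) * 𝔼 (Φ k) λ ψ → x ^ ∣ select φ ∩ select ψ ∣)
        ≈⟨ const U _ ⟩
      𝔼 (Φ k) (λ φ → (1# + x * fromℕ m ⁻¹) * 𝔼 (Φ k) λ ψ → x ^ ∣ select φ ∩ select ψ ∣)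
        ≈⟨ *-homo (Φ k) _ _ ⟩
      (1# + x * fromℕ m ⁻¹) * 𝔼 (Φ k) (λ φ → 𝔼 (Φ k) λ ψ → x ^ ∣ select φ ∩ select ψ ∣)
        ≤⟨ *-monoʳ-≤ (+-nonNeg (<⇒≤ 0<1) (*-nonNeg 0≤x (<⇒≤ (⁻¹-pos 0<m′)))) (𝔼-overlap k 0≤x) ⟩
      (1# + x * fromℕ m ⁻¹) ^ suc k ∎
      where
      block : ∀ a φ →
        𝔼 U (λ b → 𝔼 (Φ k) λ ψ → x ^ ∣ (⁅ a ⁆ Vec.++ select φ) ∩ (⁅ b ⁆ Vec.++ select ψ) ∣)
        ≤ (1# + x * fromℕ m ⁻¹) * 𝔼 (Φ k) λ ψ → x ^ ∣ select φ ∩ select ψ ∣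
      block a φ = begin
        𝔼 U (λ b → 𝔼 (Φ k) λ ψ → x ^ ∣ (⁅ a ⁆ Vec.++ select φ) ∩ (⁅ b ⁆ Vec.++ select ψ) ∣)
          ≈⟨ cong U (λ b → trans
              (cong (Φ k) λ ψ → trans
                (reflexive (≡.cong (x ^_) (∣∩-++∣ ⁅ a ⁆ ⁅ b ⁆ (select φ) (select ψ))))
                (^-homo-* x ∣ ⁅ a ⁆ ∩ ⁅ b ⁆ ∣ ∣ select φ ∩ select ψ ∣))
              (*-homo (Φ k) _ _)) ⟩
        𝔼 U (λ b → x ^ ∣ ⁅ a ⁆ ∩ ⁅ b ⁆ ∣ * 𝔼 (Φ k) λ ψ → x ^ ∣ select φ ∩ select ψ ∣)
          ≈⟨ *-homoʳ U _ _ ⟩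
        𝔼 U (λ b → x ^ ∣ ⁅ a ⁆ ∩ ⁅ b ⁆ ∣) * (𝔼 (Φ k) λ ψ → x ^ ∣ select φ ∩ select ψ ∣)
          ≤⟨ *-monoˡ-≤
              (≤-trans (≤-reflexive (sym (const (Φ k) 0#))) (mono (Φ k) λ ψ → ^-nonNeg ∣ select φ ∩ select ψ ∣ 0≤x))
              (begin
                sum (λ b → x ^ ∣ ⁅ a ⁆ ∩ ⁅ b ⁆ ∣) * fromℕ m ⁻¹
                  ≤⟨ *-monoˡ-≤ (<⇒≤ (⁻¹-pos 0<m′)) (sum-x^∣⁅a⁆∩⁅b⁆∣ a 0≤x) ⟩
                (fromℕ m + x) * fromℕ m ⁻¹
                  ≈⟨ distribʳ _ _ _ ⟩
                fromℕ m * fromℕ m ⁻¹ + x * fromℕ m ⁻¹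
                  ≈⟨ +-congʳ (x*x⁻¹ 0<m′) ⟩
                1# + x * fromℕ m ⁻¹ ∎) ⟩
        (1# + x * fromℕ m ⁻¹) * (𝔼 (Φ k) λ ψ → x ^ ∣ select φ ∩ select ψ ∣) ∎

-- The second moment of the normalised count of good choices.

module SecondMoment (em : ExcludedMiddle 0ℓ) (ℛ : CompleteOrderedField)
  {p : CompleteOrderedField.Carrier ℛ}
  (0<p : Real._<_ em ℛ (CompleteOrderedField.0# ℛ) p)
  (p<1 : Real._<_ em ℛ p (CompleteOrderedField.1# ℛ)) where

  open Real em ℛ hiding (zero)
  open RingSolver em ℛ
  open OrderedField em ℛ
  open Expectation em ℛ
  open PairProducts em ℛ
  open Overlap em ℛ
  open Mean

  q P Q : ℝ
  q = 1# - p
  P = p ⁻¹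
  Q = q ⁻¹

  0<q : 0# < q
  0<q = <⇒0<- p<1

  1≤P : 1# ≤ P
  1≤P = x≤1⇒1≤x⁻¹ 0<p (<⇒≤ p<1)

  1≤Q : 1# ≤ Q
  1≤Q = x≤1⇒1≤x⁻¹ 0<q (≤-by (<⇒≤ 0<p) (solve 1 (λ p → κ 1 :- (κ 1 :- p) := p) refl p))

  0≤P : 0# ≤ P
  0≤P = ≤-trans (<⇒≤ 0<1) 1≤P

  0≤Q : 0# ≤ Q
  0≤Q = ≤-trans (<⇒≤ 0<1) 1≤Q

  private
    C : Mean Bool
    C = coin p (<⇒≤ 0<p) (<⇒≤ p<1)

    pP : p * P ≈ 1#
    pP = x*x⁻¹ 0<p

    qQ : q * Q ≈ 1#
    qQ = x*x⁻¹ 0<q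

  -- The indicator that a pair is in the wanted state, divided by its probability: it has mean 1,
  -- and mean square 1/p or 1/q.
  match : (wanted actual : Bool) → ℝ
  match true  true  = P
  match true  false = 0#
  match false true  = 0#
  match false false = Q

  constraint : (constrained wanted : Bool) → Bool → ℝ
  constraint c w s = if c then match w s else 1#

  private
    𝔼-constraint : ∀ c w → 𝔼 C (constraint c w) ≈ 1#
    𝔼-constraint false w     = unit C
    𝔼-constraint true  true  = trans (+-cong pP (zeroʳ q)) (+-identityʳ 1#)
    𝔼-constraint true  false = trans (+-cong (zeroʳ p) qQ) (+-identityˡ 1#)

    inverse : Bool → ℝ
    inverse true  = P
    inverse false = Q

    -- Both factors carry the same `w`, since the wanted state of a pair does not depend on the
    -- choice. A doubly constrained pair therefore leaves one factor 1/p or 1/q, and never makes the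
    -- product vanish identically.
    𝔼-constraint² : ∀ c c′ w → 𝔼 C (λ s → constraint c w s * constraint c′ w s)
                               ≈ (if c ∧ c′ then inverse w else 1#)
    𝔼-constraint² false c′    w     = trans (cong C λ s → *-identityˡ (constraint c′ w s)) (𝔼-constraint c′ w)
    𝔼-constraint² true  false w     = trans (cong C λ s → *-identityʳ (match w s)) (𝔼-constraint true w)
    𝔼-constraint² true  true  true  = trans
      (solve 3 (λ p q P → p :* (P :* P) :+ q :* (κ 0 :* κ 0) := p :* P :* P) refl p q P)
      (trans (*-congʳ pP) (*-identityˡ P))
    𝔼-constraint² true  true  false = trans
      (solve 3 (λ p q Q → p :* (κ 0 :* κ 0) :+ q :* (Q :* Q) := q :* Q :* Q) refl p q Q)
      (trans (*-congʳ qQ) (*-identityˡ Q))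

    ∧-interchange : ∀ a b c d → (a ∧ b) ∧ (c ∧ d) ≡ (a ∧ c) ∧ (b ∧ d)
    ∧-interchange false b     c     d = ≡.refl
    ∧-interchange true  false false d = ≡.refl
    ∧-interchange true  false true  d = ≡.refl
    ∧-interchange true  true  c     d = ≡.refl

  module _ {n} (L : Subset n) where

    wanted : Fin n × Fin n → Bool
    wanted (u , v) = Vec.lookup L u ∧ Vec.lookup L v

    inside? : Subset n → Fin n × Fin n → Bool
    inside? W (u , v) = Vec.lookup W u ∧ Vec.lookup W v

    -- The indicator that the pairs of W inside L are edges and the other pairs
    -- of W are not, divided by its probability.
    weight : Subset n → EdgeSet n → ℝ
    weight W E = product λ e →
      constraint (inside? W (List.lookup (pairs n) e)) (wanted (List.lookup (pairs n) e)) (Vec.lookup E e)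

    private
      M : Mean (EdgeSet n)
      M = power C (length (pairs n))

    𝔼-weight : ∀ W → 𝔼 M (weight W) ≈ 1#
    𝔼-weight W = trans (𝔼-product C {length (pairs n)} λ e →
      constraint (inside? W (List.lookup (pairs n) e)) (wanted (List.lookup (pairs n) e)))
      (product-1 {length (pairs n)} λ e → 𝔼-constraint (inside? W (List.lookup (pairs n) e)) (wanted (List.lookup (pairs n) e)))

    -- By independence only pairs with both ends in `W ∩ W′` matter: those inside `L` contribute
    -- `P`, the others `Q`. Charging `Q` to the former as well, which `1≤Q` permits, separates the
    -- two powers.
    𝔼-weight-* : ∀ W W′ → 𝔼 M (λ E → weight W E * weight W′ E)
                 ≤ P ^ tri ∣ (W ∩ W′) ∩ L ∣ * Q ^ tri ∣ W ∩ W′ ∣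
    𝔼-weight-* W W′ = begin
      𝔼 M (λ E → weight W E * weight W′ E)
        ≈⟨ cong M (λ E → sym (product-* {length (pairs n)} _ _)) ⟩
      𝔼 M (λ E → product λ e → constraint (inside? W (pair e)) (wanted (pair e)) (Vec.lookup E e)
                             * constraint (inside? W′ (pair e)) (wanted (pair e)) (Vec.lookup E e))
        ≈⟨ 𝔼-product C {length (pairs n)} (λ e s → constraint (inside? W (pair e)) (wanted (pair e)) s
                             * constraint (inside? W′ (pair e)) (wanted (pair e)) s) ⟩
      product (λ e → 𝔼 C (λ s → constraint (inside? W (pair e)) (wanted (pair e)) s
                             * constraint (inside? W′ (pair e)) (wanted (pair e)) s))
        ≈⟨ product-cong {length (pairs n)} (λ e → 𝔼-constraint² (inside? W (pair e)) (inside? W′ (pair e)) (wanted (pair e))) ⟩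
      product (λ e → if inside? W (pair e) ∧ inside? W′ (pair e) then inverse (wanted (pair e)) else 1#)
        ≈⟨ product-pairs n (λ uv → if inside? W uv ∧ inside? W′ uv then inverse (wanted uv) else 1#) ⟩
      pairProduct n (λ u v → if inside? W (u , v) ∧ inside? W′ (u , v) then inverse (wanted (u , v)) else 1#)
        ≤⟨ pairProduct-mono
            (λ u v → nonNeg (inside? W (u , v) ∧ inside? W′ (u , v)) (wanted (u , v)))
            (λ u v → bound u v) ⟩
      pairProduct n (λ u v → both ((W ∩ W′) ∩ L) P u v * both (W ∩ W′) Q u v)
        ≈⟨ pairProduct-* (both ((W ∩ W′) ∩ L) P) (both (W ∩ W′) Q) ⟩
      pairProduct n (both ((W ∩ W′) ∩ L) P) * pairProduct n (both (W ∩ W′) Q)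
        ≈⟨ *-cong (pairProduct-both ((W ∩ W′) ∩ L) P) (pairProduct-both (W ∩ W′) Q) ⟩
      P ^ tri ∣ (W ∩ W′) ∩ L ∣ * Q ^ tri ∣ W ∩ W′ ∣ ∎
      where
      pair : Fin (length (pairs n)) → Fin n × Fin n
      pair = List.lookup (pairs n)

      nonNeg : ∀ c w → 0# ≤ (if c then inverse w else 1#)
      nonNeg false w     = <⇒≤ 0<1
      nonNeg true  true  = 0≤P
      nonNeg true  false = 0≤Q

      bool-bound : ∀ a b l l′ → (if a ∧ b then inverse (l ∧ l′) else 1#)
        ≤ (if (a ∧ l) ∧ (b ∧ l′) then P else 1#) * (if a ∧ b then Q else 1#)
      bool-bound false b     l     l′    = ≤-reflexive (sym (*-identityˡ 1#))
      bool-bound true  false false l′    = ≤-reflexive (sym (*-identityˡ 1#))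
      bool-bound true  false true  l′    = ≤-reflexive (sym (*-identityˡ 1#))
      bool-bound true  true  false l′    = ≤-reflexive (sym (*-identityˡ Q))
      bool-bound true  true  true  false = ≤-reflexive (sym (*-identityˡ Q))
      bool-bound true  true  true  true  =
        ≤-trans (≤-reflexive (sym (*-identityʳ P))) (*-monoʳ-≤ 0≤P 1≤Q)

      bound : ∀ u v → (if inside? W (u , v) ∧ inside? W′ (u , v) then inverse (wanted (u , v)) else 1#)
                      ≤ both ((W ∩ W′) ∩ L) P u v * both (W ∩ W′) Q u v
      bound u v
        rewrite Vec.lookup-zipWith _∧_ u (W ∩ W′) L | Vec.lookup-zipWith _∧_ v (W ∩ W′) L
              | Vec.lookup-zipWith _∧_ u W W′ | Vec.lookup-zipWith _∧_ v W W′
              | ∧-interchange (Vec.lookup W u) (Vec.lookup W v) (Vec.lookup W′ u) (Vec.lookup W′ v)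
        = bool-bound (Vec.lookup W u ∧ Vec.lookup W′ u) (Vec.lookup W v ∧ Vec.lookup W′ v) _ _

  -- Replacing the exponent tri l by a linear one makes the mean over the overlap a
  -- product; the factor Λ² is gained because overlaps of size at most 1 share no
  -- pair.
  overlap-bound : ∀ {r c l l′ Λ K} → l ℕ.≤ suc (2 ℕ.* r) → l′ ℕ.≤ l → l′ ℕ.≤ c →
    1# ≤ Λ → 0# ≤ K → K * (Λ * Λ) ≈ P ^ tri c →
    P ^ tri l′ * Q ^ tri l ≤ 1# + K * (Q ^ r * Λ) ^ l
  overlap-bound {r} {c} {l} {l′} {Λ} {K} l≤ l′≤l l′≤c 1≤Λ 0≤K KΛ² = go l l≤ l′≤l
    where
    0≤QʳΛ : 0# ≤ Q ^ r * Λ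
    0≤QʳΛ = *-nonNeg (^-nonNeg r 0≤Q) (≤-trans (<⇒≤ 0<1) 1≤Λ)

    trivial : ∀ l → P ^ 0 * Q ^ 0 ≤ 1# + K * (Q ^ r * Λ) ^ l
    trivial l = ≤-by (*-nonNeg 0≤K (^-nonNeg l 0≤QʳΛ))
      (solve 1 (λ a → κ 1 :+ a :- κ 1 :* κ 1 := a) refl (K * (Q ^ r * Λ) ^ l))

    tri≡0 : ∀ {l′} → l′ ℕ.≤ 1 → tri l′ ≡ 0
    tri≡0 ℕ.z≤n           = ≡.refl
    tri≡0 (ℕ.s≤s ℕ.z≤n) = ≡.refl

    go : ∀ l → l ℕ.≤ suc (2 ℕ.* r) → l′ ℕ.≤ l → P ^ tri l′ * Q ^ tri l ≤ 1# + K * (Q ^ r * Λ) ^ l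
    go zero          l≤ l′≤l rewrite tri≡0 (ℕ.m≤n⇒m≤1+n l′≤l) = trivial 0
    go (suc zero)    l≤ l′≤l rewrite tri≡0 l′≤l                = trivial 1
    go (suc (suc l)) l≤ l′≤l = begin
      P ^ tri l′ * Q ^ tri (2 ℕ.+ l)
        ≤⟨ *-mono-≤ (^-nonNeg (tri l′) 0≤P) (^-monoʳ-≤ 1≤P (tri-mono l′≤c))
                    (^-nonNeg (tri (2 ℕ.+ l)) 0≤Q) (^-monoʳ-≤ 1≤Q (tri≤l*r {2 ℕ.+ l} {r} l≤)) ⟩
      P ^ tri c * Q ^ ((2 ℕ.+ l) ℕ.* r)
        ≈⟨ *-cong KΛ² (reflexive (≡.cong (Q ^_) (ℕ.*-comm r (2 ℕ.+ l)))) ⟨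
      K * (Λ * Λ) * Q ^ (r ℕ.* (2 ℕ.+ l))
        ≈⟨ *-cong (solve 2 (λ K Λ → K :* (Λ :* Λ) := K :* Λ :^ 2) refl K Λ) (sym (^-assocʳ Q r (2 ℕ.+ l))) ⟩
      K * Λ ^ 2 * (Q ^ r) ^ (2 ℕ.+ l)
        ≤⟨ *-monoˡ-≤ (^-nonNeg (2 ℕ.+ l) (^-nonNeg r 0≤Q))
            (*-monoʳ-≤ 0≤K (^-monoʳ-≤ 1≤Λ (ℕ.s≤s (ℕ.s≤s (ℕ.z≤n {l}))))) ⟩
      K * Λ ^ (2 ℕ.+ l) * (Q ^ r) ^ (2 ℕ.+ l)
        ≈⟨ solve 3 (λ K a b → K :* a :* b := K :* (b :* a)) refl K _ _ ⟩
      K * ((Q ^ r) ^ (2 ℕ.+ l) * Λ ^ (2 ℕ.+ l))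
        ≈⟨ *-congˡ (^-distrib-* (Q ^ r) Λ (2 ℕ.+ l)) ⟨
      K * (Q ^ r * Λ) ^ (2 ℕ.+ l)
        ≤⟨ ≤-by (<⇒≤ 0<1) (solve 1 (λ a → κ 1 :+ a :- a := κ 1) refl _) ⟩
      1# + K * (Q ^ r * Λ) ^ (2 ℕ.+ l) ∎

  module _ (m rest : ℕ) (0<m : 0 ℕ.< m) (c s r : ℕ) (c+s≡ : c ℕ.+ s ≡ suc (2 ℕ.* r)) where

    open Blocks m rest

    private
      k n : ℕ
      k = c ℕ.+ s
      n = size k

      M : Mean (EdgeSet n)
      M = power C (length (pairs n))

      Φₖ : Mean (Vec (Fin m) k)
      Φₖ = Φ m rest 0<m k

      Y : EdgeSet n → ℝ
      Y E = 𝔼 Φₖ λ φ → weight (prefix c s) (select φ) E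

      𝔼Y : 𝔼 M Y ≈ 1#
      𝔼Y = begin-equality
        𝔼 M (λ E → 𝔼 Φₖ λ φ → weight (prefix c s) (select φ) E)
          ≈⟨ 𝔼-swap M 0<m k (λ φ → weight (prefix c s) (select φ)) ⟩
        𝔼 Φₖ (λ φ → 𝔼 M (weight (prefix c s) (select φ)))
          ≈⟨ cong Φₖ (λ φ → 𝔼-weight (prefix c s) (select φ)) ⟩
        𝔼 Φₖ (λ φ → 1#)
          ≈⟨ unit Φₖ ⟩
        1# ∎

      -- The square of an average is a double average over φ and ψ, and `𝔼-swap` brings the mean
      -- over edge sets inside. There `overlap-bound` leaves a power of the overlap with base x =
      -- Q^r Λ, whose double average `𝔼-overlap` bounds by a product over the blocks.
      𝔼Y² : ∀ {Λ K} → 1# ≤ Λ → 0# ≤ K → K * (Λ * Λ) ≈ P ^ tri c →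
            𝔼 M (λ E → Y E * Y E) ≤ 1# + K * (1# + Q ^ r * Λ * fromℕ m ⁻¹) ^ k
      𝔼Y² {Λ} {K} 1≤Λ 0≤K KΛ² = begin
        𝔼 M (λ E → Y E * Y E)
          ≈⟨ cong M (λ E → trans (sym (*-homoʳ Φₖ (λ φ → G φ E) (Y E)))
                (cong Φₖ λ φ → sym (*-homo Φₖ (G φ E) (λ ψ → G ψ E)))) ⟩
        𝔼 M (λ E → 𝔼 Φₖ λ φ → 𝔼 Φₖ λ ψ → G φ E * G ψ E)
          ≈⟨ 𝔼-swap M 0<m k (λ φ E → 𝔼 Φₖ λ ψ → G φ E * G ψ E) ⟩
        𝔼 Φₖ (λ φ → 𝔼 M λ E → 𝔼 Φₖ λ ψ → G φ E * G ψ E)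
          ≈⟨ cong Φₖ (λ φ → 𝔼-swap M 0<m k (λ ψ E → G φ E * G ψ E)) ⟩
        𝔼 Φₖ (λ φ → 𝔼 Φₖ λ ψ → 𝔼 M λ E → G φ E * G ψ E)
          ≤⟨ mono Φₖ (λ φ → mono Φₖ λ ψ → ≤-trans (𝔼-weight-* (prefix c s) (select φ) (select ψ))
               (overlap-bound {r} {c} (≡.subst (∣ select φ ∩ select ψ ∣ ℕ.≤_) (≡.trans (∣select∣ φ) c+s≡)
                                (Subset.∣p∩q∣≤∣p∣ (select φ) (select ψ)))
                 (Subset.∣p∩q∣≤∣p∣ (select φ ∩ select ψ) (prefix c s))
                 (≡.subst (∣ (select φ ∩ select ψ) ∩ prefix c s ∣ ℕ.≤_) (∣select∩prefix∣ c φ) (Subset.p⊆q⇒∣p∣≤∣q∣ (shrink φ ψ)))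
                 1≤Λ 0≤K KΛ²)) ⟩
        𝔼 Φₖ (λ φ → 𝔼 Φₖ λ ψ → 1# + K * x ^ ∣ select φ ∩ select ψ ∣)
          ≈⟨ cong Φₖ (λ φ → trans (+-homo Φₖ (λ _ → 1#) (λ ψ → K * x ^ ∣ select φ ∩ select ψ ∣))
               (+-cong (unit Φₖ) (*-homo Φₖ K (λ ψ → x ^ ∣ select φ ∩ select ψ ∣)))) ⟩
        𝔼 Φₖ (λ φ → 1# + K * 𝔼 Φₖ λ ψ → x ^ ∣ select φ ∩ select ψ ∣)
          ≈⟨ trans (+-homo Φₖ (λ _ → 1#) _) (+-cong (unit Φₖ) (*-homo Φₖ K _)) ⟩
        1# + K * 𝔼 Φₖ (λ φ → 𝔼 Φₖ λ ψ → x ^ ∣ select φ ∩ select ψ ∣)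
          ≤⟨ +-monoʳ-≤ 1# (*-monoʳ-≤ 0≤K (𝔼-overlap m rest 0<m k 0≤x)) ⟩
        1# + K * (1# + x * fromℕ m ⁻¹) ^ k ∎
        where
        G : Vec (Fin m) k → EdgeSet n → ℝ
        G φ = weight (prefix c s) (select φ)

        x : ℝ
        x = Q ^ r * Λ

        0≤x : 0# ≤ x
        0≤x = *-nonNeg (^-nonNeg r 0≤Q) (≤-trans (<⇒≤ 0<1) 1≤Λ)

        shrink : ∀ φ ψ {v} → v ∈ (select φ ∩ select ψ) ∩ prefix c s → v ∈ select φ ∩ prefix c s
        shrink φ ψ v∈ = let v∈₁ , v∈₂ = Subset.x∈p∩q⁻ (select φ ∩ select ψ) (prefix c s) v∈
          in Subset.x∈p∩q⁺ (proj₁ (Subset.x∈p∩q⁻ (select φ) (select ψ) v∈₁) , v∈₂)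

    -- Bernoulli gives (1 - y)^k ≥ 1 - k y = 1/2 for the exponent k used here, and (1 + y)(1 - y) ≤
    -- 1, so (1 + y)^k is at most the inverse of 1/2.
    [1+y]^k≤2 : ∀ k {y} → 0# ≤ y → 2# * fromℕ (suc k) * y ≈ 1# → (1# + y) ^ suc k ≤ 2#
    [1+y]^k≤2 k {y} 0≤y 2ky≈1 = *-cancelʳ-≤ (⁻¹-pos 0<2) (begin
      (1# + y) ^ suc k * 2# ⁻¹           ≤⟨ *-monoʳ-≤ (^-nonNeg (suc k) 0≤1+y) half≤ ⟩
      (1# + y) ^ suc k * (1# - y) ^ suc k ≈⟨ ^-distrib-* (1# + y) (1# - y) (suc k) ⟨
      ((1# + y) * (1# - y)) ^ suc k      ≤⟨ x^n≤1 (suc k) (*-nonNeg 0≤1+y 0≤1-y)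
                                              (≤-by (0≤x*x y) (solve 1 (λ y →
                                                κ 1 :- (κ 1 :+ y) :* (κ 1 :- y) := y :* y) refl y)) ⟩
      1#                                 ≈⟨ x*x⁻¹ 0<2 ⟨
      2# * 2# ⁻¹                         ∎)
      where
      ky : ℝ
      ky = fromℕ (suc k) * y

      ky≈half : ky ≈ 2# ⁻¹
      ky≈half = begin-equality
        ky                    ≈⟨ *-identityʳ ky ⟨
        ky * 1#               ≈⟨ *-congˡ (x*x⁻¹ 0<2) ⟨
        ky * (2# * 2# ⁻¹)     ≈⟨ solve 3 (λ k y h → k :* y :* (κ 2 :* h) := κ 2 :* k :* y :* h)
                                   refl (fromℕ (suc k)) y (2# ⁻¹) ⟩
        2# * fromℕ (suc k) * y * 2# ⁻¹ ≈⟨ *-congʳ 2ky≈1 ⟩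
        1# * 2# ⁻¹            ≈⟨ *-identityˡ _ ⟩
        2# ⁻¹                 ∎

      0≤1+y : 0# ≤ 1# + y
      0≤1+y = +-nonNeg (<⇒≤ 0<1) 0≤y

      0≤1-y : 0# ≤ 1# - y
      0≤1-y = ≤-resp refl
        (trans (solve 2 (λ k y → (κ 1 :+ k) :* y :+ (κ 1 :+ k) :* y :- y :+ (κ 0) := κ 2 :* (κ 1 :+ k) :* y :- y)
                 refl (fromℕ k) y) (+-congʳ 2ky≈1))
        (≤-by (+-nonNeg 0≤y (*-nonNeg (0≤fromℕ 2) (*-nonNeg (0≤fromℕ k) 0≤y)))
          (solve 2 (λ k y → ((κ 1 :+ k) :* y :+ (κ 1 :+ k) :* y :- y :+ κ 0) :- κ 0
                            := y :+ κ 2 :* (k :* y)) refl (fromℕ k) y))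

      half≤ : 2# ⁻¹ ≤ (1# - y) ^ suc k
      half≤ = begin
        2# ⁻¹                          ≈⟨ solve 1 (λ h → h := h :+ h :- h) refl (2# ⁻¹) ⟩
        2# ⁻¹ + 2# ⁻¹ - 2# ⁻¹          ≈⟨ +-cong (trans (solve 1 (λ h → h :+ h := κ 2 :* h) refl (2# ⁻¹)) (x*x⁻¹ 0<2)) (-‿cong (sym ky≈half)) ⟩
        1# - ky                        ≈⟨ solve 2 (λ k y → κ 1 :- k :* y := κ 1 :+ k :* (:- y)) refl (fromℕ (suc k)) y ⟩
        1# + fromℕ (suc k) * - y       ≤⟨ bernoulli (suc k) 0≤1-y ⟩
        (1# - y) ^ suc k               ∎

    -- With 𝔼Y = 1 and 𝔼Y² ≤ 1 + 2K the lower bound for the probability is 1 - 2K, so K < 1/4 is the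
    -- aim. For K = P^D / Λ² with D = `tri c` and Λ = m q^r / (2k), this reads 16 k² P^D < (m q^r)².
    half<ℙ : (A : Graph (Fin (size (c ℕ.+ s))) → Set) →
      (∀ φ E → ¬ weight (prefix c s) (select φ) E ≈ 0# → A (graph E)) →
      fromℕ 16 * (fromℕ (c ℕ.+ s) * fromℕ (c ℕ.+ s)) * P ^ tri c
        < fromℕ m * q ^ r * (fromℕ m * q ^ r) →
      2# ⁻¹ < ℙ (size (c ℕ.+ s)) p A
    half<ℙ A weight⇒A h = begin-strict
      2# ⁻¹
        ≈⟨ solve 1 (λ h → h := κ 2 :- (κ 1 :+ h) :+ (h :+ h :- κ 1)) refl (2# ⁻¹) ⟩
      2# - (1# + 2# ⁻¹) + (2# ⁻¹ + 2# ⁻¹ - 1#)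
        ≈⟨ +-congˡ (+-congʳ (trans (solve 1 (λ h → h :+ h := κ 2 :* h) refl (2# ⁻¹)) (x*x⁻¹ 0<2))) ⟩
      2# - (1# + 2# ⁻¹) + (1# - 1#)
        <⟨ <-by (<⇒0<- K*2<half) (solve 2 (λ K h →
             (κ 2 :* κ 1 :- (κ 1 :+ K :* κ 2)) :- (κ 2 :- (κ 1 :+ h) :+ (κ 1 :- κ 1)) := h :- K :* κ 2) refl K (2# ⁻¹)) ⟩
      2# * 1# - (1# + K * 2#)
        ≤⟨ +-mono-≤ (≤-reflexive (*-congˡ (sym 𝔼Y))) (-‿anti-≤ (≤-trans (𝔼Y² 1≤Λ 0≤K KΛ²)
             (+-monoʳ-≤ 1# (*-monoʳ-≤ 0≤K power≤2)))) ⟩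
      2# * 𝔼 M Y - 𝔼 M (λ E → Y E * Y E)
        ≤⟨ second-moment (<⇒≤ 0<p) (<⇒≤ p<1) A Y Y≈0 ⟩
      ℙ n p A ∎
      where
      D : ℕ
      D = tri c

      0<k′ : 0# < fromℕ k
      0<k′ = 0<fromℕ {k} (≡.subst (0 ℕ.<_) (≡.sym c+s≡) (ℕ.s≤s ℕ.z≤n))

      0<2k : 0# < 2# * fromℕ k
      0<2k = *-pos 0<2 0<k′

      0<m′ : 0# < fromℕ m
      0<m′ = 0<fromℕ {m} 0<m

      -- `y` is 1/(2k), for which (1 + y)^k is at most 2. `Λ` is solved from Q^r Λ / m = y, and `K`
      -- from the equation that `overlap-bound` demands.
      y Λ K : ℝ
      y = (2# * fromℕ k) ⁻¹
      Λ = fromℕ m * q ^ r * y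
      K = P ^ D * (Λ * Λ) ⁻¹

      0<y : 0# < y
      0<y = ⁻¹-pos 0<2k

      0<Λ : 0# < Λ
      0<Λ = *-pos (*-pos 0<m′ (^-pos r 0<q)) 0<y

      1≤Pᴰ : 1# ≤ P ^ D
      1≤Pᴰ = 1≤x^n D 1≤P

      2ky≈1 : 2# * fromℕ k * y ≈ 1#
      2ky≈1 = x*x⁻¹ 0<2k

      4Pᴰ<Λ² : fromℕ 4 * P ^ D < Λ * Λ
      4Pᴰ<Λ² = begin-strict
        fromℕ 4 * P ^ D
          ≈⟨ trans (*-congˡ (*-congˡ 2ky≈1)) (trans (*-congˡ (*-identityʳ _)) (*-identityʳ _)) ⟨
        fromℕ 4 * P ^ D * (1# * (2# * fromℕ k * y))
          ≈⟨ *-congˡ (*-congʳ 2ky≈1) ⟨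
        fromℕ 4 * P ^ D * (2# * fromℕ k * y * (2# * fromℕ k * y))
          ≈⟨ solve 3 (λ a k y → κ 4 :* a :* (κ 2 :* k :* y :* (κ 2 :* k :* y))
               := κ 16 :* (k :* k) :* a :* (y :* y)) refl (P ^ D) (fromℕ k) y ⟩
        fromℕ 16 * (fromℕ k * fromℕ k) * P ^ D * (y * y)
          <⟨ *-monoˡ-< (*-pos 0<y 0<y) h ⟩
        fromℕ m * q ^ r * (fromℕ m * q ^ r) * (y * y)
          ≈⟨ solve 2 (λ a y → a :* a :* (y :* y) := a :* y :* (a :* y)) refl (fromℕ m * q ^ r) y ⟩
        Λ * Λ ∎

      1≤Λ : 1# ≤ Λ
      1≤Λ = ≮⇒≥ λ Λ<1 → <⇒≱ 4Pᴰ<Λ² (begin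
        Λ * Λ            ≤⟨ *-mono-≤ (<⇒≤ 0<Λ) (<⇒≤ Λ<1) (<⇒≤ 0<Λ) (<⇒≤ Λ<1) ⟩
        1# * 1#          ≤⟨ *-mono-≤ (<⇒≤ 0<1)
                              (≤-by (0≤fromℕ 3) (solve 0 (κ 4 :- κ 1 := κ 3) refl)) (<⇒≤ 0<1) 1≤Pᴰ ⟩
        fromℕ 4 * P ^ D  ∎)

      0<Λ² : 0# < Λ * Λ
      0<Λ² = *-pos 0<Λ 0<Λ

      0≤K : 0# ≤ K
      0≤K = *-nonNeg (^-nonNeg D 0≤P) (<⇒≤ (⁻¹-pos 0<Λ²))

      KΛ² : K * (Λ * Λ) ≈ P ^ D
      KΛ² = *⁻¹-cancel (P ^ D) 0<Λ²

      K*2<half : K * 2# < 2# ⁻¹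
      K*2<half = *-cancelʳ-< (<⇒≤ (*-pos 0<2 0<Λ²)) (begin-strict
        K * 2# * (2# * (Λ * Λ))     ≈⟨ solve 2 (λ K L → K :* κ 2 :* (κ 2 :* L) := κ 4 :* (K :* L)) refl K (Λ * Λ) ⟩
        fromℕ 4 * (K * (Λ * Λ))     ≈⟨ *-congˡ KΛ² ⟩
        fromℕ 4 * P ^ D             <⟨ 4Pᴰ<Λ² ⟩
        Λ * Λ                       ≈⟨ *-identityˡ _ ⟨
        1# * (Λ * Λ)                ≈⟨ *-congʳ (⁻¹-inverseˡ (pos⇒≉0 0<2)) ⟨
        2# ⁻¹ * 2# * (Λ * Λ)        ≈⟨ *-assoc _ _ _ ⟩
        2# ⁻¹ * (2# * (Λ * Λ))      ∎)

      rate : Q ^ r * Λ * fromℕ m ⁻¹ ≈ y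
      rate = begin-equality
        Q ^ r * (fromℕ m * q ^ r * y) * fromℕ m ⁻¹
          ≈⟨ solve 5 (λ Q m q y i → Q :* (m :* q :* y) :* i := q :* Q :* (m :* i) :* y)
               refl (Q ^ r) (fromℕ m) (q ^ r) y (fromℕ m ⁻¹) ⟩
        q ^ r * Q ^ r * (fromℕ m * fromℕ m ⁻¹) * y
          ≈⟨ *-congʳ (*-cong (x^n*x⁻¹^n r 0<q) (x*x⁻¹ 0<m′)) ⟩
        1# * 1# * y
          ≈⟨ trans (*-congʳ (*-identityˡ 1#)) (*-identityˡ y) ⟩
        y ∎

      power≤2 : (1# + Q ^ r * Λ * fromℕ m ⁻¹) ^ k ≤ 2#
      power≤2 = ≤-trans (≤-reflexive (^-congˡ k (+-congˡ rate)))
        (≡.subst (λ k → (1# + y) ^ k ≤ 2#) (≡.sym c+s≡)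
          ([1+y]^k≤2 (2 ℕ.* r) (<⇒≤ 0<y) (≡.subst (λ k → 2# * fromℕ k * y ≈ 1#) c+s≡ 2ky≈1)))

      Y≈0 : ∀ E → ¬ A (graph E) → Y E ≈ 0#
      Y≈0 E ¬A = trans (cong Φₖ weight≈0) (const Φₖ 0#)
        where
        weight≈0 : ∀ φ → weight (prefix c s) (select φ) E ≈ 0#
        weight≈0 φ with em {weight (prefix c s) (select φ) E ≈ 0#}
        ... | yes e = e
        ... | no ¬e = ⊥-elim (¬A (weight⇒A φ E ¬e))

-- A regular simplex with inner points, and its diameter graph.

IsCorner : ∀ {c s} → Fin c ⊎ Fin s → Set
IsCorner {c} {s} z = ∃[ a ] z ≡ inj₁ {A = Fin c} {B = Fin s} a

module Geometry (em : ExcludedMiddle 0ℓ) (ℛ : CompleteOrderedField) where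

  open RingSolver em ℛ
  open Real em ℛ hiding (zero)
  open OrderedField em ℛ
  open SquareRoot em ℛ
  open Algebra.Properties.Semiring.Sum semiring using (sum-cong-≋; sum-replicate)
  open Data.List.Extrema totalOrder using (max; xs≤max; max≤v⁺)

  sum-nonNeg : ∀ {n} (f : Fin n → ℝ) → (∀ i → 0# ≤ f i) → 0# ≤ sum f
  sum-nonNeg {zero}  f _   = ≤-refl
  sum-nonNeg {suc n} f 0≤f = +-nonNeg (0≤f zero) (sum-nonNeg (f ∘ suc) (0≤f ∘ suc))

  sum-const : ∀ n c → sum {n} (λ _ → c) ≈ fromℕ n * c
  sum-const zero    c = sym (zeroˡ c)
  sum-const (suc n) c = trans (+-congˡ (sum-const n c))
    (solve 2 (λ n c → c :+ n :* c := (κ 1 :+ n) :* c) refl (fromℕ n) c)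

  sum-0 : ∀ {n} (f : Fin n → ℝ) → (∀ i → f i ≈ 0#) → sum f ≈ 0#
  sum-0 {n} f f≈0 = trans (sum-cong-≋ {n} f≈0) (trans (sum-const n 0#) (zeroʳ _))

  dist² : ∀ {d} → Point d → Point d → ℝ
  dist² x y = sum λ i → (x i - y i) ^ 2

  private
    sq : ∀ x → x ^ 2 ≈ x * x
    sq = solve 1 (λ x → x :^ 2 := x :* x) refl

  0≤dist² : ∀ {d} (x y : Point d) → 0# ≤ dist² x y
  0≤dist² x y = sum-nonNeg (λ i → (x i - y i) ^ 2) λ i →
    ≤-resp refl (sym (sq (x i - y i))) (0≤x*x (x i - y i))

  dist²-sym : ∀ {d} (x y : Point d) → dist² x y ≈ dist² y x
  dist²-sym {d} x y = sum-cong-≋ {d} λ i →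
    solve 2 (λ x y → (x :- y) :^ 2 := (y :- x) :^ 2) refl (x i) (y i)

  dist²-≋ : ∀ {d} (x y : Point d) → x ≋ y → dist² x y ≈ 0#
  dist²-≋ x y x≋y = sum-0 (λ i → (x i - y i) ^ 2) λ i → trans (sq _)
    (trans (*-congʳ (trans (+-congʳ (x≋y i)) (-‿inverseʳ (y i)))) (zeroˡ _))

  private
    dist-≤ : ∀ {d} (x y : Point d) {b} → dist² x y ≤ b → dist x y ≤ sqrt b
    dist-≤ x y = sqrt-mono-≤ (0≤dist² x y)

    dist-≥ : ∀ {d} (x y : Point d) {b} → 0# ≤ b → b ≤ dist² x y → sqrt b ≤ dist x y
    dist-≥ x y = sqrt-mono-≤

  module _ {d m} (x : Fin m → Point d) {b} (0≤b : 0# ≤ b)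
    (≤b : ∀ i j → dist² (x i) (x j) ≤ b) {i₀ j₀} (≈b : dist² (x i₀) (x j₀) ≈ b) where

    diam≈sqrt : diam x ≈ sqrt b
    diam≈sqrt = antisym
      (max≤v⁺ (0≤sqrt 0≤b) (All.map⁺ {f = distance}
        (All.universal (λ (i , j) → dist-≤ (x i) (x j) (≤b i j)) ps)))
      (≤-trans (dist-≥ (x i₀) (x j₀) 0≤b (≤-reflexive (sym ≈b)))
        (All.lookup (xs≤max 0# (List.map distance ps))
          (List.∈-map⁺ distance (List.∈-cartesianProduct⁺ (List.∈-allFin i₀) (List.∈-allFin j₀)))))
      where
      distance : Fin m × Fin m → ℝ
      distance (i , j) = dist (x i) (x j)
      ps : List (Fin m × Fin m)
      ps = cartesianProduct (allFin m) (allFin m)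

    -- Here square roots and the maximum disappear: `b` is an attained upper bound of the squared
    -- distances, and `sqrt` both preserves and reflects order.
    dist≈diam⇔ : ∀ i j → dist (x i) (x j) ≈ diam x ⇔ dist² (x i) (x j) ≈ b
    dist≈diam⇔ i j = mk⇔
      (λ e → antisym (≤b i j)
        (sqrt-cancel-≤ 0≤b (0≤dist² (x i) (x j)) (≤-reflexive (sym (trans e diam≈sqrt)))))
      (λ e → trans (antisym (dist-≤ (x i) (x j) (≤-reflexive e))
                            (dist-≥ (x i) (x j) 0≤b (≤-reflexive (sym e))))
                   (sym diam≈sqrt))

  -- Kronecker's delta; `δ i` serves as the standard basis vector e_i.
  δ : ∀ {d} → Fin d → Fin d → ℝ
  δ zero    zero    = 1#
  δ zero    (suc j) = 0#
  δ (suc i) zero    = 0#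
  δ (suc i) (suc j) = δ i j

  δ-≢ : ∀ {d} {i j : Fin d} → i ≢ j → δ i j ≈ 0#
  δ-≢ {i = zero}  {zero}  i≢j = ⊥-elim (i≢j ≡.refl)
  δ-≢ {i = zero}  {suc j} i≢j = refl
  δ-≢ {i = suc i} {zero}  i≢j = refl
  δ-≢ {i = suc i} {suc j} i≢j = δ-≢ (i≢j ∘ ≡.cong suc)

  norm² : ∀ {d} → Point d → ℝ
  norm² x = sum λ i → x i ^ 2

  norm²-δ : ∀ {d} (i : Fin d) → norm² (δ i) ≈ 1#
  norm²-δ {suc d} zero = trans (+-congˡ (sum-0 {d} (λ _ → 0# ^ 2) λ _ → trans (sq 0#) (zeroˡ 0#)))
    (solve 0 (κ 1 :^ 2 :+ κ 0 := κ 1) refl)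
  norm²-δ {suc d} (suc i) = trans (+-congˡ (norm²-δ i)) (solve 0 (κ 0 :^ 2 :+ κ 1 := κ 1) refl)

  dist²-δ : ∀ {d} (i : Fin d) (y : Point d) → dist² (δ i) y ≈ 1# - 2# * y i + norm² y
  dist²-δ {suc d} zero y = begin-equality
    (1# - y zero) ^ 2 + sum {d} (λ j → (0# - y (suc j)) ^ 2)
      ≈⟨ +-congˡ (sum-cong-≋ {d} λ j → solve 1 (λ y → (κ 0 :- y) :^ 2 := y :^ 2) refl (y (suc j))) ⟩
    (1# - y zero) ^ 2 + norm² (y ∘ suc)
      ≈⟨ solve 2 (λ y n → (κ 1 :- y) :^ 2 :+ n := κ 1 :- κ 2 :* y :+ (y :^ 2 :+ n)) refl (y zero) _ ⟩
    1# - 2# * y zero + norm² y ∎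
  dist²-δ {suc d} (suc i) y = begin-equality
    (0# - y zero) ^ 2 + dist² (δ i) (y ∘ suc)
      ≈⟨ +-congˡ (dist²-δ i (y ∘ suc)) ⟩
    (0# - y zero) ^ 2 + (1# - 2# * y (suc i) + norm² (y ∘ suc))
      ≈⟨ solve 3 (λ a b n → (κ 0 :- a) :^ 2 :+ (κ 1 :- κ 2 :* b :+ n)
           := κ 1 :- κ 2 :* b :+ (a :^ 2 :+ n)) refl (y zero) (y (suc i)) _ ⟩
    1# - 2# * y (suc i) + norm² y ∎

  -- The corners (−t, …, −t), e₁, …, e_d form a regular simplex of side √2, and
  -- the points (h, 0, …, 0) with 0 < h < 1 have smaller distances to all others.
  module Simplex (d-1 s : ℕ) where

    private
      d : ℕ
      d = suc d-1

      -- The squared distance from (-t, ..., -t) to a basis vector is 1 + 2t + d t². It equals 2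
      -- when t is the positive root of d t² + 2t = 1, which is 1/(1 + √(d+1)).
      σ t : ℝ
      σ = sqrt (fromℕ (suc d))
      t = (1# + σ) ⁻¹

      σ² : σ * σ ≈ fromℕ (suc d)
      σ² = sqrt*sqrt (0≤fromℕ (suc d))

      0<1+σ : 0# < 1# + σ
      0<1+σ = +-pos-nonNeg 0<1 (0≤sqrt (0≤fromℕ (suc d)))

      0<t : 0# < t
      0<t = ⁻¹-pos 0<1+σ

      t-inv : (1# + σ) * t ≈ 1#
      t-inv = x*x⁻¹ 0<1+σ

      dt²+2t≈1 : fromℕ d * t ^ 2 + 2# * t ≈ 1#
      dt²+2t≈1 = begin-equality
        fromℕ d * t ^ 2 + 2# * t
          ≈⟨ solve 2 (λ d t → d :* t :^ 2 :+ κ 2 :* t := ((κ 1 :+ d) :- κ 1) :* t :* t :+ κ 2 :* t) refl (fromℕ d) t ⟩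
        (fromℕ (suc d) - 1#) * t * t + 2# * t
          ≈⟨ +-congʳ (*-congʳ (*-congʳ (+-congʳ (sym σ²)))) ⟩
        (σ * σ - 1#) * t * t + 2# * t
          ≈⟨ solve 2 (λ σ t → (σ :* σ :- κ 1) :* t :* t :+ κ 2 :* t
               := (σ :- κ 1) :* t :* ((κ 1 :+ σ) :* t) :+ κ 2 :* t) refl σ t ⟩
        (σ - 1#) * t * ((1# + σ) * t) + 2# * t
          ≈⟨ +-congʳ (*-congˡ t-inv) ⟩
        (σ - 1#) * t * 1# + 2# * t
          ≈⟨ solve 2 (λ σ t → (σ :- κ 1) :* t :* κ 1 :+ κ 2 :* t := (κ 1 :+ σ) :* t) refl σ t ⟩
        (1# + σ) * t
          ≈⟨ t-inv ⟩
        1# ∎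

      -- The values 1/2, 1/3, ... are distinct and lie in (0, 1); starting at 1/2 avoids e₁ = (1, 0,
      -- ..., 0).
      h : Fin s → ℝ
      h a = fromℕ (2 ℕ.+ toℕ a) ⁻¹

      0<2+a : ∀ (a : Fin s) → 0# < fromℕ (2 ℕ.+ toℕ a)
      0<2+a a = 0<fromℕ {2 ℕ.+ toℕ a} (ℕ.s≤s ℕ.z≤n)

      0<h : ∀ a → 0# < h a
      0<h a = ⁻¹-pos (0<2+a a)

      h<1 : ∀ a → h a < 1#
      h<1 a = *-cancelʳ-< (<⇒≤ (0<2+a a)) (<-resp
        (trans (+-identityʳ 1#) (sym (⁻¹-inverseˡ (pos⇒≉0 (0<2+a a))))) (sym (*-identityˡ _))
        (fromℕ-mono-< {1} {2 ℕ.+ toℕ a} (ℕ.s≤s (ℕ.s≤s ℕ.z≤n))))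

      h-injective : ∀ {a b} → h a ≈ h b → a ≡ b
      h-injective {a} {b} e = Fin.toℕ-injective (ℕ.+-cancelˡ-≡ 2 (toℕ a) (toℕ b) (ℕ.≤-antisym
        (fromℕ-cancel-≤ {2 ℕ.+ toℕ a} {2 ℕ.+ toℕ b} (≤-reflexive eq))
        (fromℕ-cancel-≤ {2 ℕ.+ toℕ b} {2 ℕ.+ toℕ a} (≤-reflexive (sym eq)))))
        where
        A B : ℝ
        A = fromℕ (2 ℕ.+ toℕ a)
        B = fromℕ (2 ℕ.+ toℕ b)
        eq : A ≈ B
        eq = begin-equality
          A               ≈⟨ *-identityʳ A ⟨
          A * 1#          ≈⟨ *-congˡ (⁻¹-inverseˡ (pos⇒≉0 (0<2+a b))) ⟨
          A * (h b * B)   ≈⟨ *-congˡ (*-congʳ e) ⟨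
          A * (h a * B)   ≈⟨ *-assoc A (h a) B ⟨
          A * h a * B     ≈⟨ *-congʳ (x*x⁻¹ (0<2+a a)) ⟩
          1# * B          ≈⟨ *-identityˡ B ⟩
          B               ∎

      apex : Point d
      apex _ = - t

      inner : Fin s → Point d
      inner a zero    = h a
      inner a (suc _) = 0#

      norm²-apex : norm² apex ≈ fromℕ d * t ^ 2
      norm²-apex = trans (sum-const d ((- t) ^ 2))
        (solve 2 (λ d t → d :* (:- t) :^ 2 := d :* t :^ 2) refl (fromℕ d) t)

      norm²-inner : ∀ a → norm² (inner a) ≈ h a ^ 2
      norm²-inner a = trans (+-congˡ (sum-0 {d-1} (λ _ → 0# ^ 2) λ _ → trans (sq 0#) (zeroˡ 0#))) (+-identityʳ _)

      h²<1 : ∀ a → h a ^ 2 < 1#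
      h²<1 a = begin-strict
        h a ^ 2     ≈⟨ sq (h a) ⟩
        h a * h a   <⟨ *-monoˡ-< (0<h a) (h<1 a) ⟩
        1# * h a    ≈⟨ *-identityˡ _ ⟩
        h a         <⟨ h<1 a ⟩
        1#          ∎

    point : Fin (suc d) ⊎ Fin s → Point d
    point (inj₁ zero)    = apex
    point (inj₁ (suc i)) = δ i
    point (inj₂ a)       = inner a

    private
      apex-δ : ∀ (i : Fin d) → dist² (δ i) apex ≈ 2#
      apex-δ i = begin-equality
        dist² (δ i) apex                 ≈⟨ dist²-δ i apex ⟩
        1# - 2# * - t + norm² apex       ≈⟨ +-congˡ norm²-apex ⟩
        1# - 2# * - t + fromℕ d * t ^ 2  ≈⟨ solve 2 (λ t n → κ 1 :- κ 2 :* (:- t) :+ n := κ 1 :+ (n :+ κ 2 :* t)) refl t _ ⟩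
        1# + (fromℕ d * t ^ 2 + 2# * t)  ≈⟨ +-congˡ dt²+2t≈1 ⟩
        1# + 1#                          ≈⟨ solve 0 (κ 1 :+ κ 1 := κ 2) refl ⟩
        2#                               ∎

      δ-δ : ∀ {i j : Fin d} → i ≢ j → dist² (δ i) (δ j) ≈ 2#
      δ-δ {i} {j} i≢j = begin-equality
        dist² (δ i) (δ j)                ≈⟨ dist²-δ i (δ j) ⟩
        1# - 2# * δ j i + norm² (δ j)    ≈⟨ +-cong (+-congˡ (-‿cong (*-congˡ (δ-≢ (i≢j ∘ ≡.sym))))) (norm²-δ j) ⟩
        1# - 2# * 0# + 1#                ≈⟨ solve 0 (κ 1 :- κ 2 :* κ 0 :+ κ 1 := κ 2) refl ⟩
        2#                               ∎

      δ-inner : ∀ i a → dist² (δ i) (inner a) < 2#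
      δ-inner i a = begin-strict
        dist² (δ i) (inner a)                ≈⟨ dist²-δ i (inner a) ⟩
        1# - 2# * inner a i + norm² (inner a) ≈⟨ +-congˡ (norm²-inner a) ⟩
        1# - 2# * inner a i + h a ^ 2        <⟨ <-by (+-pos-nonNeg (<⇒0<- (h²<1 a)) (*-nonNeg (0≤fromℕ 2) (0≤inner i)))
                                                  (solve 2 (λ x n → κ 2 :- (κ 1 :- κ 2 :* x :+ n) := (κ 1 :- n) :+ κ 2 :* x)
                                                    refl (inner a i) (h a ^ 2)) ⟩
        2#                                   ∎
        where
        0≤inner : ∀ i → 0# ≤ inner a i
        0≤inner zero    = <⇒≤ (0<h a)
        0≤inner (suc i) = ≤-refl

      apex-inner : ∀ a → dist² apex (inner a) < 2#
      apex-inner a = begin-strict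
        (- t - h a) ^ 2 + sum {d-1} (λ _ → (- t - 0#) ^ 2)
          ≈⟨ +-congˡ (sum-const d-1 ((- t - 0#) ^ 2)) ⟩
        (- t - h a) ^ 2 + fromℕ d-1 * (- t - 0#) ^ 2
          ≈⟨ solve 3 (λ t h n → (:- t :- h) :^ 2 :+ n :* (:- t :- κ 0) :^ 2
               := ((κ 1 :+ n) :* t :^ 2 :+ κ 2 :* t) :- κ 2 :* t :* (κ 1 :- h) :+ h :^ 2) refl t (h a) (fromℕ d-1) ⟩
        (fromℕ d * t ^ 2 + 2# * t) - 2# * t * (1# - h a) + h a ^ 2
          ≈⟨ +-congʳ (+-congʳ dt²+2t≈1) ⟩
        1# - 2# * t * (1# - h a) + h a ^ 2
          <⟨ <-by (+-pos-nonNeg (<⇒0<- (h²<1 a)) (*-nonNeg (*-nonNeg (0≤fromℕ 2) (<⇒≤ 0<t)) (<⇒≤ (<⇒0<- (h<1 a)))))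
               (solve 2 (λ x n → κ 2 :- (κ 1 :- x :+ n) := (κ 1 :- n) :+ x) refl (2# * t * (1# - h a)) (h a ^ 2)) ⟩
        2# ∎

      inner-inner : ∀ a b → dist² (inner a) (inner b) < 2#
      inner-inner a b = begin-strict
        (h a - h b) ^ 2 + sum {d-1} (λ _ → (0# - 0#) ^ 2)
          ≈⟨ +-congˡ (sum-const d-1 ((0# - 0#) ^ 2)) ⟩
        (h a - h b) ^ 2 + fromℕ d-1 * (0# - 0#) ^ 2
          <⟨ <-by (+-pos-nonNeg (+-pos-nonNeg (<⇒0<- (h²<1 a)) (<⇒≤ (<⇒0<- (h²<1 b))))
                 (*-nonNeg (*-nonNeg (0≤fromℕ 2) (<⇒≤ (0<h a))) (<⇒≤ (0<h b))))
               (solve 3 (λ a b n → κ 2 :- ((a :- b) :^ 2 :+ n :* (κ 0 :- κ 0) :^ 2)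
                 := (κ 1 :- a :^ 2) :+ (κ 1 :- b :^ 2) :+ κ 2 :* a :* b) refl (h a) (h b) (fromℕ d-1)) ⟩
        2# ∎

    corner-corner : ∀ {a b} → a ≢ b → dist² (point (inj₁ a)) (point (inj₁ b)) ≈ 2#
    corner-corner {zero}  {zero}  a≢b = ⊥-elim (a≢b ≡.refl)
    corner-corner {zero}  {suc b} a≢b = trans (dist²-sym apex (δ b)) (apex-δ b)
    corner-corner {suc a} {zero}  a≢b = apex-δ a
    corner-corner {suc a} {suc b} a≢b = δ-δ {a} {b} (a≢b ∘ ≡.cong suc)

    to-inner : ∀ z b → dist² (point z) (point (inj₂ b)) < 2#
    to-inner (inj₁ zero)    b = apex-inner b
    to-inner (inj₁ (suc i)) b = δ-inner i b
    to-inner (inj₂ a)       b = inner-inner a b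

    dist²≤2 : ∀ y z → dist² (point y) (point z) ≤ 2#
    dist²≤2 y        (inj₂ b) = <⇒≤ (to-inner y b)
    dist²≤2 (inj₂ a) (inj₁ b) =
      ≤-trans (≤-reflexive (dist²-sym (inner a) (point (inj₁ b)))) (<⇒≤ (to-inner (inj₁ b) a))
    dist²≤2 (inj₁ a) (inj₁ b) with a Fin.≟ b
    ... | yes ≡.refl = ≤-trans (≤-reflexive (dist²-≋ (point (inj₁ a)) (point (inj₁ a)) λ _ → refl)) (0≤fromℕ 2)
    ... | no  a≢b    = ≤-reflexive (corner-corner a≢b)

    dist²≈2⇒corners : ∀ y z → dist² (point y) (point z) ≈ 2# → IsCorner y × IsCorner z
    dist²≈2⇒corners y        (inj₂ b) e = ⊥-elim (proj₂ (to-inner y b) e)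
    dist²≈2⇒corners (inj₂ a) (inj₁ b) e =
      ⊥-elim (proj₂ (to-inner (inj₁ b) a) (trans (dist²-sym (point (inj₁ b)) (inner a)) e))
    dist²≈2⇒corners (inj₁ a) (inj₁ b) e = (a , ≡.refl) , (b , ≡.refl)

    private
      -- The first coordinate decides: it is -t, 1 or 0 at a corner, and strictly between 0 and 1 at
      -- an inner point.
      corner≉inner : ∀ a b → ¬ point (inj₁ a) ≋ inner b
      corner≉inner zero          b e = <⇒≱ (0<h b) (≤-trans (≤-reflexive (sym (e zero)))
        (≤-by (<⇒≤ 0<t) (solve 1 (λ t → κ 0 :- (:- t) := t) refl t)))
      corner≉inner (suc zero)    b e = proj₂ (h<1 b) (sym (e zero))
      corner≉inner (suc (suc i)) b e = proj₂ (0<h b) (e zero)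

    point-injective : ∀ y z → point y ≋ point z → y ≡ z
    point-injective (inj₁ a) (inj₁ b) e with a Fin.≟ b
    ... | yes a≡b = ≡.cong inj₁ a≡b
    ... | no  a≢b = ⊥-elim (pos⇒≉0 0<2
            (trans (sym (corner-corner a≢b)) (dist²-≋ (point (inj₁ a)) (point (inj₁ b)) e)))
    point-injective (inj₁ a) (inj₂ b) e = ⊥-elim (corner≉inner a b e)
    point-injective (inj₂ a) (inj₁ b) e = ⊥-elim (corner≉inner b a (sym ∘ e))
    point-injective (inj₂ a) (inj₂ b) e = ≡.cong inj₂ (h-injective (e zero))

    module _ {V : Set} (G : Graph V) (f : V ↔ Fin (suc d ℕ.+ s)) where

      open Inverse f using (to; from; strictlyInverseˡ)

      private
        kind : V → Fin (suc d) ⊎ Fin s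
        kind v = splitAt (suc d) (to v)

        place : Fin (suc d ℕ.+ s) → Point d
        place i = point (splitAt (suc d) i)

        splitAt-injective : ∀ {i j} → splitAt (suc d) {s} i ≡ splitAt (suc d) j → i ≡ j
        splitAt-injective {i} {j} e = ≡.trans (≡.sym (Fin.join-splitAt (suc d) s i))
          (≡.trans (≡.cong (Fin.join (suc d) s) e) (Fin.join-splitAt (suc d) s j))

        -- The labels 0 and 1 are both corners because the dimension is at least 1, so the upper
        -- bound 2 is attained.
        place-dist² : dist² (place zero) (place (suc zero)) ≈ 2#
        place-dist² = corner-corner {zero} {suc zero} λ ()

      module _ (adj : ∀ u v → Adj G u v ⇔ (to u ≢ to v × IsCorner (kind u) × IsCorner (kind v))) where

        private
          corners⇒dist²≈2 : ∀ {i j} → i ≢ j → IsCorner {suc d} {s} (splitAt (suc d) i) →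
            IsCorner {suc d} {s} (splitAt (suc d) j) → dist² (place i) (place j) ≈ 2#
          corners⇒dist²≈2 {i} {j} i≢j (a , ea) (b , eb) = ≡.subst₂ (λ y z → dist² (point y) (point z) ≈ 2#)
            (≡.sym ea) (≡.sym eb)
            (corner-corner λ a≡b → i≢j (splitAt-injective (≡.trans ea (≡.trans (≡.cong inj₁ a≡b) (≡.sym eb)))))

          extremal : ∀ i j → dist (place i) (place j) ≈ diam place ⇔ dist² (place i) (place j) ≈ 2#
          extremal = dist≈diam⇔ place (0≤fromℕ 2)
            (λ i j → dist²≤2 (splitAt (suc d) i) (splitAt (suc d) j)) {zero} {suc zero} place-dist²

        -- The pairs at the maximal squared distance 2 are exactly the pairs of distinct corners,
        -- and by `adj` so are the edges of `G`.
        isDiameterGraph : IsDiameterGraph d G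
        isDiameterGraph = suc d ℕ.+ s , place ,
          (λ {i} {j} e → splitAt-injective (point-injective (splitAt (suc d) i) (splitAt (suc d) j) e)) ,
          f , λ u v → mk⇔
            (λ uv → let u≢v , cu , cv = Equivalence.to (adj u v) uv in
              u≢v , inj₁ (Equivalence.from (extremal (to u) (to v)) (corners⇒dist²≈2 u≢v cu cv)))
            (λ { (u≢v , inj₁ e) → Equivalence.from (adj u v) (u≢v ,
                   dist²≈2⇒corners (kind u) (kind v) (Equivalence.to (extremal (to u) (to v)) e))
               ; (u≢v , inj₂ e) → Equivalence.from (adj u v) (u≢v ,
                   (let cv , cu = dist²≈2⇒corners (kind v) (kind u) (Equivalence.to (extremal (to v) (to u)) e)
                    in cu , cv)) })

        -- Corners receive their own index as colour; the other vertices are isolated and may share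
        -- colour 0. Conversely the corners form a clique, so a proper colouring is injective on
        -- these d + 1 vertices.
        hasChromaticNumber : HasChromaticNumber G (suc d)
        hasChromaticNumber =
          ((λ v → [ id , (λ _ → zero) ]′ (kind v)) , λ u v uv same →
            let u≢v , (a , ea) , (b , eb) = Equivalence.to (adj u v) uv in
            u≢v (splitAt-injective (≡.trans ea (≡.trans (≡.cong inj₁
              (≡.subst₂ (λ y z → [ id , (λ _ → zero) ]′ y ≡ [ id , (λ _ → zero) ]′ z) ea eb same)) (≡.sym eb)))))
          , λ j (colour , proper) → Fin.injective⇒≤ {f = colour ∘ corner} λ {a} {b} same →
              case (a Fin.≟ b) same proper
          where
          corner : Fin (suc d) → V
          corner a = from (a ↑ˡ s)

          kind-corner : ∀ a → kind (corner a) ≡ inj₁ a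
          kind-corner a = ≡.trans (≡.cong (splitAt (suc d)) (strictlyInverseˡ (a ↑ˡ s))) (Fin.splitAt-↑ˡ (suc d) a s)

          case : ∀ {a b j} {colour : V → Fin j} → Dec (a ≡ b) → colour (corner a) ≡ colour (corner b) →
                 (∀ u v → Adj G u v → colour u ≢ colour v) → a ≡ b
          case         (yes a≡b) same proper = a≡b
          case {a} {b} (no  a≢b) same proper = ⊥-elim (proper (corner a) (corner b)
            (Equivalence.from (adj (corner a) (corner b))
              ((λ e → a≢b (inj₁-injective (≡.trans (≡.sym (kind-corner a))
                 (≡.trans (≡.cong (splitAt (suc d)) e) (kind-corner b))))) ,
               (a , kind-corner a) , (b , kind-corner b)))
            same)

-- Labelling the chosen vertices by their blocks.

-- A vertex of `G [ W ]` carries a proof of membership. Its uniqueness is what makes `select↔Fin` a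
-- bijection.
∈-irrelevant : ∀ {n} {v : Fin n} {S : Subset n} (a b : v ∈ S) → a ≡ b
∈-irrelevant Vec.here      Vec.here      = ≡.refl
∈-irrelevant (Vec.there a) (Vec.there b) = ≡.cong Vec.there (∈-irrelevant a b)

module SelectedVertices (m rest : ℕ) where

  open Blocks m rest

  vertex : ∀ {k} → Vec (Fin m) k → Fin k → Fin (size k)
  vertex {suc k} (a ∷ φ) zero    = a ↑ˡ size k
  vertex         (a ∷ φ) (suc i) = m ↑ʳ vertex φ i

  vertex-injective : ∀ {k} (φ : Vec (Fin m) k) {i j} → vertex φ i ≡ vertex φ j → i ≡ j
  vertex-injective         (a ∷ φ) {zero}  {zero}  e = ≡.refl
  vertex-injective {suc k} (a ∷ φ) {zero}  {suc j} e
    with () ← ≡.trans (≡.sym (Fin.splitAt-↑ˡ m a (size k)))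
                (≡.trans (≡.cong (splitAt m) e) (Fin.splitAt-↑ʳ m (size k) (vertex φ j)))
  vertex-injective {suc k} (a ∷ φ) {suc i} {zero}  e
    with () ← ≡.trans (≡.sym (Fin.splitAt-↑ˡ m a (size k)))
                (≡.trans (≡.cong (splitAt m) (≡.sym e)) (Fin.splitAt-↑ʳ m (size k) (vertex φ i)))
  vertex-injective (a ∷ φ) {suc i} {suc j} e =
    ≡.cong suc (vertex-injective φ (Fin.↑ʳ-injective m _ _ e))

  vertex∈select : ∀ {k} (φ : Vec (Fin m) k) i → vertex φ i ∈ select φ
  vertex∈select (a ∷ φ) zero    = Vec.lookup⇒[]= _ _
    (≡.trans (Vec.lookup-++ˡ ⁅ a ⁆ (select φ) a) (Vec.[]=⇒lookup (Subset.x∈⁅x⁆ a)))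
  vertex∈select (a ∷ φ) (suc i) = Vec.lookup⇒[]= _ _
    (≡.trans (Vec.lookup-++ʳ ⁅ a ⁆ (select φ) (vertex φ i)) (Vec.[]=⇒lookup (vertex∈select φ i)))

  vertex-surjective : ∀ {k} (φ : Vec (Fin m) k) {v} → v ∈ select φ → ∃[ i ] vertex φ i ≡ v
  vertex-surjective         []      v∈ = ⊥-elim (Subset.∉⊥ v∈)
  vertex-surjective {suc k} (a ∷ φ) {v} v∈ = split (splitAt m v) (Fin.join-splitAt m (size k) v)
    where
    split : ∀ z → Fin.join m (size k) z ≡ v → ∃[ i ] vertex (a ∷ φ) i ≡ v
    split (inj₁ b) ≡.refl = zero , ≡.cong (_↑ˡ size k) (≡.sym (Subset.x∈⁅y⁆⇒x≡y a
      (Vec.lookup⇒[]= b ⁅ a ⁆ (≡.trans (≡.sym (Vec.lookup-++ˡ ⁅ a ⁆ (select φ) b)) (Vec.[]=⇒lookup v∈)))))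
    split (inj₂ w) ≡.refl =
      let i , e = vertex-surjective φ (Vec.lookup⇒[]= w (select φ)
                    (≡.trans (≡.sym (Vec.lookup-++ʳ ⁅ a ⁆ (select φ) w)) (Vec.[]=⇒lookup v∈)))
      in suc i , ≡.cong (m ↑ʳ_) e

  select↔Fin : ∀ {k} (φ : Vec (Fin m) k) → (∃[ v ] v ∈ select φ) ↔ Fin k
  select↔Fin φ = mk↔ₛ′ (λ (v , v∈) → proj₁ (vertex-surjective φ v∈)) (λ i → vertex φ i , vertex∈select φ i)
    (λ i → vertex-injective φ (proj₂ (vertex-surjective φ (vertex∈select φ i))))
    (λ (v , v∈) → pair≡ (proj₂ (vertex-surjective φ v∈)))
    where
    pair≡ : ∀ {v w} {v∈ : v ∈ select φ} {w∈ : w ∈ select φ} → v ≡ w → (v , v∈) ≡ (w , w∈)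
    pair≡ ≡.refl = ≡.cong (_ ,_) (∈-irrelevant _ _)

  prefix-vertex : ∀ c {s} (φ : Vec (Fin m) (c ℕ.+ s)) i →
    Vec.lookup (prefix c s) (vertex φ i) ≡ inside ⇔ IsCorner {c} {s} (splitAt c i)
  prefix-vertex zero    φ       i       = mk⇔
    (λ e → ⊥-elim (Subset.∉⊥ (Vec.lookup⇒[]= (vertex φ i) ⊥ e))) λ ()
  prefix-vertex (suc c) {s} (a ∷ φ) zero    = mk⇔ (λ _ → zero , ≡.refl)
    (λ _ → ≡.trans (Vec.lookup-++ˡ (⊤ {m}) (prefix c s) a) (Vec.lookup-replicate a inside))
  prefix-vertex (suc c) {s} (a ∷ φ) (suc i) = mk⇔
    (λ e → let b , eq = Equivalence.to (prefix-vertex c φ i)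
                          (≡.trans (≡.sym (Vec.lookup-++ʳ (⊤ {m}) (prefix c s) (vertex φ i))) e)
           in suc b , ≡.cong (Sum.map₁ suc) eq)
    (λ (b , eq) → ≡.trans (Vec.lookup-++ʳ (⊤ {m}) (prefix c s) (vertex φ i))
       (Equivalence.from (prefix-vertex c φ i) (unsuc (splitAt c i) eq)))
    where
    unsuc : ∀ (z : Fin c ⊎ Fin s) {b} → Sum.map₁ suc z ≡ inj₁ b → IsCorner {c} {s} z
    unsuc (inj₁ a) _ = a , ≡.refl

-- A good choice induces a diameter graph.

module Copies (em : ExcludedMiddle 0ℓ) (ℛ : CompleteOrderedField)
  {p : CompleteOrderedField.Carrier ℛ}
  (0<p : Real._<_ em ℛ (CompleteOrderedField.0# ℛ) p)
  (p<1 : Real._<_ em ℛ p (CompleteOrderedField.1# ℛ)) where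

  open Real em ℛ hiding (zero)
  open OrderedField em ℛ
  open Expectation em ℛ
  open SecondMoment em ℛ 0<p p<1

  private
    constraint≉0 : ∀ {c w s} → ¬ constraint c w s ≈ 0# → c ≡ true → s ≡ w
    constraint≉0 {true} {true}  {true}  _ _ = ≡.refl
    constraint≉0 {true} {false} {false} _ _ = ≡.refl
    constraint≉0 {true} {true}  {false} h _ = ⊥-elim (h refl)
    constraint≉0 {true} {false} {true}  h _ = ⊥-elim (h refl)

    ∧-true : ∀ {a b} → a ≡ true → b ≡ true → a ∧ b ≡ true
    ∧-true ≡.refl ≡.refl = ≡.refl

    ∧-true⁻ : ∀ a {b} → a ∧ b ≡ true → a ≡ true × b ≡ true
    ∧-true⁻ true e = ≡.refl , e

  pair-index : ∀ {n} {u v : Fin n} → u Fin.< v → ∃[ e ] List.lookup (pairs n) e ≡ (u , v)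
  pair-index {n} {u} {v} u<v = Any.index uv∈ , ≡.sym (Any.lookup-index uv∈)
    where
    uv∈ = List.∈-filter⁺ (λ (u , v) → u Fin.<? v) (List.∈-cartesianProduct⁺ (List.∈-allFin u) (List.∈-allFin v)) u<v

  module _ {n} (L W : Subset n) (E : EdgeSet n) (weight≉0 : ¬ weight L W E ≈ 0#) where

    private
      pair : Fin (length (pairs n)) → Fin n × Fin n
      pair = List.lookup (pairs n)

      edge : ∀ {u v} → u ∈ W → v ∈ W → ∀ e → pair e ≡ (u , v) → Vec.lookup E e ≡ wanted L (u , v)
      edge {u} {v} u∈ v∈ e e≡ = ≡.trans
        (constraint≉0 {inside? L W (pair e)} (λ z → weight≉0 (product-0 {length (pairs n)} e z))
          (≡.trans (≡.cong (inside? L W) e≡) (∧-true (Vec.[]=⇒lookup u∈) (Vec.[]=⇒lookup v∈))))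
        (≡.cong (wanted L) e≡)

      swapped : ∀ {u v} → wanted L (u , v) ≡ true → wanted L (v , u) ≡ true
      swapped {u} {v} e = let a , b = ∧-true⁻ (Vec.lookup L u) e in ∧-true b a

      joined⇒wanted : ∀ {u v} → u ∈ W → v ∈ W → ∃[ e ] (e ∈ E × pair e ≡ (u , v)) → wanted L (u , v) ≡ true
      joined⇒wanted u∈ v∈ (e , e∈ , e≡) = ≡.trans (≡.sym (edge u∈ v∈ e e≡)) (Vec.[]=⇒lookup e∈)

      wanted⇒joined : ∀ {u v} → u ∈ W → v ∈ W → u Fin.< v → wanted L (u , v) ≡ true →
                      ∃[ e ] (e ∈ E × pair e ≡ (u , v))
      wanted⇒joined u∈ v∈ u<v w = let e , e≡ = pair-index u<v in
        e , Vec.lookup⇒[]= e E (≡.trans (edge u∈ v∈ e e≡) w) , e≡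

    -- A product with a zero factor vanishes, so a nonzero weight forces every pair inside `W` into
    -- its wanted state: an edge exactly if both ends lie in `L`.
    induced-adj : ∀ (u v : ∃[ v ] v ∈ W) → Adj (graph E [ W ]) u v ⇔
      (proj₁ u ≢ proj₁ v × Vec.lookup L (proj₁ u) ≡ true × Vec.lookup L (proj₁ v) ≡ true)
    induced-adj (u , u∈) (v , v∈) = mk⇔
      (λ uv → (λ { ≡.refl → Graph.irrefl (graph E) uv }) , ∧-true⁻ (Vec.lookup L u) (to uv))
      from
      where
      to : Adj (graph E) u v → wanted L (u , v) ≡ true
      to (inj₁ j) = joined⇒wanted u∈ v∈ j
      to (inj₂ j) = swapped (joined⇒wanted v∈ u∈ j)

      from : u ≢ v × Vec.lookup L u ≡ true × Vec.lookup L v ≡ true → Adj (graph E) u v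
      from (u≢v , lu , lv) with Fin.<-cmp u v
      ... | tri< u<v _ _ = inj₁ (wanted⇒joined u∈ v∈ u<v (∧-true lu lv))
      ... | tri≈ _ u≡v _ = ⊥-elim (u≢v u≡v)
      ... | tri> _ _ v<u = inj₂ (wanted⇒joined v∈ u∈ v<u (∧-true lv lu))

  module _ (d-1 s m rest : ℕ) where

    open Blocks m rest
    open SelectedVertices m rest
    open Geometry.Simplex em ℛ d-1 s

    weight≉0⇒hasDiameterSubgraph : ∀ φ E → ¬ weight (prefix (2 ℕ.+ d-1) s) (select φ) E ≈ 0# →
      HasDiameterSubgraph (suc d-1) (2 ℕ.+ d-1 ℕ.+ s) (graph E)
    weight≉0⇒hasDiameterSubgraph φ E h =
      select φ , ∣select∣ φ ,
      isDiameterGraph (graph E [ select φ ]) (select↔Fin φ) adj ,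
      hasChromaticNumber (graph E [ select φ ]) (select↔Fin φ) adj
      where
      open Inverse (select↔Fin φ) using (to)

      vertex-to : ∀ v → vertex φ (to v) ≡ proj₁ v
      vertex-to (v , v∈) = proj₂ (vertex-surjective φ v∈)

      Corner : Fin (2 ℕ.+ d-1 ℕ.+ s) → Set
      Corner i = IsCorner {2 ℕ.+ d-1} {s} (splitAt (2 ℕ.+ d-1) i)

      corner⇔ : ∀ v → Vec.lookup (prefix (2 ℕ.+ d-1) s) (proj₁ v) ≡ true ⇔ Corner (to v)
      corner⇔ v = ≡.subst (λ w → Vec.lookup (prefix (2 ℕ.+ d-1) s) w ≡ true ⇔ Corner (to v)) (vertex-to v)
        (prefix-vertex (2 ℕ.+ d-1) φ (to v))

      adj : ∀ u v → Adj (graph E [ select φ ]) u v ⇔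
        (to u ≢ to v × Corner (to u) × Corner (to v))
      adj u v = mk⇔
        (λ uv → let u≢v , lu , lv = Equivalence.to (induced-adj L W E h u v) uv in
          (λ e → u≢v (≡.trans (≡.sym (vertex-to u)) (≡.trans (≡.cong (vertex φ) e) (vertex-to v)))) ,
          Equivalence.to (corner⇔ u) lu , Equivalence.to (corner⇔ v) lv)
        (λ (i≢j , cu , cv) → Equivalence.from (induced-adj L W E h u v)
          ((λ e → i≢j (vertex-injective φ (≡.trans (vertex-to u) (≡.trans e (≡.sym (vertex-to v)))))) ,
           Equivalence.from (corner⇔ u) cu , Equivalence.from (corner⇔ v) cv))
        where
        L = prefix (2 ℕ.+ d-1) s
        W = select φ

-- Lower bounds for `u`.

module LowerBound (em : ExcludedMiddle 0ℓ) (ℛ : CompleteOrderedField) where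

  open Real em ℛ hiding (zero)
  open OrderedField em ℛ
  open Expectation em ℛ

  bounded⇒largest : ∀ (P : ℕ → Set) b → (∀ j → P j → j ℕ.≤ b) → ∃ P → ∃ (IsLargest P)
  bounded⇒largest P zero    ≤b (j , Pj) = j , Pj , λ i Pi → ℕ.≤-trans (≤b i Pi) ℕ.z≤n
  bounded⇒largest P (suc b) ≤b ∃P with em {P (suc b)}
  ... | yes Psb = suc b , Psb , ≤b
  ... | no ¬Psb = bounded⇒largest P b
    (λ j Pj → ℕ.≤-pred (ℕ.≤∧≢⇒< (≤b j Pj) λ { ≡.refl → ¬Psb Pj })) ∃P

  -- Subgraphs with more than n vertices have probability 0, so the admissible sizes are bounded and
  -- have a largest element. Hence `u` does not fall back on its default 0.
  ≤u : ∀ {d n p k} → 0# ≤ p → p ≤ 1# → 1 ℕ.≤ k → 2# ⁻¹ < ℙ n p (HasDiameterSubgraph d k) → k ℕ.≤ u d n p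
  ≤u {d} {n} {p} {k} 0≤p p≤1 1≤k half<ℙ
    with em {∃ (IsLargest λ k → 1 ℕ.≤ k × 2# ⁻¹ < ℙ n p (HasDiameterSubgraph d k))}
  ... | yes (l , _ , l-largest) = l-largest k (1≤k , half<ℙ)
  ... | no ¬largest = ⊥-elim (¬largest (bounded⇒largest _ n bounded (k , 1≤k , half<ℙ)))
    where
    bounded : ∀ j → 1 ℕ.≤ j × 2# ⁻¹ < ℙ n p (HasDiameterSubgraph d j) → j ℕ.≤ n
    bounded j (_ , half<) with j ℕ.≤? n
    ... | yes j≤n = j≤n
    ... | no  j≰n = ⊥-elim (<⇒≱ half< (≤-trans
      (≤-reflexive (ℙ-impossible 0≤p p≤1 (HasDiameterSubgraph d j)
        λ G (W , ∣W∣≡j , _) → j≰n (≡.subst (ℕ._≤ n) ∣W∣≡j (Subset.∣p∣≤n W))))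
      (<⇒≤ (⁻¹-pos 0<2))))

-- Logarithmic estimates and the choice of k.

module Asymptotics (em : ExcludedMiddle 0ℓ) (ℛ : CompleteOrderedField)
  (exp ln : CompleteOrderedField.Carrier ℛ → CompleteOrderedField.Carrier ℛ)
  (isLogarithm : Laws.IsLogarithm em ℛ exp ln) where

  open RingSolver em ℛ
  open Real em ℛ hiding (zero; exp; ln)
  open Laws em ℛ
  open OrderedField em ℛ
  open Eventual em ℛ
  open IsLogarithm isLogarithm

  ln-cong : ∀ {x y} → 0# < x → x ≈ y → ln x ≈ ln y
  ln-cong 0<x x≈y = antisym (ln-mono-≤ 0<x (≤-reflexive x≈y))
    (ln-mono-≤ (<-resp refl x≈y 0<x) (≤-reflexive (sym x≈y)))

  ln-cancel-< : ∀ {x y} → 0# < y → ln x < ln y → x < y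
  ln-cancel-< 0<y lnx<lny = ≰⇒> λ y≤x → <⇒≱ lnx<lny (ln-mono-≤ 0<y y≤x)

  ln-1 : ln 1# ≈ 0#
  ln-1 = begin-equality
    ln 1#                    ≈⟨ solve 1 (λ a → a := a :+ a :- a) refl (ln 1#) ⟩
    ln 1# + ln 1# - ln 1#    ≈⟨ +-congʳ (ln-* 0<1 0<1) ⟨
    ln (1# * 1#) - ln 1#     ≈⟨ +-congʳ (ln-cong (*-pos 0<1 0<1) (*-identityˡ 1#)) ⟩
    ln 1# - ln 1#            ≈⟨ -‿inverseʳ _ ⟩
    0#                       ∎

  ln-^ : ∀ {x} n → 0# < x → ln (x ^ n) ≈ fromℕ n * ln x
  ln-^ {x} zero    0<x = trans ln-1 (sym (zeroˡ (ln x)))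
  ln-^ {x} (suc n) 0<x = begin-equality
    ln (x * x ^ n)            ≈⟨ ln-* 0<x (^-pos n 0<x) ⟩
    ln x + ln (x ^ n)         ≈⟨ +-congˡ (ln-^ n 0<x) ⟩
    ln x + fromℕ n * ln x     ≈⟨ solve 2 (λ n a → a :+ n :* a := (κ 1 :+ n) :* a) refl (fromℕ n) (ln x) ⟩
    fromℕ (suc n) * ln x      ∎

  ln-⁻¹ : ∀ {x} → 0# < x → ln (x ⁻¹) ≈ - ln x
  ln-⁻¹ {x} 0<x = begin-equality
    ln (x ⁻¹)                    ≈⟨ solve 2 (λ a b → b := (a :+ b) :- a) refl (ln x) (ln (x ⁻¹)) ⟩
    ln x + ln (x ⁻¹) - ln x      ≈⟨ +-congʳ (ln-* 0<x (⁻¹-pos 0<x)) ⟨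
    ln (x * x ⁻¹) - ln x         ≈⟨ +-congʳ (trans (ln-cong (*-pos 0<x (⁻¹-pos 0<x)) (x*x⁻¹ 0<x)) ln-1) ⟩
    0# - ln x                    ≈⟨ +-identityˡ _ ⟩
    - ln x                       ∎

  1-x≤ln[x⁻¹] : ∀ {x} → 0# < x → 1# - x ≤ ln (x ⁻¹)
  1-x≤ln[x⁻¹] {x} 0<x = ≤-resp (solve 1 (λ x → :- (x :- κ 1) := κ 1 :- x) refl x) (sym (ln-⁻¹ 0<x))
    (-‿anti-≤ (ln≤x-1 0<x))

  half≤ln2 : 2# ⁻¹ ≤ ln 2#
  half≤ln2 = begin
    2# ⁻¹             ≈⟨ solve 1 (λ h → h := h :+ h :- h) refl (2# ⁻¹) ⟩
    2# ⁻¹ + 2# ⁻¹ - 2# ⁻¹ ≈⟨ +-congʳ (trans (solve 1 (λ h → h :+ h := κ 2 :* h) refl (2# ⁻¹)) (x*x⁻¹ 0<2)) ⟩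
    1# - 2# ⁻¹        ≤⟨ 1-x≤ln[x⁻¹] (⁻¹-pos 0<2) ⟩
    ln (2# ⁻¹ ⁻¹)     ≈⟨ ln-⁻¹ (⁻¹-pos 0<2) ⟩
    - ln (2# ⁻¹)      ≈⟨ -‿cong (ln-⁻¹ 0<2) ⟩
    - - ln 2#         ≈⟨ solve 1 (λ a → :- (:- a) := a) refl (ln 2#) ⟩
    ln 2#             ∎

  -- Once n exceeds 2^j, ln n is at least j ln 2 ≥ j/2, and `j` is taken above 2M.
  ln→∞ : ∀ M → Eventually (λ n → M < ln (fromℕ n))
  ln→∞ M = eventually-map bound (eventually-> (2# ^ j))
    where
    j : ℕ
    j = proj₁ (archimedean (M * 2#))

    bound : ∀ n → 2# ^ j < fromℕ n → M < ln (fromℕ n)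
    bound n 2ʲ<n = begin-strict
      M                   ≈⟨ trans (*-congˡ (x*x⁻¹ 0<2)) (*-identityʳ M) ⟨
      M * (2# * 2# ⁻¹)    ≈⟨ *-assoc _ _ _ ⟨
      M * 2# * 2# ⁻¹      <⟨ *-monoˡ-< (⁻¹-pos 0<2) (proj₂ (archimedean (M * 2#))) ⟩
      fromℕ j * 2# ⁻¹     ≤⟨ *-monoʳ-≤ (0≤fromℕ j) half≤ln2 ⟩
      fromℕ j * ln 2#     ≈⟨ ln-^ j 0<2 ⟨
      ln (2# ^ j)         ≤⟨ ln-mono-≤ (^-pos j 0<2) (<⇒≤ 2ʲ<n) ⟩
      ln (fromℕ n)        ∎

  -- With b = a/2, ln y = ln (b y) - ln b ≤ b y - 1 - ln b, and for y beyond -ln b / b the constant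
  -- -ln b is absorbed by a second b y.
  ln-sublinear : ∀ {a} → 0# < a → ∃[ Y ] ∀ y → 0# < y → Y < y → ln y ≤ a * y
  ln-sublinear {a} 0<a = - ln b * b ⁻¹ , λ y 0<y Y<y → begin
    ln y                      ≈⟨ solve 2 (λ b y → y := (b :+ y) :- b) refl (ln b) (ln y) ⟩
    ln b + ln y - ln b        ≈⟨ +-congʳ (ln-* 0<b 0<y) ⟨
    ln (b * y) - ln b         ≤⟨ +-mono-≤ (ln≤x-1 (*-pos 0<b 0<y)) (≤-refl { - ln b}) ⟩
    b * y - 1# - ln b         ≈⟨ +-congˡ (*⁻¹-cancel (- ln b) 0<b) ⟨
    b * y - 1# + - ln b * b ⁻¹ * b  ≤⟨ +-monoʳ-≤ _ (*-monoˡ-≤ (<⇒≤ 0<b) (<⇒≤ Y<y)) ⟩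
    b * y - 1# + y * b        ≤⟨ ≤-by (<⇒≤ 0<1) (solve 2 (λ b y →
                                   κ 2 :* b :* y :- (b :* y :- κ 1 :+ y :* b) := κ 1) refl b y) ⟩
    2# * b * y                ≈⟨ *-congʳ (trans (solve 2 (λ a h → κ 2 :* (a :* h) := a :* (κ 2 :* h)) refl a (2# ⁻¹))
                                   (trans (*-congˡ (x*x⁻¹ 0<2)) (*-identityʳ a))) ⟩
    a * y                     ∎
    where
    b : ℝ
    b = a * 2# ⁻¹
    0<b : 0# < b
    0<b = *-pos 0<a (⁻¹-pos 0<2)

  -- What the growth conditions yield at a single large n: each of ln (1/p), ln (1/q), ln ln n and
  -- ln 64 is at most δ ln n. The remaining estimates are then made for fixed n.
  record Sparse (δ : ℝ) (n : ℕ) (p : ℝ) : Set where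
    L : ℝ
    L = ln (fromℕ n)
    field
      0<p    : 0# < p
      p<1    : p < 1#
      0<n    : 0# < fromℕ n
      0<L    : 0# < L
      -lnp≤  : - ln p ≤ δ * L
      lnb≤   : ln ((1# - p) ⁻¹) ≤ δ * L
      lnL≤   : ln L ≤ δ * L
      ln64≤  : ln (fromℕ 64) ≤ δ * L

    p≤lnb : p ≤ ln ((1# - p) ⁻¹)
    p≤lnb = ≤-resp (solve 1 (λ p → κ 1 :- (κ 1 :- p) := p) refl p) refl (1-x≤ln[x⁻¹] (<⇒0<- p<1))

    0<lnb : 0# < ln ((1# - p) ⁻¹)
    0<lnb = <-≤-trans 0<p p≤lnb

  eventually-sparse : (p : ℕ → ℝ) → (∀ n → 0# ≤ p n × p n ≤ 1#) →
    (∀ α → 0# < α → TendsTo+∞ (λ n → p n * exp (α * ln (fromℕ n)))) →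
    TendsTo+∞ (λ n → (1# - p n) * ln (fromℕ n)) →
    ∀ {δ} → 0# < δ → Eventually (λ n → Sparse δ n (p n))
  eventually-sparse p 0≤p≤1 p-large q-large {δ} 0<δ =
    eventually-map sparse (p-large δ 0<δ 1# ⋏ q-large 1# ⋏ eventually-> 0# ⋏ ln→∞ 0#
      ⋏ ln→∞ (proj₁ (ln-sublinear 0<δ)) ⋏ ln→∞ (ln (fromℕ 64) * δ ⁻¹))
    where
    sparse : ∀ n → _ → Sparse δ n (p n)
    sparse n (1<pnᵅ , 1<qL , 0<n , 0<L , Y<L , C<L) = record
      { 0<p = 0<p ; p<1 = p<1 ; 0<n = 0<n ; 0<L = 0<L
      -- This is p n^δ > 1, the growth condition on p with exponent δ, after taking logarithms.
      ; -lnp≤ = begin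
          - ln (p n)                               ≈⟨ solve 2 (λ a b → :- a := b :- (a :+ b)) refl (ln (p n)) (ln e) ⟩
          ln e - (ln (p n) + ln e)                 ≈⟨ +-congˡ (-‿cong (ln-* 0<p (0<exp _))) ⟨
          ln e - ln (p n * e)                      ≤⟨ +-mono-≤ (ln-exp≤ _) (-‿anti-≤ (ln-mono-≤ 0<1 (<⇒≤ 1<pnᵅ))) ⟩
          δ * L - ln 1#                            ≈⟨ +-congˡ (-‿cong ln-1) ⟩
          δ * L - 0#                               ≈⟨ solve 1 (λ a → a :- κ 0 := a) refl (δ * L) ⟩
          δ * L                                    ∎
      -- From q ln n > 1 follows 1/q ≤ ln n, so ln (1/q) is at most ln ln n.
      ; lnb≤ = ≤-trans (ln-mono-≤ (⁻¹-pos 0<q) b≤L) lnL≤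
      ; lnL≤ = lnL≤
      ; ln64≤ = begin
          ln (fromℕ 64)            ≈⟨ *⁻¹-cancel (ln (fromℕ 64)) 0<δ ⟨
          ln (fromℕ 64) * δ ⁻¹ * δ ≤⟨ *-monoˡ-≤ (<⇒≤ 0<δ) (<⇒≤ C<L) ⟩
          L * δ                    ≈⟨ *-comm L δ ⟩
          δ * L                    ∎
      }
      where
      L e : ℝ
      L = ln (fromℕ n)
      e = exp (δ * L)

      0<p : 0# < p n
      0<p = *-cancelʳ-< (<⇒≤ (0<exp (δ * L))) (<-resp (sym (zeroˡ e)) refl (<-trans 0<1 1<pnᵅ))

      0<q : 0# < 1# - p n
      0<q = *-cancelʳ-< (<⇒≤ 0<L) (<-resp (sym (zeroˡ L)) refl (<-trans 0<1 1<qL))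

      p<1 : p n < 1#
      p<1 = <-by 0<q refl

      lnL≤ : ln L ≤ δ * L
      lnL≤ = proj₂ (ln-sublinear 0<δ) L 0<L Y<L

      b≤L : (1# - p n) ⁻¹ ≤ L
      b≤L = *-cancelʳ-≤ 0<q (begin
        (1# - p n) ⁻¹ * (1# - p n)   ≈⟨ ⁻¹-inverseˡ (pos⇒≉0 0<q) ⟩
        1#                           ≤⟨ <⇒≤ 1<qL ⟩
        (1# - p n) * L               ≈⟨ *-comm _ _ ⟩
        L * (1# - p n)               ∎)

  -- The least admissible r, found by descending from an Archimedean bound. The condition d ≤ r
  -- makes room for the d + 1 clique blocks; the descent stops either at r = d or because r - 1 is
  -- too small, and then 2r + 1 is within 2 of R.
  round-up : ∀ R d → ∃[ r ] d ℕ.≤ r × R ≤ fromℕ (suc (2 ℕ.* r)) ×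
                            (r ≡ d ⊎ fromℕ (suc (2 ℕ.* r)) ≤ R + 2#)
  round-up R d = descend (proj₁ (archimedean R)) (begin
      R                             ≤⟨ <⇒≤ (proj₂ (archimedean R)) ⟩
      fromℕ N                       ≤⟨ fromℕ-mono-≤ {N} (ℕ.m≤n⇒m≤1+n (ℕ.≤-trans (ℕ.m≤n+m N d) (ℕ.m≤m+n (d ℕ.+ N) _))) ⟩
      fromℕ (suc (2 ℕ.* (d ℕ.+ N))) ∎)
    where
    N : ℕ
    N = proj₁ (archimedean R)

    descend : ∀ N → R ≤ fromℕ (suc (2 ℕ.* (d ℕ.+ N))) → ∃[ r ] d ℕ.≤ r × R ≤ fromℕ (suc (2 ℕ.* r)) ×
              (r ≡ d ⊎ fromℕ (suc (2 ℕ.* r)) ≤ R + 2#)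
    descend zero    R≤ = d , ℕ.≤-refl , ≡.subst (λ j → R ≤ fromℕ (suc (2 ℕ.* j))) (ℕ.+-identityʳ d) R≤ , inj₁ ≡.refl
    descend (suc N) R≤ with ≤-<-connex R (fromℕ (suc (2 ℕ.* (d ℕ.+ N))))
    ... | inj₁ R≤′ = descend N R≤′
    ... | inj₂ <R  = d ℕ.+ suc N , ℕ.m≤m+n d (suc N) , R≤ , inj₂ (begin
      fromℕ (suc (2 ℕ.* (d ℕ.+ suc N)))     ≡⟨ ≡.cong (λ j → fromℕ (suc j)) (≡.trans
                                                 (≡.cong (2 ℕ.*_) (ℕ.+-suc d N)) (ℕ.*-suc 2 (d ℕ.+ N))) ⟩
      fromℕ (suc (2 ℕ.+ 2 ℕ.* (d ℕ.+ N)))   ≈⟨ solve 1 (λ a → κ 1 :+ (κ 1 :+ (κ 1 :+ a)) := (κ 1 :+ a) :+ κ 2)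
                                                 refl (fromℕ (2 ℕ.* (d ℕ.+ N))) ⟩
      fromℕ (suc (2 ℕ.* (d ℕ.+ N))) + 2#    ≤⟨ +-monoˡ-≤ 2# (<⇒≤ <R) ⟩
      R + 2#                                ∎)

  -- The logarithm of the left side in parameters has error terms adding up to
  -- (16 + 2d + D) δ ln n.
  tolerance : ℝ → ℕ → ℕ → ℝ
  tolerance ε d D = ε * (fromℕ 17 + 2# * fromℕ d + fromℕ D) ⁻¹

  module _ {ε : ℝ} (0<ε : 0# < ε) (ε≤2 : ε ≤ 2#) (d D : ℕ) where

    private
      B δ : ℝ
      B = fromℕ 17 + 2# * fromℕ d + fromℕ D
      δ = tolerance ε d D

      0<B : 0# < B
      0<B = +-pos-nonNeg (+-pos-nonNeg (0<fromℕ {17} (ℕ.s≤s ℕ.z≤n)) (*-nonNeg (0≤fromℕ 2) (0≤fromℕ d))) (0≤fromℕ D)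

      δB : δ * B ≈ ε
      δB = *⁻¹-cancel ε 0<B

    0<tolerance : 0# < tolerance ε d D
    0<tolerance = *-pos 0<ε (⁻¹-pos 0<B)

    module _ {n : ℕ} {p : ℝ} (sparse : Sparse (tolerance ε d D) n p) where

      open Sparse sparse

      private
        b lnb R : ℝ
        b = (1# - p) ⁻¹
        lnb = ln b
        R = (2# - ε) * (ln (fromℕ n * p) * lnb ⁻¹)

        0≤δL : 0# ≤ δ * L
        0≤δL = *-nonNeg (<⇒≤ 0<tolerance) (<⇒≤ 0<L)

        0≤2-ε : 0# ≤ 2# - ε
        0≤2-ε = ≤⇒0≤- ε≤2

        0<b : 0# < b
        0<b = ⁻¹-pos (<⇒0<- p<1)

      parameters : ∃[ r ] d ℕ.≤ r × R ≤ fromℕ (suc (2 ℕ.* r)) ×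
        fromℕ 64 * fromℕ (suc (2 ℕ.* r)) ^ 4 * p ⁻¹ ^ D * b ^ (2 ℕ.* r) < fromℕ n * fromℕ n
      parameters = r , d≤r , R≤k , ln-cancel-< (*-pos 0<n 0<n) (begin-strict
        ln (fromℕ 64 * fromℕ k ^ 4 * p ⁻¹ ^ D * b ^ (2 ℕ.* r))
          ≈⟨ ln-* (*-pos (*-pos 0<64 (^-pos 4 0<k)) (^-pos D (⁻¹-pos 0<p))) (^-pos (2 ℕ.* r) 0<b) ⟩
        ln (fromℕ 64 * fromℕ k ^ 4 * p ⁻¹ ^ D) + ln (b ^ (2 ℕ.* r))
          ≈⟨ +-cong (ln-* (*-pos 0<64 (^-pos 4 0<k)) (^-pos D (⁻¹-pos 0<p))) (ln-^ (2 ℕ.* r) 0<b) ⟩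
        ln (fromℕ 64 * fromℕ k ^ 4) + ln (p ⁻¹ ^ D) + fromℕ (2 ℕ.* r) * lnb
          ≈⟨ +-congʳ (+-cong (ln-* 0<64 (^-pos 4 0<k)) (ln-^ D (⁻¹-pos 0<p))) ⟩
        ln (fromℕ 64) + ln (fromℕ k ^ 4) + fromℕ D * ln (p ⁻¹) + fromℕ (2 ℕ.* r) * lnb
          ≈⟨ +-congʳ (+-cong (+-congˡ (ln-^ 4 0<k)) (*-congˡ (ln-⁻¹ 0<p))) ⟩
        ln (fromℕ 64) + fromℕ 4 * ln (fromℕ k) + fromℕ D * - ln p + fromℕ (2 ℕ.* r) * lnb
          ≤⟨ +-mono-≤ (+-mono-≤ (+-mono-≤ ln64≤ (*-monoʳ-≤ (0≤fromℕ 4) lnk≤)) (*-monoʳ-≤ (0≤fromℕ D) -lnp≤))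
               (≤-trans (*-monoˡ-≤ (<⇒≤ 0<lnb) (fromℕ-mono-≤ (ℕ.n≤1+n (2 ℕ.* r)))) k*lnb≤) ⟩
        δ * L + fromℕ 4 * (fromℕ 3 * (δ * L)) + fromℕ D * (δ * L) + ((2# - ε) * L + (2# * fromℕ d + fromℕ 3) * (δ * L))
          ≈⟨ solve 5 (λ δ L ε d D →
               δ :* L :+ κ 4 :* (κ 3 :* (δ :* L)) :+ D :* (δ :* L) :+ ((κ 2 :- ε) :* L :+ (κ 2 :* d :+ κ 3) :* (δ :* L))
               := (L :+ L) :+ (δ :* (κ 17 :+ κ 2 :* d :+ D) :- ε) :* L :- δ :* L) refl δ L ε (fromℕ d) (fromℕ D) ⟩
        -- The error terms have coefficients 1, 12, D and 2d + 3. Their sum is one short of B, so δ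
        -- B = ε cancels them against -ε L and leaves -δ L for the strict inequality.
        L + L + (δ * B - ε) * L - δ * L
          ≈⟨ +-congʳ (+-congˡ (*-congʳ (trans (+-congʳ δB) (-‿inverseʳ ε)))) ⟩
        L + L + 0# * L - δ * L
          <⟨ <-by (*-pos 0<tolerance 0<L) (solve 2 (λ L x → (L :+ L) :- ((L :+ L) :+ κ 0 :* L :- x) := x) refl L (δ * L)) ⟩
        L + L
          ≈⟨ ln-* 0<n 0<n ⟨
        ln (fromℕ n * fromℕ n) ∎)
        where
        rounding = round-up R d

        r k : ℕ
        r = proj₁ rounding
        k = suc (2 ℕ.* r)

        d≤r : d ℕ.≤ r
        d≤r = proj₁ (proj₂ rounding)

        R≤k : R ≤ fromℕ k
        R≤k = proj₁ (proj₂ (proj₂ rounding))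

        0<64 : 0# < fromℕ 64
        0<64 = 0<fromℕ {64} (ℕ.s≤s ℕ.z≤n)

        0<k : 0# < fromℕ k
        0<k = 0<fromℕ {k} (ℕ.s≤s ℕ.z≤n)

        R*lnb≤ : R * lnb ≤ (2# - ε) * L
        R*lnb≤ = begin
          (2# - ε) * (ln (fromℕ n * p) * lnb ⁻¹) * lnb   ≈⟨ *-assoc _ _ _ ⟩
          (2# - ε) * (ln (fromℕ n * p) * lnb ⁻¹ * lnb)   ≈⟨ *-congˡ (*⁻¹-cancel _ 0<lnb) ⟩
          (2# - ε) * ln (fromℕ n * p)                    ≤⟨ *-monoʳ-≤ 0≤2-ε (ln-mono-≤ (*-pos 0<n 0<p)
              (≤-trans (*-monoʳ-≤ (<⇒≤ 0<n) (<⇒≤ p<1)) (≤-reflexive (*-identityʳ _)))) ⟩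
          (2# - ε) * L                                   ∎

        -- Either r = d, and k is a constant to be multiplied by ln (1/q) ≤ δ L, or k ≤ R + 2, and
        -- rounding costs at most 2 δ L. The right side covers both cases.
        k*lnb≤ : fromℕ k * lnb ≤ (2# - ε) * L + (2# * fromℕ d + fromℕ 3) * (δ * L)
        k*lnb≤ with proj₂ (proj₂ (proj₂ rounding))
        ... | inj₁ r≡d = begin
          fromℕ k * lnb
            ≡⟨ ≡.cong (λ r → fromℕ (suc (2 ℕ.* r)) * lnb) r≡d ⟩
          fromℕ (suc (2 ℕ.* d)) * lnb
            ≤⟨ *-monoʳ-≤ (0≤fromℕ (suc (2 ℕ.* d))) lnb≤ ⟩
          fromℕ (suc (2 ℕ.* d)) * (δ * L)
            ≈⟨ *-congʳ (+-congˡ (fromℕ-* 2 d)) ⟩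
          (1# + 2# * fromℕ d) * (δ * L)
            ≤⟨ ≤-by (+-nonNeg (*-nonNeg 0≤2-ε (<⇒≤ 0<L)) (*-nonNeg (0≤fromℕ 2) 0≤δL))
                (solve 3 (λ a d x → (a :+ (κ 2 :* d :+ κ 3) :* x) :- (κ 1 :+ κ 2 :* d) :* x := a :+ κ 2 :* x)
                  refl ((2# - ε) * L) (fromℕ d) (δ * L)) ⟩
          (2# - ε) * L + (2# * fromℕ d + fromℕ 3) * (δ * L) ∎
        ... | inj₂ k≤R+2 = begin
          fromℕ k * lnb
            ≤⟨ *-monoˡ-≤ (<⇒≤ 0<lnb) k≤R+2 ⟩
          (R + 2#) * lnb
            ≈⟨ distribʳ lnb R 2# ⟩
          R * lnb + 2# * lnb
            ≤⟨ +-mono-≤ R*lnb≤ (*-monoʳ-≤ (0≤fromℕ 2) lnb≤) ⟩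
          (2# - ε) * L + 2# * (δ * L)
            ≤⟨ ≤-by (*-nonNeg (+-nonNeg (<⇒≤ 0<1) (*-nonNeg (0≤fromℕ 2) (0≤fromℕ d))) 0≤δL)
                (solve 3 (λ a d x → (a :+ (κ 2 :* d :+ κ 3) :* x) :- (a :+ κ 2 :* x) := (κ 1 :+ κ 2 :* d) :* x)
                  refl ((2# - ε) * L) (fromℕ d) (δ * L)) ⟩
          (2# - ε) * L + (2# * fromℕ d + fromℕ 3) * (δ * L) ∎

        -- The crude bound k ≤ 2L/p, from p ≤ ln (1/q), suffices for the polynomial factor k⁴: it
        -- makes ln k at most ln 2 + ln L + ln (1/p), three terms of size at most δ L.
        k*p≤2L : fromℕ k * p ≤ 2# * L
        k*p≤2L = begin
          fromℕ k * p
            ≤⟨ *-monoʳ-≤ (<⇒≤ 0<k) p≤lnb ⟩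
          fromℕ k * lnb
            ≤⟨ k*lnb≤ ⟩
          (2# - ε) * L + (2# * fromℕ d + fromℕ 3) * (δ * L)
            ≤⟨ ≤-by (*-nonNeg (+-nonNeg (0≤fromℕ 14) (0≤fromℕ D)) 0≤δL) (solve 4 (λ y x d D →
                 (y :+ ((κ 17 :+ κ 2 :* d :+ D) :* x)) :- (y :+ (κ 2 :* d :+ κ 3) :* x) := (κ 14 :+ D) :* x)
                 refl ((2# - ε) * L) (δ * L) (fromℕ d) (fromℕ D)) ⟩
          (2# - ε) * L + B * (δ * L)
            ≈⟨ +-congˡ (trans (solve 3 (λ B δ L → B :* (δ :* L) := δ :* B :* L) refl B δ L) (*-congʳ δB)) ⟩
          (2# - ε) * L + ε * L
            ≈⟨ solve 2 (λ ε L → (κ 2 :- ε) :* L :+ ε :* L := κ 2 :* L) refl ε L ⟩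
          2# * L ∎

        lnk≤ : ln (fromℕ k) ≤ fromℕ 3 * (δ * L)
        lnk≤ = begin
          ln (fromℕ k)
            ≈⟨ solve 2 (λ a b → a := (a :+ b) :- b) refl (ln (fromℕ k)) (ln p) ⟩
          ln (fromℕ k) + ln p - ln p
            ≈⟨ +-congʳ (ln-* 0<k 0<p) ⟨
          ln (fromℕ k * p) - ln p
            ≤⟨ +-mono-≤ (ln-mono-≤ (*-pos 0<k 0<p) k*p≤2L) -lnp≤ ⟩
          ln (2# * L) + δ * L
            ≈⟨ +-congʳ (ln-* 0<2 0<L) ⟩
          ln 2# + ln L + δ * L
            ≤⟨ +-monoˡ-≤ (δ * L) (+-mono-≤ (≤-trans (ln-mono-≤ 0<2 (fromℕ-mono-≤ {2} {64} (ℕ.s≤s (ℕ.s≤s ℕ.z≤n)))) ln64≤) lnL≤) ⟩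
          δ * L + δ * L + δ * L
            ≈⟨ solve 1 (λ x → x :+ x :+ x := κ 3 :* x) refl (δ * L) ⟩
          fromℕ 3 * (δ * L) ∎

-- From blocks of size m to graphs on n vertices.

module DiameterSubgraphs (em : ExcludedMiddle 0ℓ) (ℛ : CompleteOrderedField) where

  open RingSolver em ℛ
  open Real em ℛ hiding (zero)
  open OrderedField em ℛ
  open LowerBound em ℛ

  private
    -- `k` and `n` are variables tied down by equations, so that matching on `refl` replaces
    -- transports along the block arithmetic.
    k≤u-blocks : ∀ {p} (0<p : 0# < p) (p<1 : p < 1#) d-1 r s m rest → 0 ℕ.< m →
      ∀ {k} → 2 ℕ.+ d-1 ℕ.+ s ≡ k → k ≡ suc (2 ℕ.* r) →
      ∀ {n} → Blocks.size m rest (2 ℕ.+ d-1 ℕ.+ s) ≡ n →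
      fromℕ 16 * (fromℕ k * fromℕ k) * p ⁻¹ ^ tri (2 ℕ.+ d-1)
        < fromℕ m * (1# - p) ^ r * (fromℕ m * (1# - p) ^ r) →
      k ℕ.≤ u (suc d-1) n p
    k≤u-blocks 0<p p<1 d-1 r s m rest 0<m ≡.refl k≡ ≡.refl h =
      ≤u (<⇒≤ 0<p) (<⇒≤ p<1) (ℕ.s≤s ℕ.z≤n)
        (SecondMoment.half<ℙ em ℛ 0<p p<1 m rest 0<m (2 ℕ.+ d-1) s r k≡
          (HasDiameterSubgraph (suc d-1) (2 ℕ.+ d-1 ℕ.+ s))
          (Copies.weight≉0⇒hasDiameterSubgraph em ℛ 0<p p<1 d-1 s m rest) h)

  -- The block size is the integer quotient m of n by k. Since n ≤ 2mk, the hypothesis divided by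
  -- 4k² gives 16 k² P^D Q^(2r) < m², and multiplying by q^(2r) yields the condition on blocks.
  k≤u : ∀ {n p} (0<p : 0# < p) (p<1 : p < 1#) d-1 r → suc d-1 ℕ.≤ r →
    fromℕ 64 * fromℕ (suc (2 ℕ.* r)) ^ 4 * p ⁻¹ ^ tri (2 ℕ.+ d-1) * (1# - p) ⁻¹ ^ (2 ℕ.* r)
      < fromℕ n * fromℕ n →
    suc (2 ℕ.* r) ℕ.≤ u (suc d-1) n p
  k≤u {n} {p} 0<p p<1 d-1 r d≤r h =
    k≤u-blocks 0<p p<1 d-1 r (k ℕ.∸ c) m rest 0<m (ℕ.m+[n∸m]≡n c≤k) ≡.refl n≡ (begin-strict
      fromℕ 16 * (K * K) * Pᴰ
        ≈⟨ trans (*-congˡ (x^n*x⁻¹^n (2 ℕ.* r) 0<q)) (*-identityʳ _) ⟨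
      fromℕ 16 * (K * K) * Pᴰ * (q ^ (2 ℕ.* r) * Q ^ (2 ℕ.* r))
        ≈⟨ solve 3 (λ a b c → a :* (b :* c) := a :* c :* b) refl (fromℕ 16 * (K * K) * Pᴰ) (q ^ (2 ℕ.* r)) (Q ^ (2 ℕ.* r)) ⟩
      fromℕ 16 * (K * K) * Pᴰ * Q ^ (2 ℕ.* r) * q ^ (2 ℕ.* r)
        <⟨ *-monoˡ-< (^-pos (2 ℕ.* r) 0<q) 16k²<m² ⟩
      M * M * q ^ (2 ℕ.* r)
        ≈⟨ *-congˡ (trans (reflexive (≡.cong (λ j → q ^ (r ℕ.+ j)) (ℕ.+-identityʳ r))) (^-homo-* q r r)) ⟩
      M * M * (q ^ r * q ^ r)
        ≈⟨ solve 2 (λ m a → m :* m :* (a :* a) := m :* a :* (m :* a)) refl M (q ^ r) ⟩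
      M * q ^ r * (M * q ^ r) ∎)
    where
    k c m rest : ℕ
    k    = suc (2 ℕ.* r)
    c    = 2 ℕ.+ d-1
    m    = n ℕ./ k
    rest = n ℕ.% k

    q Q K M Pᴰ : ℝ
    q  = 1# - p
    Q  = q ⁻¹
    K  = fromℕ k
    M  = fromℕ m
    Pᴰ = p ⁻¹ ^ tri c

    0<q : 0# < q
    0<q = <⇒0<- p<1

    c≤k : c ℕ.≤ k
    c≤k = ℕ.s≤s (ℕ.≤-trans d≤r (ℕ.m≤m+n r (r ℕ.+ 0)))

    n≡ : Blocks.size m rest (c ℕ.+ (k ℕ.∸ c)) ≡ n
    n≡ = ≡.trans (≡.cong (Blocks.size m rest) (ℕ.m+[n∸m]≡n c≤k)) (≡.trans (Blocks.size≡ m rest k)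
      (≡.trans (ℕ.+-comm (k ℕ.* m) rest) (≡.trans (≡.cong (rest ℕ.+_) (ℕ.*-comm k m)) (≡.sym (m≡m%n+[m/n]*n n k)))))

    0<K : 0# < K
    0<K = 0<fromℕ {k} (ℕ.s≤s ℕ.z≤n)

    1≤K : 1# ≤ K
    1≤K = ≤-trans (≤-reflexive (sym (+-identityʳ 1#))) (fromℕ-mono-≤ {1} {k} (ℕ.s≤s ℕ.z≤n))

    1≤W : 1# ≤ Pᴰ * Q ^ (2 ℕ.* r)
    1≤W = ≤-trans (≤-reflexive (sym (*-identityˡ 1#))) (*-mono-≤ (<⇒≤ 0<1)
      (1≤x^n (tri c) (x≤1⇒1≤x⁻¹ 0<p (<⇒≤ p<1))) (<⇒≤ 0<1)
      (1≤x^n (2 ℕ.* r) (x≤1⇒1≤x⁻¹ 0<q (≤-by (<⇒≤ 0<p) (solve 1 (λ p → κ 1 :- (κ 1 :- p) := p) refl p)))))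

    n<[m+1]k : n ℕ.< k ℕ.+ m ℕ.* k
    n<[m+1]k = ≡.subst (ℕ._< k ℕ.+ m ℕ.* k) (≡.sym (m≡m%n+[m/n]*n n k)) (ℕ.+-monoˡ-< (m ℕ.* k) (m%n<n n k))

    square-≤ : ∀ {i j} → i ℕ.≤ j → fromℕ i * fromℕ i ≤ fromℕ j * fromℕ j
    square-≤ {i} i≤j = *-mono-≤ (0≤fromℕ i) (fromℕ-mono-≤ i≤j) (0≤fromℕ i) (fromℕ-mono-≤ i≤j)

    k⁴W : fromℕ 64 * K ^ 4 * Pᴰ * Q ^ (2 ℕ.* r) ≈ fromℕ 64 * K ^ 4 * (Pᴰ * Q ^ (2 ℕ.* r))
    k⁴W = *-assoc _ _ _

    -- For n < k the hypothesis fails, because its left side is at least k². This is what makes the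
    -- blocks nonempty.
    k≤n : k ℕ.≤ n
    k≤n with ℕ.≤-<-connex k n
    ... | inj₁ k≤n = k≤n
    ... | inj₂ n<k = ⊥-elim (<⇒≱ h (begin
      fromℕ n * fromℕ n                            ≤⟨ square-≤ (ℕ.<⇒≤ n<k) ⟩
      K * K                                        ≈⟨ solve 1 (λ a → a :* a := a :^ 2) refl K ⟩
      K ^ 2                                        ≤⟨ ^-monoʳ-≤ {K} {2} {4} 1≤K (ℕ.s≤s (ℕ.s≤s ℕ.z≤n)) ⟩
      K ^ 4                                        ≤⟨ ≤-by (*-nonNeg (0≤fromℕ 63) (^-nonNeg 4 (<⇒≤ 0<K)))
                                                        (solve 1 (λ a → κ 64 :* a :- a := κ 63 :* a) refl (K ^ 4)) ⟩
      fromℕ 64 * K ^ 4                             ≈⟨ *-identityʳ _ ⟨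
      fromℕ 64 * K ^ 4 * 1#                        ≤⟨ *-monoʳ-≤ (*-nonNeg (0≤fromℕ 64) (^-nonNeg 4 (<⇒≤ 0<K))) 1≤W ⟩
      fromℕ 64 * K ^ 4 * (Pᴰ * Q ^ (2 ℕ.* r))      ≈⟨ k⁴W ⟨
      fromℕ 64 * K ^ 4 * Pᴰ * Q ^ (2 ℕ.* r)        ∎))

    0<m : 0 ℕ.< m
    0<m with m | n<[m+1]k
    ... | zero  | n<k+0 = ⊥-elim (ℕ.<⇒≱ n<k+0 (≡.subst (ℕ._≤ n) (≡.sym (ℕ.+-identityʳ k)) k≤n))
    ... | suc _ | _     = ℕ.s≤s ℕ.z≤n

    n≤2mk : n ℕ.≤ 2 ℕ.* (m ℕ.* k)
    n≤2mk = ℕ.≤-trans (ℕ.<⇒≤ n<[m+1]k) (ℕ.+-mono-≤ (k≤m*k m 0<m) (ℕ.m≤m+n (m ℕ.* k) 0))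
      where
      k≤m*k : ∀ m → 0 ℕ.< m → k ℕ.≤ m ℕ.* k
      k≤m*k (suc m) _ = ℕ.m≤m+n k (m ℕ.* k)

    16k²<m² : fromℕ 16 * (K * K) * Pᴰ * Q ^ (2 ℕ.* r) < M * M
    16k²<m² = *-cancelʳ-< {fromℕ 4 * (K * K)}
      (*-nonNeg (0≤fromℕ 4) (0≤x*x K)) (begin-strict
        fromℕ 16 * (K * K) * Pᴰ * Q ^ (2 ℕ.* r) * (fromℕ 4 * (K * K))
          ≈⟨ solve 3 (λ k a b → κ 16 :* (k :* k) :* a :* b :* (κ 4 :* (k :* k)) := κ 64 :* k :^ 4 :* a :* b)
               refl K Pᴰ (Q ^ (2 ℕ.* r)) ⟩
        fromℕ 64 * K ^ 4 * Pᴰ * Q ^ (2 ℕ.* r)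
          <⟨ h ⟩
        fromℕ n * fromℕ n
          ≤⟨ square-≤ n≤2mk ⟩
        fromℕ (2 ℕ.* (m ℕ.* k)) * fromℕ (2 ℕ.* (m ℕ.* k))
          ≈⟨ *-cong 2mk 2mk ⟩
        2# * (M * K) * (2# * (M * K))
          ≈⟨ solve 2 (λ m k → κ 2 :* (m :* k) :* (κ 2 :* (m :* k)) := m :* m :* (κ 4 :* (k :* k))) refl M K ⟩
        M * M * (fromℕ 4 * (K * K)) ∎)
      where
      2mk : fromℕ (2 ℕ.* (m ℕ.* k)) ≈ 2# * (M * K)
      2mk = trans (fromℕ-* 2 (m ℕ.* k)) (*-congˡ (fromℕ-* m k))

-- The asymptotic lower bound.

module Theorem24 (em : ExcludedMiddle 0ℓ) (ℛ : CompleteOrderedField) where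

  open RingSolver em ℛ
  open Real em ℛ hiding (zero)
  open OrderedField em ℛ
  open Eventual em ℛ
  open DiameterSubgraphs em ℛ

  private
    isLogarithm : Laws.IsLogarithm em ℛ exp ln
    isLogarithm = Logarithm.isLogarithm em ℛ exp ln (Exponential.isExponential em ℛ) (λ _ → ≡.refl)

  open Asymptotics em ℛ exp ln isLogarithm

  module _ (p : ℕ → ℝ) (0≤p≤1 : ∀ n → 0# ≤ p n × p n ≤ 1#)
    (p-large : ∀ α → 0# < α → TendsTo+∞ (λ n → p n * pow (fromℕ n) α))
    (q-large : TendsTo+∞ (λ n → (1# - p n) * ln (fromℕ n))) (d-1 : ℕ) where

    private
      Bound : ℝ → ℕ → Set
      Bound ε n = (2# - ε) * log ((1# - p n) ⁻¹) (fromℕ n * p n) ≤ fromℕ (u (suc d-1) n (p n))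

      sparse : ∀ {δ} → 0# < δ → Eventually (λ n → Sparse δ n (p n))
      sparse = eventually-sparse p 0≤p≤1 p-large q-large

    small-ε : ∀ {ε} → 0# < ε → ε ≤ 2# → Eventually (Bound ε)
    small-ε {ε} 0<ε ε≤2 = eventually-map bound (sparse (0<tolerance 0<ε ε≤2 (suc d-1) D))
      where
      D : ℕ
      D = tri (2 ℕ.+ d-1)

      bound : ∀ n → Sparse (tolerance ε (suc d-1) D) n (p n) → Bound ε n
      bound n sp =
        let r , d≤r , R≤k , h = parameters 0<ε ε≤2 (suc d-1) D sp
        in ≤-trans R≤k (fromℕ-mono-≤ (k≤u (Sparse.0<p sp) (Sparse.p<1 sp) d-1 r d≤r h))

    -- The factor 2 - ε is not positive, and the logarithm is nonnegative: ln (1/p) ≤ ln n gives ln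
    -- (np) ≥ 0, while ln (1/q) > 0. So the left side is at most 0.
    large-ε : ∀ {ε} → 2# ≤ ε → Eventually (Bound ε)
    large-ε {ε} 2≤ε = eventually-map bound (sparse 0<1)
      where
      bound : ∀ n → Sparse 1# n (p n) → Bound ε n
      bound n sp = begin
        (2# - ε) * log ((1# - p n) ⁻¹) (fromℕ n * p n)
          ≤⟨ ≤-by (*-nonNeg (≤⇒0≤- 2≤ε) 0≤log) (solve 2 (λ ε l → κ 0 :- (κ 2 :- ε) :* l := (ε :- κ 2) :* l) refl ε _) ⟩
        0#
          ≤⟨ 0≤fromℕ (u (suc d-1) n (p n)) ⟩
        fromℕ (u (suc d-1) n (p n)) ∎
        where
        open Sparse sp
        0≤ln[np] : 0# ≤ ln (fromℕ n * p n)
        0≤ln[np] = ≤-resp refl (sym (Laws.IsLogarithm.ln-* isLogarithm 0<n 0<p))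
          (≤-by (≤⇒0≤- -lnp≤) (solve 2 (λ L x → (L :+ x) :- κ 0 := κ 1 :* L :- (:- x)) refl (ln (fromℕ n)) (ln (p n))))
        0≤log : 0# ≤ log ((1# - p n) ⁻¹) (fromℕ n * p n)
        0≤log = *-nonNeg 0≤ln[np] (<⇒≤ (⁻¹-pos 0<lnb))

    eventually-bound : ∀ ε → 0# < ε → Eventually (Bound ε)
    eventually-bound ε 0<ε with ≤-<-connex ε 2#
    ... | inj₁ ε≤2 = small-ε 0<ε ε≤2
    ... | inj₂ 2<ε = large-ε (<⇒≤ 2<ε)

theorem24 :
    (em : ExcludedMiddle 0ℓ) (ℛ : CompleteOrderedField) →
    let open Real em ℛ in
    (p : ℕ → ℝ) →
    (∀ n → 0# ≤ p n × p n ≤ 1#) →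
    (∀ α → 0# < α → TendsTo+∞ (λ n → p n * pow (fromℕ n) α)) →
    TendsTo+∞ (λ n → (1# - p n) * ln (fromℕ n)) →
    ∀ d → 1 ℕ.≤ d →
    ∀ ε → 0# < ε →
    ∃[ n₀ ] ∀ n → n₀ ℕ.≤ n →
      (2# - ε) * log ((1# - p n) ⁻¹) (fromℕ n * p n) ≤ fromℕ (u d n (p n))
theorem24 em ℛ p 0≤p≤1 p-large q-large (suc d-1) _ =
  Theorem24.eventually-bound em ℛ p 0≤p≤1 p-large q-large d-1
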